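{- Let $G$ be a simple quadrangulation graph with $n\geq 4$ vertices. Then the Wiener index $W(G)=\sum_{\{u,v\}\subseteq V(G)} d_G(u,v)$ satisfies \[ W(G)\leq \begin{cases} \frac{1}{12}n^3+\frac{7}{6}n-2, & n\equiv 0 \pmod 2,\\[2pt] \frac{1}{12}n^3+\frac{11}{12}n-1, & n\equiv 1 \pmod 2. \end{cases} \]
   Context: A quadrangulation graph is a finite, simple, connected plane graph (a graph embedded in the plane) in which every face, including the outer face, is bounded by a cycle of length 4. $d_G(u,v)$ denotes the distance (length of a shortest path) between $u$ and $v$ in $G$, and the sum defining $W(G)$ runs over all unordered pairs of distinct vertices. -}

module Defs where

open import Data.Nat using (ℕ; zero; suc; _+_; _*_; _^_; _≤_; _<_)
open import Data.Fin using (Fin; toℕ)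
import Data.Sum
import Data.Nat.Properties
open import Data.Nat.Properties using (_≤?_)
open import Data.List using (List; []; _∷_; length; filter; map; concatMap; allFin)
open import Data.Nat.ListAction using (sum)
open import Data.Product using (Σ; ∃; _×_; _,_)
open import Relation.Binary.PropositionalEquality using (_≡_; _≢_)
open import Relation.Nullary using (¬_; Dec; yes; no)

open import Data.Nat using (_<?_)

iter : {A : Set} → (A → A) → ℕ → A → A
iter f zero    x = x
iter f (suc k) x = f (iter f k x)

-- A plane graph on vertex set Fin n, given combinatorially as a map
-- (rotation system): darts Fin D, each dart has a tail vertex, α is the
-- fixed-point-free involution pairing the two darts of an edge, and σ is
-- the rotation permutation, whose cycles are exactly the sets of darts at
-- each vertex (cyclic order of darts around the vertex in the embedding).
-- Faces are the orbits of φ = σ ∘ α.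

record Map (n : ℕ) : Set where
  field
    D       : ℕ
    tail    : Fin D → Fin n
    α       : Fin D → Fin D
    σ       : Fin D → Fin D
    σ⁻¹     : Fin D → Fin D
    α-invol : ∀ d → α (α d) ≡ d
    α-fpf   : ∀ d → α d ≢ d
    σσ⁻¹    : ∀ d → σ (σ⁻¹ d) ≡ d
    σ⁻¹σ    : ∀ d → σ⁻¹ (σ d) ≡ d
    σ-tail  : ∀ d → tail (σ d) ≡ tail d
    σ-trans : ∀ d e → tail d ≡ tail e → ∃ λ k → iter σ k d ≡ e

  head : Fin D → Fin n
  head d = tail (α d)

  φ : Fin D → Fin D
  φ d = σ (α d)

  faceRep? : (d : Fin D) → Dec (∀ k → k < D → toℕ d ≤ toℕ (iter φ k d))
  faceRep? d = go D
    where
      open import Data.Nat.Properties using (≤-refl; m<n⇒m≤1+n; ≤-pred)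
      go : (m : ℕ) → Dec (∀ k → k < D → toℕ d ≤ toℕ (iter φ k d))
      go _ = allBelow D
        where
          allBelow : (m : ℕ) → Dec (∀ k → k < m → toℕ d ≤ toℕ (iter φ k d))
          allBelow zero = yes (λ k ())
          allBelow (suc m) with allBelow m | toℕ d ≤? toℕ (iter φ m d)
          ... | no ¬p | _ = no (λ f → ¬p (λ k k<m → f k (Data.Nat.Properties.m<n⇒m<1+n k<m)))
          ... | yes p | no ¬q = no (λ f → ¬q (f m ≤-refl))
          ... | yes p | yes q = yes h
            where
              h : ∀ k → k < suc m → toℕ d ≤ toℕ (iter φ k d)
              h k k<sm with Data.Nat.Properties.m≤n⇒m<n∨m≡n (≤-pred k<sm)
              ... | Data.Sum.inj₁ k<m = p k k<m
              ... | Data.Sum.inj₂ Relation.Binary.PropositionalEquality.refl = q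

  faceCount : ℕ
  faceCount = length (filter faceRep? (allFin D))

  -- number of edges is D / 2; Euler's formula V - E + F = 2 for a connected
  -- map characterises genus 0, i.e. a plane embedding.  Written as
  -- 2(V + F) = D + 4 to avoid subtraction/division.
  Planar : Set
  Planar = 2 * (n + faceCount) ≡ D + 4

  data Walk : ℕ → Fin n → Fin n → Set where
    here : ∀ u → Walk 0 u u
    step : ∀ {k v} (d : Fin D) → Walk k (head d) v → Walk (suc k) (tail d) v

  Simple : Set
  Simple = (∀ d → tail d ≢ head d)
         × (∀ d e → tail d ≡ tail e → head d ≡ head e → d ≡ e)

  Connected : Set
  Connected = ∀ u v → ∃ λ k → Walk k u v

  AllFaces4Cycles : Set
  AllFaces4Cycles = ∀ d →
      iter φ 4 d ≡ d × φ d ≢ d × iter φ 2 d ≢ d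
    × tail d ≢ tail (iter φ 1 d) × tail d ≢ tail (iter φ 2 d) × tail d ≢ tail (iter φ 3 d)
    × tail (iter φ 1 d) ≢ tail (iter φ 2 d) × tail (iter φ 1 d) ≢ tail (iter φ 3 d)
    × tail (iter φ 2 d) ≢ tail (iter φ 3 d)

  IsDistance : (Fin n → Fin n → ℕ) → Set
  IsDistance dist = ∀ u v → Walk (dist u v) u v × (∀ k → Walk k u v → dist u v ≤ k)

record Quadrangulation (n : ℕ) : Set where
  field
    M         : Map n
    simple    : Map.Simple M
    connected : Map.Connected M
    planar    : Map.Planar M
    faces4    : Map.AllFaces4Cycles M
  open Map M public

pairSum : (n : ℕ) → (Fin n → Fin n → ℕ) → ℕ
pairSum n f = sum (concatMap (λ u → map (λ v → f u v)
                     (filter (λ v → toℕ u <? toℕ v) (allFin n))) (allFin n))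

Wiener : (n : ℕ) → (Fin n → Fin n → ℕ) → ℕ
Wiener = pairSum

{-# OPTIONS --safe #-}
-- Work with quadrangulated spheres whose 1-skeleton is an isometric subset S of
-- V(G), by strong induction on |S|.  A cut {a, c} of such a sphere has a face
-- (p₁ a q₁ c) and a face (q₂ a p₂ c) and no other face meeting both sides A and
-- C, so A ∪ {a, c} and C ∪ {a, c} are again isometric spheres, and
--   W(S) = W(A ∪ {a, c}) + W(C ∪ {a, c}) - 2 + Σ_{x ∈ A, y ∈ C} d(x, y).
-- That only two faces cross follows from Jordan's theorem for fundamental cycles
-- of a spanning tree, and that the pieces are spheres from V - E + F ≤ 2 for each
-- of them, both by counting the cotree edges that connect the faces.
--
-- * If no cut exists, all inner distance levels have at least 3 vertices, and
--   summing the resulting bound on Σ_y d(x, y), which improves with the degree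
--   of x, over all x suffices because the degrees add up to 4n - 8.
-- * If some vertex v has degree 2, remove v; if n is odd and level 2 around v has
--   only two vertices, remove one of the neighbours of v as well.
-- * Otherwise take a cut with |A| minimal.  The levels in A around {a, c} have at
--   least 3 vertices, those in C at least 2, with one exception for each of the
--   at most |A| - 3 vertices x of A that are not equidistant from a and c.
module Submission where

open import Defs
open import Data.Nat using (ℕ; zero; suc; _+_; _*_; _^_; _∸_; _≤_; _<_; z≤n; s≤s; _≤?_; _<?_; ⌊_/2⌋)
import Data.Nat as ℕ
open import Data.Nat.Properties
open import Data.Nat.DivMod using (_%_; [m+kn]%n≡m%n)
open import Data.Nat.ListAction using (sum)
open import Data.Nat.ListAction.Properties using (sum-++)
open import Data.Nat.Tactic.RingSolver using (solve-∀)
open import Data.Fin using (Fin; zero; suc; toℕ; combine; remQuot; _↑ˡ_; _↑ʳ_)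
open import Data.Fin.Properties using (any?; toℕ-injective; remQuot-combine; combine-remQuot; combine-injective) renaming (_≟_ to _≟F_)
open import Data.Bool using (Bool; true; false; _∧_; not; if_then_else_)
import Data.Bool as Bool
import Data.Bool.Properties as Boolₚ
open import Data.List using (List; filter; length; map; concatMap; allFin; tabulate)
open import Data.Product using (∃; _×_; _,_; proj₁; proj₂)
open import Data.Sum using (_⊎_; inj₁; inj₂; [_,_]′)
open import Data.Empty using (⊥; ⊥-elim)
open import Function using (_∘_; id; case_of_)
open import Relation.Binary.Definitions using (tri<; tri≈; tri>)
open import Relation.Binary.PropositionalEquality using (_≡_; _≢_; refl; sym; trans; cong; cong₂; subst; subst₂; module ≡-Reasoning)
open import Relation.Nullary using (¬_; Dec; yes; no; does; contradiction)
open import Relation.Nullary.Decidable using (_×-dec_; _⊎-dec_; ¬?; dec-true; dec-false; decidable-stable)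

-- Sums and finite sets

-- Over ordered pairs the bound is n³/6 up to linear terms, and a vertex whose inner levels all have
-- 3 vertices already has distance sum about n²/6. So the case without cuts agrees with the bound in
-- the cubic term, and degree at least 3 alone would leave an excess of quadratic order; the average
-- degree 4 - 8/n removes exactly this excess. The vertices of degree 2 are as delicate: passing
-- from an odd sphere to an even one by such a vertex leaves no slack at all, and passing from 2k to
-- 2k + 1 vertices only allows the distance sum k² + 2, where levels of size 2 give k² + k. Hence
-- the occasional removal of two vertices at once. Isometric subsets make it possible to keep one
-- metric `d` throughout: a piece inherits distances, adjacency and bipartiteness, and only the
-- rotation `nx` changes. Planarity enters solely as the equation 4 |S| = (sum of degrees) + 8,
-- which can be passed to the pieces because their degree sums add up to that of the whole.

𝟙 : Bool → ℕ
𝟙 true  = 1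
𝟙 false = 0

∑ : ∀ {n} → (Fin n → ℕ) → ℕ
∑ {zero}  f = 0
∑ {suc n} f = f zero + ∑ (f ∘ suc)

∑-cong : ∀ {n} {f g : Fin n → ℕ} → (∀ i → f i ≡ g i) → ∑ f ≡ ∑ g
∑-cong {zero}  h = refl
∑-cong {suc n} h = cong₂ _+_ (h zero) (∑-cong (h ∘ suc))

∑-mono : ∀ {n} {f g : Fin n → ℕ} → (∀ i → f i ≤ g i) → ∑ f ≤ ∑ g
∑-mono {zero}  h = z≤n
∑-mono {suc n} h = +-mono-≤ (h zero) (∑-mono (h ∘ suc))

interchange : ∀ a b c d → (a + b) + (c + d) ≡ (a + c) + (b + d)
interchange = solve-∀

∑-+ : ∀ {n} (f g : Fin n → ℕ) → ∑ (λ i → f i + g i) ≡ ∑ f + ∑ g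
∑-+ {zero}  f g = refl
∑-+ {suc n} f g = trans (cong (f zero + g zero +_) (∑-+ (f ∘ suc) (g ∘ suc)))
                        (interchange (f zero) (g zero) _ _)

∑-* : ∀ {n} k (f : Fin n → ℕ) → ∑ (λ i → k * f i) ≡ k * ∑ f
∑-* {zero}  k f = sym (*-zeroʳ k)
∑-* {suc n} k f = trans (cong (k * f zero +_) (∑-* k (f ∘ suc)))
                        (sym (*-distribˡ-+ k (f zero) _))

∑-const : ∀ n k → ∑ {n} (λ _ → k) ≡ n * k
∑-const zero    k = refl
∑-const (suc n) k = cong (k +_) (∑-const n k)

∑-zero : ∀ n → ∑ {n} (λ _ → 0) ≡ 0
∑-zero n = trans (∑-const n 0) (*-zeroʳ n)

∑-swap : ∀ {m n} (f : Fin m → Fin n → ℕ) →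
         ∑ (λ i → ∑ (λ j → f i j)) ≡ ∑ (λ j → ∑ (λ i → f i j))
∑-swap {zero}  {n} f = sym (∑-zero n)
∑-swap {suc m} {n} f =
  trans (cong (∑ (f zero) +_) (∑-swap (f ∘ suc))) (sym (∑-+ (f zero) _))

∑-δ : ∀ {n} (j : Fin n) (f : Fin n → ℕ) → ∑ (λ i → 𝟙 (does (i ≟F j)) * f i) ≡ f j
∑-δ {suc n} zero f = trans (cong (f zero + 0 +_) (∑-zero n)) (trans (+-identityʳ _) (+-identityʳ _))
∑-δ {suc n} (suc j) f = ∑-δ j (f ∘ suc)

∑-single : ∀ {n} (f : Fin n → ℕ) j → f j ≤ ∑ f
∑-single f zero    = m≤m+n (f zero) _
∑-single f (suc j) = ≤-trans (∑-single (f ∘ suc) j) (m≤n+m _ (f zero))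

∑-++ : ∀ m {n} (f : Fin (m + n) → ℕ) → ∑ f ≡ ∑ (λ i → f (i ↑ˡ n)) + ∑ (λ j → f (m ↑ʳ j))
∑-++ zero    f = refl
∑-++ (suc m) f = trans (cong (f zero +_) (∑-++ m (f ∘ suc))) (sym (+-assoc (f zero) _ _))

∑-pair : ∀ m {n} (f : Fin (m * n) → ℕ) → ∑ f ≡ ∑ {m} (λ i → ∑ {n} (λ j → f (combine i j)))
∑-pair zero        f = refl
∑-pair (suc m) {n} f = trans (∑-++ n f) (cong (∑ (λ j → f (j ↑ˡ (m * n))) +_) (∑-pair m (λ j → f (n ↑ʳ j))))

dec-true⁻ : ∀ {P : Set} (d : Dec P) → does d ≡ true → P
dec-true⁻ (yes p) _ = p

does-⇔ : ∀ {P Q : Set} (p : Dec P) (q : Dec Q) → (P → Q) → (Q → P) → does p ≡ does q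
does-⇔ (yes p) (yes q) f g = refl
does-⇔ (no p) (no q) f g = refl
does-⇔ (yes p) (no q) f g = contradiction (f p) q
does-⇔ (no p) (yes q) f g = contradiction (g q) p

true≢false : ∀ {b} → b ≡ true → b ≡ false → ⊥
true≢false refl ()

¬true : ∀ {b} → ¬ (b ≡ true) → b ≡ false
¬true {false} _ = refl
¬true {true}  h = ⊥-elim (h refl)

Sub : ℕ → Set
Sub N = Fin N → Bool

infix 4 _∈_ _∈?_

_∈_ : ∀ {N} → Fin N → Sub N → Set
x ∈ S = S x ≡ true

_∈?_ : ∀ {N} (x : Fin N) (S : Sub N) → Dec (x ∈ S)
x ∈? S = S x Bool.≟ true

⟦_⟧ : ∀ {N} {P : Fin N → Set} → (∀ x → Dec (P x)) → Sub N
⟦ P? ⟧ x = does (P? x)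

∣_∣ : ∀ {N} → Sub N → ℕ
∣ S ∣ = ∑ (𝟙 ∘ S)

𝟙≡1 : ∀ {b} → b ≡ true → 𝟙 b ≡ 1
𝟙≡1 refl = refl

𝟙≡0 : ∀ {b} → ¬ (b ≡ true) → 𝟙 b ≡ 0
𝟙≡0 h = cong 𝟙 (¬true h)

𝟙-mono : ∀ {b c} → (b ≡ true → c ≡ true) → 𝟙 b ≤ 𝟙 c
𝟙-mono {false} h = z≤n
𝟙-mono {true} {c} h rewrite h refl = ≤-refl

𝟙-dec : ∀ {P Q : Set} (p : Dec P) (q : Dec Q) → (P → Q) → (Q → P) → 𝟙 (does p) ≡ 𝟙 (does q)
𝟙-dec p q f g = cong 𝟙 (does-⇔ p q f g)

𝟙-⊎ : ∀ {P Q R : Set} (p : Dec P) (q : Dec Q) (r : Dec R) →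
      (P → Q ⊎ R) → (Q → P) → (R → P) → (Q → R → ⊥) → 𝟙 (does p) ≡ 𝟙 (does q) + 𝟙 (does r)
𝟙-⊎ (yes p) (yes q) (yes r) f g h i = ⊥-elim (i q r)
𝟙-⊎ (yes p) (yes q) (no r) f g h i = refl
𝟙-⊎ (yes p) (no q) (yes r) f g h i = refl
𝟙-⊎ (yes p) (no q) (no r) f g h i = [ ⊥-elim ∘ q , ⊥-elim ∘ r ]′ (f p)
𝟙-⊎ (no p) (yes q) r f g h i = ⊥-elim (p (g q))
𝟙-⊎ (no p) (no q) (yes r) f g h i = ⊥-elim (p (h r))
𝟙-⊎ (no p) (no q) (no r) f g h i = refl

𝟙-≟ : ∀ b → 𝟙 (does (b Bool.≟ true)) ≡ 𝟙 b
𝟙-≟ true  = refl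
𝟙-≟ false = refl

_∖_ : ∀ {N} → Sub N → Fin N → Sub N
(S ∖ x) y = S y ∧ not (does (y ≟F x))

∖-∈ : ∀ {N} (S : Sub N) {x y} → y ∈ S → y ≢ x → y ∈ (S ∖ x)
∖-∈ S {x} {y} h y≢x rewrite h | dec-false (y ≟F x) y≢x = refl

∖-∈⁻ : ∀ {N} (S : Sub N) {x y} → y ∈ (S ∖ x) → y ∈ S × y ≢ x
∖-∈⁻ S {x} {y} h with S y | y ≟F x
... | true | no q = refl , q

card-∖ : ∀ {N} (S : Sub N) {x} → x ∈ S → ∣ S ∣ ≡ suc ∣ S ∖ x ∣
card-∖ S {x} h = begin
  ∑ (𝟙 ∘ S)                                                     ≡⟨ ∑-cong pt ⟩
  ∑ (λ y → 𝟙 (does (y ≟F x)) * 𝟙 (S y) + 𝟙 ((S ∖ x) y))          ≡⟨ ∑-+ (λ y → 𝟙 (does (y ≟F x)) * 𝟙 (S y)) (𝟙 ∘ (S ∖ x)) ⟩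
  ∑ (λ y → 𝟙 (does (y ≟F x)) * 𝟙 (S y)) + ∣ S ∖ x ∣              ≡⟨ cong (_+ ∣ S ∖ x ∣) (∑-δ x _) ⟩
  𝟙 (S x) + ∣ S ∖ x ∣                                           ≡⟨ cong (_+ ∣ S ∖ x ∣) (𝟙≡1 h) ⟩
  suc ∣ S ∖ x ∣ ∎
  where
  open ≡-Reasoning
  pt : ∀ y → 𝟙 (S y) ≡ 𝟙 (does (y ≟F x)) * 𝟙 (S y) + 𝟙 ((S ∖ x) y)
  pt y with S y | does (y ≟F x)
  ... | true  | true  = refl
  ... | true  | false = refl
  ... | false | true  = refl
  ... | false | false = refl

card-mono : ∀ {N} {S T : Sub N} → (∀ x → x ∈ S → x ∈ T) → ∣ S ∣ ≤ ∣ T ∣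
card-mono h = ∑-mono (λ x → 𝟙-mono (h x))

card-< : ∀ {N} {S T : Sub N} x → (∀ y → y ∈ S → y ∈ T) → x ∈ T → ¬ (x ∈ S) → ∣ S ∣ < ∣ T ∣
card-< {S = S} {T} x h xT xS =
  subst (suc ∣ S ∣ ≤_) (sym (card-∖ T xT))
    (s≤s (card-mono {S = S} {T = T ∖ x} (λ y yS → ∖-∈ T (h y yS) (λ { refl → xS yS }))))

card-empty : ∀ {N} (S : Sub N) → (∀ x → ¬ (x ∈ S)) → ∣ S ∣ ≡ 0
card-empty {N} S h = trans (∑-cong (λ x → 𝟙≡0 (h x))) (∑-zero N)

card-single : ∀ {N} (S : Sub N) {x} → x ∈ S → (∀ {y} → y ∈ S → y ≡ x) → ∣ S ∣ ≡ 1
card-single S {x} h only = trans (card-∖ S h) (cong suc (card-empty (S ∖ x) (λ y p → proj₂ (∖-∈⁻ S p) (only (proj₁ (∖-∈⁻ S p))))))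

card-≥1 : ∀ {N} (S : Sub N) {x} → x ∈ S → 1 ≤ ∣ S ∣
card-≥1 S h = subst (1 ≤_) (sym (card-∖ S h)) (s≤s z≤n)

card-≥2 : ∀ {N} (S : Sub N) {x y} → x ∈ S → y ∈ S → x ≢ y → 2 ≤ ∣ S ∣
card-≥2 S {x} {y} hx hy ne = subst (2 ≤_) (sym (card-∖ S hx))
  (s≤s (card-≥1 (S ∖ x) (∖-∈ S hy (ne ∘ sym))))

card-≥3 : ∀ {N} (S : Sub N) {x y z} → x ∈ S → y ∈ S → z ∈ S → x ≢ y → x ≢ z → y ≢ z → 3 ≤ ∣ S ∣
card-≥3 S {x} hx hy hz xy xz yz = subst (3 ≤_) (sym (card-∖ S hx))
  (s≤s (card-≥2 (S ∖ x) (∖-∈ S hy (xy ∘ sym)) (∖-∈ S hz (xz ∘ sym)) yz))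

card-inhabited : ∀ {N} (S : Sub N) → 1 ≤ ∣ S ∣ → ∃ λ x → x ∈ S
card-inhabited S h with any? (_∈? S)
... | yes e = e
... | no ¬e = ⊥-elim (<-irrefl (sym (card-empty S (λ x p → ¬e (x , p)))) h)

card-two : ∀ {N} (S : Sub N) → 2 ≤ ∣ S ∣ → ∃ λ x → ∃ λ y → x ∈ S × y ∈ S × x ≢ y
card-two S h with card-inhabited S (≤-trans (s≤s z≤n) h)
... | x , hx with card-inhabited (S ∖ x) (≤-pred (subst (2 ≤_) (card-∖ S hx) h))
... | y , hy with ∖-∈⁻ S hy
... | yS , y≢x = x , y , hx , yS , y≢x ∘ sym

card-few : ∀ {N} (S : Sub N) → ¬ (2 ≤ ∣ S ∣) → (∀ x → ¬ (x ∈ S)) ⊎ (∃ λ z → z ∈ S × (∀ x → x ∈ S → x ≡ z))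
card-few S h with any? (_∈? S)
... | no ¬e = inj₁ λ x p → ¬e (x , p)
... | yes (z , hz) = inj₂ (z , hz , λ x p → case x ≟F z of λ where
        (yes e) → e
        (no ne) → ⊥-elim (h (card-≥2 S p hz ne)))

card-∪ : ∀ {N} {S T U : Sub N} → (∀ x → 𝟙 (U x) ≡ 𝟙 (S x) + 𝟙 (T x)) → ∣ U ∣ ≡ ∣ S ∣ + ∣ T ∣
card-∪ {S = S} {T} h = trans (∑-cong h) (∑-+ (𝟙 ∘ S) (𝟙 ∘ T))

-- Turns a polynomial inequality into an identity for the ring solver: the slack `s` is written out,
-- and no subtraction of natural numbers occurs.
≤-from-slack : ∀ {X Y G H} s → X ≤ Y → (G + Y) + s ≡ H + X → G ≤ H
≤-from-slack {X} {Y} {G} {H} s X≤Y e = +-cancelʳ-≤ X G H (begin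
  G + X       ≤⟨ +-monoʳ-≤ G X≤Y ⟩
  G + Y       ≤⟨ m≤m+n (G + Y) s ⟩
  G + Y + s   ≡⟨ e ⟩
  H + X       ∎)
  where open ≤-Reasoning

-- Sums over distance levels

Σ< : ℕ → (ℕ → ℕ) → ℕ
Σ< zero    f = 0
Σ< (suc K) f = f 0 + Σ< K (f ∘ suc)

∑-Σ< : ∀ {n} K (g : Fin n → ℕ → ℕ) → ∑ (λ x → Σ< K (g x)) ≡ Σ< K (λ k → ∑ (λ x → g x k))
∑-Σ< {n} zero g = ∑-zero n
∑-Σ< (suc K) g = trans (∑-+ (λ x → g x 0) (λ x → Σ< K (g x ∘ suc)))
                       (cong (∑ (λ x → g x 0) +_) (∑-Σ< K (λ x → g x ∘ suc)))

Σ<-zero : ∀ K → Σ< K (λ _ → 0) ≡ 0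
Σ<-zero zero    = refl
Σ<-zero (suc K) = Σ<-zero K

Σ<-indicator : ∀ K m → m ≤ K → Σ< K (λ k → 𝟙 (does (k <? m))) ≡ m
Σ<-indicator K       zero    _       = Σ<-zero K
Σ<-indicator (suc K) (suc m) (s≤s h) = cong suc (Σ<-indicator K m h)

Far Lev : ∀ {N} → Sub N → (Fin N → ℕ) → ℕ → Sub N
Far X δ k = ⟦ (λ x → (x ∈? X) ×-dec (k <? δ x)) ⟧
Lev X δ k = ⟦ (λ x → (x ∈? X) ×-dec (δ x ℕ.≟ k)) ⟧

∈Far : ∀ {N} (X : Sub N) δ k {x} → x ∈ X → k < δ x → x ∈ Far X δ k
∈Far X δ k {x} p q = dec-true ((x ∈? X) ×-dec (k <? δ x)) (p , q)

Far∈ : ∀ {N} (X : Sub N) δ k {x} → x ∈ Far X δ k → x ∈ X × k < δ x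
Far∈ X δ k {x} = dec-true⁻ ((x ∈? X) ×-dec (k <? δ x))

∈Lev : ∀ {N} (X : Sub N) δ k {x} → x ∈ X → δ x ≡ k → x ∈ Lev X δ k
∈Lev X δ k {x} p q = dec-true ((x ∈? X) ×-dec (δ x ℕ.≟ k)) (p , q)

Lev∈ : ∀ {N} (X : Sub N) δ k {x} → x ∈ Lev X δ k → x ∈ X × δ x ≡ k
Lev∈ X δ k {x} = dec-true⁻ ((x ∈? X) ×-dec (δ x ℕ.≟ k))

layer-cake : ∀ {N} (X : Sub N) (δ : Fin N → ℕ) →
             ∃ λ K → ∑ (λ x → 𝟙 (X x) * δ x) ≡ Σ< K (λ k → ∣ Far X δ k ∣)
-- `∑ δ` serves as a cutoff that no value of `δ` exceeds.
layer-cake X δ = ∑ δ , trans (∑-cong pt) (∑-Σ< (∑ δ) (λ x k → 𝟙 (Far X δ k x)))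
  where
  pt : ∀ x → 𝟙 (X x) * δ x ≡ Σ< (∑ δ) (λ k → 𝟙 (Far X δ k x))
  pt x with X x
  ... | false = sym (Σ<-zero (∑ δ))
  ... | true  = trans (+-identityʳ (δ x)) (sym (Σ<-indicator (∑ δ) (δ x) (∑-single δ x)))

Far-step : ∀ {N} (X : Sub N) δ k → ∣ Far X δ k ∣ ≡ ∣ Far X δ (suc k) ∣ + ∣ Lev X δ (suc k) ∣
Far-step X δ k = card-∪ {S = Far X δ (suc k)} {T = Lev X δ (suc k)} pt
  where
  pt : ∀ x → 𝟙 (Far X δ k x) ≡ 𝟙 (Far X δ (suc k) x) + 𝟙 (Lev X δ (suc k) x)
  pt x with X x
  ... | false = refl
  ... | true  = 𝟙-⊎ (k <? δ x) (suc k <? δ x) (δ x ℕ.≟ suc k)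
    (λ k<δ → case m≤n⇒m<n∨m≡n k<δ of λ where
      (inj₁ q) → inj₁ q
      (inj₂ e) → inj₂ (sym e))
    (<-trans (n<1+n k)) (λ e → ≤-reflexive (sym e)) (λ q e → <-irrefl (sym e) q)

-- The first alternative is there for the outermost level, which may be small: only levels with
-- something beyond them are known to have `w` vertices.
Step : ℕ → (ℕ → ℕ) → ℕ → Set
Step w f k = f (suc k) ≡ 0 ⊎ f (suc k) + w ≤ f k

Lev⇒Step : ∀ {N} (X : Sub N) δ w k →
           (1 ≤ ∣ Far X δ (suc k) ∣ → w ≤ ∣ Lev X δ (suc k) ∣) → Step w (λ k → ∣ Far X δ k ∣) k
Lev⇒Step X δ w k h with 1 ≤? ∣ Far X δ (suc k) ∣
... | no p  = inj₁ (n<1⇒n≡0 (≰⇒> p))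
... | yes p = inj₂ (≤-trans (+-monoʳ-≤ ∣ Far X δ (suc k) ∣ (h p)) (≤-reflexive (sym (Far-step X δ k))))

-- m + (m - 2) + (m - 4) + ..., the largest distance sum of m vertices when every level but the last
-- has at least 2 of them; `W₃` is its analogue for 3.
W₂ : ℕ → ℕ
W₂ 0             = 0
W₂ 1             = 1
W₂ (suc (suc m)) = suc (suc m) + W₂ m

W₂-suc : ∀ m → W₂ m ≤ W₂ (suc m)
W₂-suc 0             = z≤n
W₂-suc 1             = s≤s z≤n
W₂-suc (suc (suc m)) = +-mono-≤ (n≤1+n (2 + m)) (W₂-suc m)

mono-from-suc : (f : ℕ → ℕ) → (∀ m → f m ≤ f (suc m)) → ∀ {m n} → m ≤ n → f m ≤ f n
mono-from-suc f h {n = zero}  z≤n = ≤-refl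
mono-from-suc f h {n = suc n} z≤n = ≤-trans (mono-from-suc f h {n = n} z≤n) (h n)
mono-from-suc f h (s≤s p) = mono-from-suc (f ∘ suc) (h ∘ suc) p

W₂-mono : ∀ {m n} → m ≤ n → W₂ m ≤ W₂ n
W₂-mono = mono-from-suc W₂ W₂-suc

m≤W₂ : ∀ m → m ≤ W₂ m
m≤W₂ 0             = z≤n
m≤W₂ 1             = ≤-refl
m≤W₂ (suc (suc m)) = m≤m+n (2 + m) (W₂ m)

sum-2 : ∀ K f → (∀ k → Step 2 f k) → Σ< K f ≤ W₂ (f 0)
sum-2 zero    f h = z≤n
sum-2 (suc K) f h with sum-2 K (f ∘ suc) (h ∘ suc) | h 0
... | ih | inj₁ e rewrite e = ≤-trans (+-monoʳ-≤ (f 0) ih) (≤-trans (≤-reflexive (+-identityʳ (f 0))) (m≤W₂ (f 0)))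
... | ih | inj₂ p = begin
  f 0 + Σ< K (f ∘ suc)  ≤⟨ +-monoʳ-≤ (f 0) (≤-trans ih (W₂-mono {f 1} {f 0 ∸ 2} (m+n≤o⇒m≤o∸n (f 1) p))) ⟩
  f 0 + W₂ (f 0 ∸ 2)     ≡⟨ unfold (f 0) (≤-trans (m≤n+m 2 (f 1)) p) ⟩
  W₂ (f 0)               ∎
  where
  open ≤-Reasoning
  unfold : ∀ m → 2 ≤ m → m + W₂ (m ∸ 2) ≡ W₂ m
  unfold (suc (suc m)) _ = refl
  unfold (suc zero) (s≤s ())

W₃ : ℕ → ℕ
W₃ 0                   = 0
W₃ 1                   = 1
W₃ 2                   = 2
W₃ (suc (suc (suc m))) = suc (suc (suc m)) + W₃ m

W₃-suc : ∀ m → W₃ m ≤ W₃ (suc m)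
W₃-suc 0                   = z≤n
W₃-suc 1                   = s≤s z≤n
W₃-suc 2                   = s≤s (s≤s z≤n)
W₃-suc (suc (suc (suc m))) = +-mono-≤ (n≤1+n (3 + m)) (W₃-suc m)

W₃-mono : ∀ {m n} → m ≤ n → W₃ m ≤ W₃ n
W₃-mono = mono-from-suc W₃ W₃-suc

m≤W₃ : ∀ m → m ≤ W₃ m
m≤W₃ 0                   = z≤n
m≤W₃ 1                   = ≤-refl
m≤W₃ 2                   = ≤-refl
m≤W₃ (suc (suc (suc m))) = m≤m+n (3 + m) (W₃ m)

-- Exact unless 3 divides m, where it is off by 2; one polynomial saves a distinction of residues
-- later.
6W₃≤ : ∀ m → 6 * W₃ m ≤ suc m * suc (suc m)
6W₃≤ 0 = z≤n
6W₃≤ 1 = ≤-refl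
6W₃≤ 2 = ≤-refl {12}
6W₃≤ (suc (suc (suc m))) = ≤-from-slack 0 (6W₃≤ m) (eq m (W₃ m))
  where
  eq : ∀ m t → (6 * (3 + m + t) + suc m * suc (suc m)) + 0 ≡ suc (3 + m) * suc (suc (3 + m)) + 6 * t
  eq = solve-∀

sum-3 : ∀ K f → (∀ k → Step 3 f k) → Σ< K f ≤ W₃ (f 0)
sum-3 zero    f h = z≤n
sum-3 (suc K) f h with sum-3 K (f ∘ suc) (h ∘ suc) | h 0
... | ih | inj₁ e rewrite e = ≤-trans (+-monoʳ-≤ (f 0) ih) (≤-trans (≤-reflexive (+-identityʳ (f 0))) (m≤W₃ (f 0)))
... | ih | inj₂ p = begin
  f 0 + Σ< K (f ∘ suc)  ≤⟨ +-monoʳ-≤ (f 0) (≤-trans ih (W₃-mono {f 1} {f 0 ∸ 3} (m+n≤o⇒m≤o∸n (f 1) p))) ⟩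
  f 0 + W₃ (f 0 ∸ 3)    ≡⟨ unfold (f 0) (≤-trans (m≤n+m 3 (f 1)) p) ⟩
  W₃ (f 0)              ∎
  where
  open ≤-Reasoning
  unfold : ∀ m → 3 ≤ m → m + W₃ (m ∸ 3) ≡ W₃ m
  unfold (suc (suc (suc m))) _ = refl
  unfold (suc zero) (s≤s ())
  unfold (suc (suc zero)) (s≤s (s≤s ()))

sum-32 : ∀ K f → Step 3 f 0 → (∀ k → Step 2 f (suc k)) → Σ< K f ≤ f 0 + W₂ (f 0 ∸ 3)
sum-32 zero    f h₀ h = z≤n
sum-32 (suc K) f h₀ h = +-monoʳ-≤ (f 0) (≤-trans (sum-2 K (f ∘ suc) h) (W₂-mono (f1≤ h₀)))
  where
  f1≤ : Step 3 f 0 → f 1 ≤ f 0 ∸ 3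
  f1≤ (inj₁ e) rewrite e = z≤n
  f1≤ (inj₂ p) = m+n≤o⇒m≤o∸n (f 1) p

-- The largest distance sum when level 1 has at least 2 vertices, level 2 at least 3, and the later
-- inner levels at least 2.
W₂₃ : ℕ → ℕ
W₂₃ m = m + ((m ∸ 2) + W₂ (m ∸ 2 ∸ 3))

sum-232 : ∀ K f → Step 2 f 0 → Step 3 f 1 → (∀ k → Step 2 f (suc (suc k))) → Σ< K f ≤ W₂₃ (f 0)
sum-232 zero    f h₀ h₁ h = z≤n
sum-232 (suc K) f h₀ h₁ h = +-monoʳ-≤ (f 0) (≤-trans (sum-32 K (f ∘ suc) h₁ h)
    (+-mono-≤ (f1≤ h₀) (W₂-mono (∸-monoˡ-≤ 3 (f1≤ h₀)))))
  where
  f1≤ : Step 2 f 0 → f 1 ≤ f 0 ∸ 2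
  f1≤ (inj₁ e) rewrite e = z≤n
  f1≤ (inj₂ p) = m+n≤o⇒m≤o∸n (f 1) p

-- A level with a single vertex does most harm when it is the first one, since then most vertices
-- are pushed outwards; this value bounds the distance sum for every position of that level.
W₁ : ℕ → ℕ
W₁ m = m + W₂ (m ∸ 1)

-- One level, at an unknown place, may have a single vertex.
sum-1 : ∀ K f k₀ → Step 1 f k₀ → (∀ k → k ≢ k₀ → Step 2 f k) → Σ< K f ≤ W₁ (f 0)
sum-1 zero    f k₀ h₀ h = z≤n
sum-1 (suc K) f zero h₀ h = +-monoʳ-≤ (f 0) (≤-trans (sum-2 K (f ∘ suc) (λ k → h (suc k) λ ())) (W₂-mono (f1≤ h₀)))
  where
  f1≤ : Step 1 f 0 → f 1 ≤ f 0 ∸ 1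
  f1≤ (inj₁ e) rewrite e = z≤n
  f1≤ (inj₂ p) = m+n≤o⇒m≤o∸n (f 1) p
sum-1 (suc K) f (suc k₀) h₀ h
  with sum-1 K (f ∘ suc) k₀ h₀ (λ k ne → h (suc k) (ne ∘ suc-injective)) | h 0 (λ ())
... | ih | inj₁ e rewrite e = +-monoʳ-≤ (f 0) (≤-trans ih z≤n)
... | ih | inj₂ p = +-monoʳ-≤ (f 0) (≤-trans ih (≤-trans (W₁≤W₂ (f 1)) (W₂-mono (m+n≤o⇒m≤o∸n (suc (f 1)) (≤-trans (≤-reflexive (sym (+-suc (f 1) 1))) p)))))
  where
  W₁≤W₂ : ∀ m → W₁ m ≤ W₂ (suc m)
  W₁≤W₂ zero    = z≤n
  W₁≤W₂ (suc m) = +-monoˡ-≤ (W₂ m) (n≤1+n (suc m))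

W₂-even : ∀ k → W₂ (k + k) ≡ k * k + k
W₂-even zero = refl
W₂-even (suc k) rewrite +-suc k k | W₂-even k = eq k
  where
  eq : ∀ k → suc (suc (k + k)) + (k * k + k) ≡ suc k * suc k + suc k
  eq = solve-∀

W₂-odd : ∀ k → W₂ (suc (k + k)) ≡ suc k * suc k
W₂-odd zero = refl
W₂-odd (suc k) rewrite +-suc k k | W₂-odd k = eq k
  where
  eq : ∀ k → suc (suc (suc (k + k))) + suc k * suc k ≡ suc (suc k) * suc (suc k)
  eq = solve-∀

parity : ∀ n → (∃ λ k → n ≡ k + k) ⊎ (∃ λ k → n ≡ suc (k + k))
parity zero = inj₁ (0 , refl)
parity (suc n) with parity n
... | inj₁ (k , refl) = inj₂ (k , refl)
... | inj₂ (k , refl) = inj₁ (suc k , cong suc (sym (+-suc k k)))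

Far0≤ : ∀ {N} (X : Sub N) δ → ∣ Far X δ 0 ∣ ≤ ∣ X ∣
Far0≤ X δ = card-mono {S = Far X δ 0} {T = X} (λ x p → proj₁ (Far∈ X δ 0 p))

module Profile {N} (X : Sub N) (δ : Fin N → ℕ) where
  Wide : ℕ → ℕ → Set
  Wide w k = ∀ x → x ∈ X → k < δ x → w ≤ ∣ Lev X δ k ∣

  private
    f : ℕ → ℕ
    f k = ∣ Far X δ k ∣
    K  = proj₁ (layer-cake X δ)
    lc = proj₂ (layer-cake X δ)

  wide⇒step : ∀ w k → Wide w (suc k) → Step w f k
  wide⇒step w k h = Lev⇒Step X δ w k λ p →
    case card-inhabited (Far X δ (suc k)) p of λ where
      (x , q) → h x (proj₁ (Far∈ X δ _ q)) (proj₂ (Far∈ X δ _ q))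

  total-2 : (∀ k → Wide 2 (suc k)) → ∑ (λ x → 𝟙 (X x) * δ x) ≤ W₂ ∣ X ∣
  total-2 h = ≤-trans (≤-reflexive lc)
    (≤-trans (sum-2 K f (λ k → wide⇒step 2 k (h k))) (W₂-mono (Far0≤ X δ)))

  total-3 : (∀ k → Wide 3 (suc k)) → ∑ (λ x → 𝟙 (X x) * δ x) ≤ W₃ ∣ X ∣
  total-3 h = ≤-trans (≤-reflexive lc)
    (≤-trans (sum-3 K f (λ k → wide⇒step 3 k (h k))) (W₃-mono (Far0≤ X δ)))

  total-232 : (∀ k → Wide 2 (suc k)) → Wide 3 2 → ∑ (λ x → 𝟙 (X x) * δ x) ≤ W₂₃ ∣ X ∣
  total-232 h h₃ = ≤-trans (≤-reflexive lc)
    (≤-trans (sum-232 K f (wide⇒step 2 0 (h 0)) (wide⇒step 3 1 h₃) (λ k → wide⇒step 2 _ (h _)))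
      (+-mono-≤ le (+-mono-≤ (∸-monoˡ-≤ 2 le) (W₂-mono (∸-monoˡ-≤ 3 (∸-monoˡ-≤ 2 le))))))
    where le = Far0≤ X δ

  total-1 : ∀ k₀ → Wide 1 (suc k₀) → (∀ k → k ≢ k₀ → Wide 2 (suc k)) → ∑ (λ x → 𝟙 (X x) * δ x) ≤ W₁ ∣ X ∣
  total-1 k₀ h₀ h = ≤-trans (≤-reflexive lc)
    (≤-trans (sum-1 K f k₀ (wide⇒step 1 k₀ h₀) (λ k ne → wide⇒step 2 k (h k ne)))
      (+-mono-≤ le (W₂-mono (∸-monoˡ-≤ 1 le))))
    where le = Far0≤ X δ

-- Orbits of length 4, and merging classes

-- `f` permutes `al` with inverse `g`. Written as a double sum over the pairs with j = f i, the left
-- side can be summed over j first, and then `g j` is the only i.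
reindex : ∀ {M} (al : Sub M) (f g : Fin M → Fin M) →
          (∀ {i} → i ∈ al → f i ∈ al) → (∀ {i} → i ∈ al → g i ∈ al) →
          (∀ {i} → i ∈ al → g (f i) ≡ i) → (∀ {i} → i ∈ al → f (g i) ≡ i) →
          (h : Fin M → ℕ) → ∑ (λ i → 𝟙 (al i) * h (f i)) ≡ ∑ (λ i → 𝟙 (al i) * h i)
reindex {M} al f g fc gc gf fg h = begin
  ∑ (λ i → 𝟙 (al i) * h (f i))                                 ≡⟨ ∑-cong (λ i → cong (𝟙 (al i) *_) (sym (∑-δ (f i) h))) ⟩
  ∑ (λ i → 𝟙 (al i) * ∑ (λ j → 𝟙 (does (j ≟F f i)) * h j))     ≡⟨ ∑-cong (λ i → sym (∑-* (𝟙 (al i)) (λ j → 𝟙 (does (j ≟F f i)) * h j))) ⟩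
  ∑ (λ i → ∑ (λ j → 𝟙 (al i) * (𝟙 (does (j ≟F f i)) * h j)))   ≡⟨ ∑-swap (λ i j → 𝟙 (al i) * (𝟙 (does (j ≟F f i)) * h j)) ⟩
  ∑ (λ j → ∑ (λ i → 𝟙 (al i) * (𝟙 (does (j ≟F f i)) * h j)))   ≡⟨ ∑-cong (λ j → ∑-cong (λ i → pt i j)) ⟩
  ∑ (λ j → ∑ (λ i → 𝟙 (does (i ≟F g j)) * (𝟙 (al j) * h j)))   ≡⟨ ∑-cong (λ j → ∑-δ (g j) (λ _ → 𝟙 (al j) * h j)) ⟩
  ∑ (λ j → 𝟙 (al j) * h j)                                     ∎
  where
  open ≡-Reasoning
  same : ∀ i j → 𝟙 (does ((i ∈? al) ×-dec (j ≟F f i))) ≡ 𝟙 (does ((i ≟F g j) ×-dec (j ∈? al)))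
  same i j = 𝟙-dec ((i ∈? al) ×-dec (j ≟F f i)) ((i ≟F g j) ×-dec (j ∈? al))
    (λ { (p , refl) → sym (gf p) , fc p }) (λ { (refl , q) → gc q , sym (fg q) })
  𝟙-∧ : ∀ b c → 𝟙 (b ∧ c) ≡ 𝟙 b * 𝟙 c
  𝟙-∧ true  c = sym (+-identityʳ (𝟙 c))
  𝟙-∧ false c = refl
  pt : ∀ i j → 𝟙 (al i) * (𝟙 (does (j ≟F f i)) * h j) ≡ 𝟙 (does (i ≟F g j)) * (𝟙 (al j) * h j)
  pt i j = begin
    𝟙 (al i) * (𝟙 (does (j ≟F f i)) * h j)                  ≡⟨ sym (*-assoc (𝟙 (al i)) _ (h j)) ⟩
    𝟙 (al i) * 𝟙 (does (j ≟F f i)) * h j                    ≡⟨ cong (λ z → z * 𝟙 (does (j ≟F f i)) * h j) (sym (𝟙-≟ (al i))) ⟩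
    𝟙 (does (i ∈? al)) * 𝟙 (does (j ≟F f i)) * h j          ≡⟨ cong (_* h j) (trans (sym (𝟙-∧ (does (i ∈? al)) (does (j ≟F f i)))) (trans (same i j) (𝟙-∧ (does (i ≟F g j)) (does (j ∈? al))))) ⟩
    𝟙 (does (i ≟F g j)) * 𝟙 (does (j ∈? al)) * h j          ≡⟨ cong (λ z → 𝟙 (does (i ≟F g j)) * z * h j) (𝟙-≟ (al j)) ⟩
    𝟙 (does (i ≟F g j)) * 𝟙 (al j) * h j                    ≡⟨ *-assoc (𝟙 (does (i ≟F g j))) (𝟙 (al j)) (h j) ⟩
    𝟙 (does (i ≟F g j)) * (𝟙 (al j) * h j)                  ∎

least? : ∀ a b c e → Dec (a ≤ b × a ≤ c × a ≤ e)
least? a b c e = (a ≤? b) ×-dec ((a ≤? c) ×-dec (a ≤? e))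

leasts : ℕ → ℕ → ℕ → ℕ → ℕ
leasts a b c e = 𝟙 (does (least? a b c e)) + (𝟙 (does (least? b c e a)) + (𝟙 (does (least? c e a b)) + 𝟙 (does (least? e a b c))))

leasts-rotate : ∀ a b c e → leasts a b c e ≡ leasts b c e a
leasts-rotate a b c e = rot (𝟙 (does (least? a b c e))) (𝟙 (does (least? b c e a))) (𝟙 (does (least? c e a b))) (𝟙 (does (least? e a b c)))
  where
  rot : ∀ w x y z → w + (x + (y + z)) ≡ x + (y + (z + w))
  rot = solve-∀

least-first : ∀ {a b c e} → a ≢ b → a ≢ c → a ≢ e → a ≤ b × a ≤ c × a ≤ e → leasts a b c e ≡ 1
least-first {a} {b} {c} {e} ab ac ae l@(p , q , r)
  rewrite dec-true (least? a b c e) l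
        | dec-false (least? b c e a) (λ { (_ , _ , s) → ab (≤-antisym p s) })
        | dec-false (least? c e a b) (λ { (_ , s , _) → ac (≤-antisym q s) })
        | dec-false (least? e a b c) (λ { (s , _ , _) → ae (≤-antisym r s) }) = refl

one-least : ∀ a b c e → a ≢ b → a ≢ c → a ≢ e → b ≢ c → b ≢ e → c ≢ e → leasts a b c e ≡ 1
one-least a b c e ab ac ae bc be ce = go (≤-total a b) (≤-total c e)
  where
  A : a ≤ b × a ≤ c × a ≤ e → leasts a b c e ≡ 1
  A = least-first ab ac ae
  B : b ≤ c × b ≤ e × b ≤ a → leasts a b c e ≡ 1
  B l = trans (leasts-rotate a b c e) (least-first bc be (ab ∘ sym) l)
  C : c ≤ e × c ≤ a × c ≤ b → leasts a b c e ≡ 1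
  C l = trans (leasts-rotate a b c e) (trans (leasts-rotate b c e a) (least-first ce (ac ∘ sym) (bc ∘ sym) l))
  E : e ≤ a × e ≤ b × e ≤ c → leasts a b c e ≡ 1
  E l = trans (sym (leasts-rotate e a b c)) (least-first (ae ∘ sym) (be ∘ sym) (ce ∘ sym) l)
  go : a ≤ b ⊎ b ≤ a → c ≤ e ⊎ e ≤ c → leasts a b c e ≡ 1
  go (inj₁ p) (inj₁ q) = [ (λ r → A (p , r , ≤-trans r q)) , (λ r → C (q , r , ≤-trans r p)) ]′ (≤-total a c)
  go (inj₁ p) (inj₂ q) = [ (λ r → A (p , ≤-trans r q , r)) , (λ r → E (r , ≤-trans r p , q)) ]′ (≤-total a e)
  go (inj₂ p) (inj₁ q) = [ (λ r → B (r , ≤-trans r q , p)) , (λ r → C (q , ≤-trans r p , r)) ]′ (≤-total b c)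
  go (inj₂ p) (inj₂ q) = [ (λ r → B (≤-trans r q , r , p)) , (λ r → E (≤-trans r p , r , q)) ]′ (≤-total b e)

module Orbit4 {M} (al : Sub M) (φ : Fin M → Fin M)
              (φ-closed : ∀ {i} → i ∈ al → φ i ∈ al)
              (φ⁴ : ∀ {i} → i ∈ al → φ (φ (φ (φ i))) ≡ i)
              (φ² : ∀ {i} → i ∈ al → φ (φ i) ≢ i) where

  Rep? : ∀ i → Dec (toℕ i ≤ toℕ (φ i) × toℕ i ≤ toℕ (φ (φ i)) × toℕ i ≤ toℕ (φ (φ (φ i))))
  Rep? i = least? (toℕ i) (toℕ (φ i)) (toℕ (φ (φ i))) (toℕ (φ (φ (φ i))))

  rep : Sub M
  rep = ⟦ Rep? ⟧

  φ¹ : ∀ {i} → i ∈ al → φ i ≢ i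
  φ¹ p e = φ² p (trans (cong φ e) e)

  φ³ : ∀ {i} → i ∈ al → φ (φ (φ i)) ≢ i
  φ³ p e = φ¹ p (trans (sym (cong φ e)) (φ⁴ p))

  rep-sum : ∀ {i} → i ∈ al → 𝟙 (rep i) + (𝟙 (rep (φ i)) + (𝟙 (rep (φ (φ i))) + 𝟙 (rep (φ (φ (φ i)))))) ≡ 1
  rep-sum {i} p rewrite φ⁴ p =
    one-least (toℕ i) (toℕ (φ i)) (toℕ (φ (φ i))) (toℕ (φ (φ (φ i))))
      (φ¹ p ∘ sym ∘ toℕ-injective) (φ² p ∘ sym ∘ toℕ-injective) (φ³ p ∘ sym ∘ toℕ-injective)
      (φ¹ (φ-closed p) ∘ sym ∘ toℕ-injective) (φ² (φ-closed p) ∘ sym ∘ toℕ-injective)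
      (φ¹ (φ-closed (φ-closed p)) ∘ sym ∘ toℕ-injective)

  shift : ∀ h → ∑ (λ i → 𝟙 (al i) * h (φ i)) ≡ ∑ (λ i → 𝟙 (al i) * h i)
  shift = reindex al φ (φ ∘ φ ∘ φ) φ-closed (φ-closed ∘ φ-closed ∘ φ-closed) φ⁴ φ⁴

  -- Each face contributes its common weight four times. Weight 1 counts faces; the indicator of a
  -- colour shows that the number of darts of that colour is divisible by 4.
  four-reps : (w : Fin M → ℕ) → (∀ {i} → i ∈ al → w (φ i) ≡ w i) →
              ∑ (λ i → 𝟙 (al i) * w i) ≡ 4 * ∑ (λ i → 𝟙 (al i) * (w i * 𝟙 (rep i)))
  four-reps w inv = begin
    ∑ (λ i → 𝟙 (al i) * w i)                         ≡⟨ ∑-cong pt ⟩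
    ∑ (λ i → t₀ i + (t₁ i + (t₂ i + t₃ i)))          ≡⟨ trans (∑-+ t₀ (λ i → t₁ i + (t₂ i + t₃ i))) (cong (∑ t₀ +_) (trans (∑-+ t₁ (λ i → t₂ i + t₃ i)) (cong (∑ t₁ +_) (∑-+ t₂ t₃)))) ⟩
    ∑ t₀ + (∑ t₁ + (∑ t₂ + ∑ t₃))                    ≡⟨ cong (∑ t₀ +_) (cong₂ _+_ s₁ (cong₂ _+_ s₂ s₃)) ⟩
    ∑ t₀ + (∑ t₀ + (∑ t₀ + ∑ t₀))                    ≡⟨ quad (∑ t₀) ⟩
    4 * ∑ t₀                                         ∎
    where
    open ≡-Reasoning
    h t₀ t₁ t₂ t₃ : Fin M → ℕ
    h i = w i * 𝟙 (rep i)
    t₀ i = 𝟙 (al i) * h i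
    t₁ i = 𝟙 (al i) * h (φ i)
    t₂ i = 𝟙 (al i) * h (φ (φ i))
    t₃ i = 𝟙 (al i) * h (φ (φ (φ i)))
    s₁ = shift h
    s₂ = trans (shift (h ∘ φ)) s₁
    s₃ = trans (shift (h ∘ φ ∘ φ)) s₂
    quad : ∀ x → x + (x + (x + x)) ≡ 4 * x
    quad = solve-∀
    dist : ∀ x a b c e → x * (a + (b + (c + e))) ≡ x * a + (x * b + (x * c + x * e))
    dist = solve-∀
    pt : ∀ i → 𝟙 (al i) * w i ≡ t₀ i + (t₁ i + (t₂ i + t₃ i))
    pt i with al i in p
    ... | false = refl
    ... | true = begin
      w i + 0                                        ≡⟨ +-identityʳ (w i) ⟩
      w i                                            ≡⟨ sym (*-identityʳ (w i)) ⟩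
      w i * 1                                        ≡⟨ cong (w i *_) (sym (rep-sum p)) ⟩
      w i * (𝟙 (rep i) + (𝟙 (rep (φ i)) + (𝟙 (rep (φ (φ i))) + 𝟙 (rep (φ (φ (φ i)))))))
        ≡⟨ dist (w i) (𝟙 (rep i)) (𝟙 (rep (φ i))) (𝟙 (rep (φ (φ i)))) (𝟙 (rep (φ (φ (φ i))))) ⟩
      w i * 𝟙 (rep i) + (w i * 𝟙 (rep (φ i)) + (w i * 𝟙 (rep (φ (φ i))) + w i * 𝟙 (rep (φ (φ (φ i))))))
        ≡⟨ cong₂ _+_ (sym (+-identityʳ (h i))) (cong₂ _+_ (one i₁) (cong₂ _+_ (one i₂) (one i₃))) ⟩
      h i + 0 + (h (φ i) + 0 + (h (φ (φ i)) + 0 + (h (φ (φ (φ i))) + 0))) ∎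
      where
      i₁ : w (φ i) ≡ w i
      i₁ = inv p
      i₂ : w (φ (φ i)) ≡ w i
      i₂ = trans (inv (φ-closed p)) i₁
      i₃ : w (φ (φ (φ i))) ≡ w i
      i₃ = trans (inv (φ-closed (φ-closed p))) i₂
      one : ∀ {j} → w j ≡ w i → w i * 𝟙 (rep j) ≡ h j + 0
      one {j} e = trans (cong (_* 𝟙 (rep j)) (sym e)) (sym (+-identityʳ (h j)))

-- A partition of `al`, encoded by a retraction onto representatives: ∣ R ∣ is the number of
-- classes, and identifying two elements lowers it by at most one.
record Labelling {M} (al : Sub M) (lab : Fin M → Fin M) (R : Sub M) : Set where
  field
    lab∈R : ∀ {i} → i ∈ al → lab i ∈ R
    R⊆al  : ∀ {i} → i ∈ R → i ∈ al
    fixR  : ∀ {i} → i ∈ R → lab i ≡ i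

Coarser : ∀ {M} → (lab lab′ : Fin M → Fin M) → Set
Coarser lab lab′ = ∀ i j → lab i ≡ lab j → lab′ i ≡ lab′ j

merge : ∀ {M} {al : Sub M} {lab R} → Labelling al lab R → ∀ u v → u ∈ al → v ∈ al →
        ∃ λ lab′ → ∃ λ R′ → Labelling al lab′ R′ × Coarser lab lab′ × lab′ u ≡ lab′ v × ∣ R ∣ ≤ suc ∣ R′ ∣
merge {M} {al} {lab} {R} L u v up vp with lab u ≟F lab v
... | yes e = lab , R , L , (λ _ _ h → h) , e , n≤1+n _
... | no ne = lab′ , R ∖ lab u , L′ , (λ i j h → cong swap h) , trans at-u (sym at-v) , ≤-reflexive (card-∖ R (lab∈R up))
  where
  open Labelling L
  swap : Fin M → Fin M
  swap l = if does (l ≟F lab u) then lab v else l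
  lab′ : Fin M → Fin M
  lab′ i = swap (lab i)
  at-u : lab′ u ≡ lab v
  at-u rewrite dec-true (lab u ≟F lab u) refl = refl
  keep : ∀ {l} → l ≢ lab u → swap l ≡ l
  keep {l} h rewrite dec-false (l ≟F lab u) h = refl
  at-v : lab′ v ≡ lab v
  at-v = keep (ne ∘ sym)
  L′ : Labelling al lab′ (R ∖ lab u)
  L′ = record
    { lab∈R = λ {i} p → case lab i ≟F lab u of λ where
        (yes e) → subst (_∈ (R ∖ lab u)) (sym (trans (cong swap e) at-u)) (∖-∈ R (lab∈R vp) (ne ∘ sym))
        (no h) → subst (_∈ (R ∖ lab u)) (sym (keep h)) (∖-∈ R (lab∈R p) h)
    ; R⊆al = λ p → R⊆al (proj₁ (∖-∈⁻ R p))
    ; fixR = λ {i} p → case ∖-∈⁻ R p of λ where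
        (q , h) → trans (cong swap (fixR q)) (keep h) }

merge-all : ∀ {M} {al : Sub M} k (E : Sub M) (f : Fin M → Fin M) → ∣ E ∣ ≡ k →
  (∀ {i} → i ∈ E → i ∈ al) → (∀ {i} → i ∈ E → f i ∈ al) →
  ∀ {lab R} → Labelling al lab R →
  ∃ λ lab′ → ∃ λ R′ → Labelling al lab′ R′ × Coarser lab lab′ × (∀ {i} → i ∈ E → lab′ i ≡ lab′ (f i)) × ∣ R ∣ ≤ k + ∣ R′ ∣
merge-all zero E f c E⊆ f∈ {lab} {R} L =
  lab , R , L , (λ _ _ h → h) , (λ p → ⊥-elim (<-irrefl (sym c) (card-≥1 E p))) , ≤-refl
merge-all (suc k) E f c E⊆ f∈ {lab} {R} L
  with card-inhabited E (≤-trans (s≤s z≤n) (≤-reflexive (sym c)))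
... | x , xE with merge-all k (E ∖ x) f (suc-injective (trans (sym (card-∖ E xE)) c))
                    (λ p → E⊆ (proj₁ (∖-∈⁻ E p))) (λ p → f∈ (proj₁ (∖-∈⁻ E p))) L
... | lab₁ , R₁ , L₁ , co₁ , eq₁ , le₁ with merge L₁ x (f x) (E⊆ xE) (f∈ xE)
... | lab₂ , R₂ , L₂ , co₂ , eq₂ , le₂ =
  lab₂ , R₂ , L₂ , (λ i j h → co₂ i j (co₁ i j h)) ,
  (λ {i} p → case i ≟F x of λ where
     (yes refl) → eq₂
     (no ne) → co₂ _ _ (eq₁ (∖-∈ E p ne))) ,
  ≤-trans le₁ (≤-trans (+-monoʳ-≤ k le₂) (≤-reflexive (+-suc k ∣ R₂ ∣)))

-- Quadrangulated surfaces

record Metric {N} (d : Fin N → Fin N → ℕ) : Set where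
  field
    d-refl : ∀ u → d u u ≡ 0
    d-zero : ∀ {u v} → d u v ≡ 0 → u ≡ v
    d-sym  : ∀ u v → d u v ≡ d v u
    d-tri  : ∀ u v w → d u w ≤ d u v + d v w

-- A closed quadrangulated surface whose 1-skeleton is the subset S of a metric
-- space, adjacency being distance 1.  nx u v is the vertex that follows the
-- dart u → v on its face, so x ↦ nx x v is the rotation at v.
record Surf {N} (d : Fin N → Fin N → ℕ) (S : Sub N) (nx : Fin N → Fin N → Fin N) : Set where
  field
    geo    : ∀ {u v} → u ∈ S → v ∈ S → u ≢ v → ∃ λ w → w ∈ S × d u w ≡ 1 × suc (d w v) ≡ d u v
    nx-in  : ∀ {u v} → u ∈ S → v ∈ S → d u v ≡ 1 → nx u v ∈ S
    nx-adj : ∀ {u v} → u ∈ S → v ∈ S → d u v ≡ 1 → d v (nx u v) ≡ 1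
    nx-per : ∀ {u v} → u ∈ S → v ∈ S → d u v ≡ 1 → nx (nx u v) (nx v (nx u v)) ≡ u
    nx-ne  : ∀ {u v} → u ∈ S → v ∈ S → d u v ≡ 1 → nx u v ≢ u
    -- Says that the rotation at v is transitive on the neighbours of v, as an induction principle,
    -- so that iterates of the rotation never appear.
    link   : ∀ {v} → v ∈ S → (g : Sub N) → (∀ {x} → x ∈ S → d x v ≡ 1 → x ∈ g → nx x v ∈ g) →
             ∀ {x y} → x ∈ S → d x v ≡ 1 → x ∈ g → y ∈ S → d y v ≡ 1 → y ∈ g

module Surface {N} {d : Fin N → Fin N → ℕ} (M : Metric d)
               {S : Sub N} {nx : Fin N → Fin N → Fin N} (G : Surf d S nx) where
  open Metric M
  open Surf G

  record Dart (u v : Fin N) : Set where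
    constructor dart
    field
      src : u ∈ S
      tgt : v ∈ S
      adj : d u v ≡ 1

  adj-≢ : ∀ {u v} → d u v ≡ 1 → u ≢ v
  adj-≢ {u} e refl = case trans (sym e) (d-refl u) of λ ()

  rev : ∀ {u v} → Dart u v → Dart v u
  rev {u} {v} (dart p q e) = dart q p (trans (d-sym v u) e)

  next : ∀ {u v} → Dart u v → Dart v (nx u v)
  next (dart p q e) = dart q (nx-in p q e) (nx-adj p q e)

  nx-per′ : ∀ {u v} → Dart u v → nx (nx u v) (nx v (nx u v)) ≡ u
  nx-per′ (dart p q e) = nx-per p q e

  nx-ne′ : ∀ {u v} → Dart u v → nx u v ≢ u
  nx-ne′ (dart p q e) = nx-ne p q e

  nx-per₂ : ∀ {u v} → Dart u v → nx (nx v (nx u v)) u ≡ v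
  nx-per₂ D = trans (cong (nx _) (sym (nx-per′ D))) (nx-per′ (next D))

  -- The dart closing up the face through u → v.
  last : ∀ {u v} → Dart u v → Dart (nx v (nx u v)) u
  last D = subst (Dart _) (nx-per′ D) (next (next (next D)))

  nx-inj : ∀ {u u′ v} → Dart u v → Dart u′ v → nx u v ≡ nx u′ v → u ≡ u′
  nx-inj {v = v} D D′ e = trans (sym (nx-per′ D)) (trans (cong (λ w → nx w (nx v w)) e) (nx-per′ D′))

  connected : (g : Sub N) → (∀ {u v} → Dart u v → g u ≡ g v) → ∀ {u v} → u ∈ S → v ∈ S → g u ≡ g v
  connected g h {u} {v} p q = go (d u v) u refl p
    where
    go : ∀ k u → d u v ≡ k → u ∈ S → g u ≡ g v
    go k u e p with u ≟F v
    ... | yes refl = refl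
    go k u e p | no ne with geo p q ne
    go zero u e p | no ne | w , wS , a , b = case trans b e of λ ()
    go (suc k) u e p | no ne | w , wS , a , b =
      trans (h (dart p wS a)) (go k w (suc-injective (trans b e)) wS)

  rotate-constant : ∀ {v} → v ∈ S → (g : Sub N) → (∀ {x} → Dart x v → g x ≡ g (nx x v)) →
                    ∀ {x y} → Dart x v → Dart y v → g x ≡ g y
  rotate-constant {v} vS g h {x} {y} (dart xS _ xa) (dart yS _ ya) =
    sym (dec-true⁻ (g y Bool.≟ g x) (link vS (λ z → does (g z Bool.≟ g x))
      (λ {z} zS za p → dec-true (g (nx z v) Bool.≟ g x) (trans (sym (h (dart zS vS za))) (dec-true⁻ (g z Bool.≟ g x) p)))
      xS xa (dec-true (g x Bool.≟ g x) refl) yS ya))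

  -- A single vertex z does not disconnect S. Two consecutive neighbours x and `nx x z` of z are
  -- joined through the fourth vertex of their face, which is not z; so `g` is constant on the
  -- neighbours of z, and giving z their value makes `g` constant along all edges.
  separate : ∀ z (g : Sub N) → (∀ {u v} → Dart u v → u ≢ z → v ≢ z → g u ≡ g v) →
             ∀ {u v} → u ∈ S → v ∈ S → u ≢ z → v ≢ z → g u ≡ g v
  separate z g h {u} {v} uS vS u≢z v≢z with z ∈? S
  ... | no z∉ = connected g (λ D → h D (λ { refl → z∉ (Dart.src D) }) (λ { refl → z∉ (Dart.tgt D) })) uS vS
  ... | yes zS with geo zS uS (u≢z ∘ sym)
  ... | x₀ , x₀S , zx₀ , _ = trans (sym (off u≢z)) (trans (connected g* loc uS vS) (off v≢z))
    where
    g* : Sub N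
    g* y = if does (y ≟F z) then g x₀ else g y
    off : ∀ {y} → y ≢ z → g* y ≡ g y
    off {y} ne rewrite dec-false (y ≟F z) ne = refl
    corner : ∀ {x} → Dart x z → g x ≡ g (nx x z)
    corner {x} D = trans (sym (h (last D) (nx-ne′ (next D)) (adj-≢ (Dart.adj D))))
                         (sym (h (next (next D)) (adj-≢ (Dart.adj (next D)) ∘ sym) (nx-ne′ (next D))))
    nbr : ∀ {x} → Dart x z → g x ≡ g x₀
    nbr D = rotate-constant zS g corner D (rev (dart zS x₀S zx₀))
    loc : ∀ {u v} → Dart u v → g* u ≡ g* v
    loc {u} {v} D with u ≟F z | v ≟F z
    ... | yes refl | yes refl = refl
    ... | yes refl | no ne = sym (nbr (rev D))
    ... | no ne | yes refl = nbr D
    ... | no n₁ | no n₂ = h D n₁ n₂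

  Lip : (Fin N → ℕ) → Set
  Lip δ = ∀ {u v} → Dart u v → δ u ≤ suc (δ v)

  d-lip : ∀ r → Lip (d r)
  d-lip r {u} {v} D = ≤-trans (d-tri r v u) (≤-reflexive (trans (cong (d r v +_) (Dart.adj (rev D))) (+-comm (d r v) 1)))

  -- An edge cannot jump over level i, so with at most one vertex this level could not separate u
  -- from v. The function `δ` is arbitrary because distances from vertices outside S and from a pair
  -- of poles are needed as well.
  level-2 : ∀ δ → Lip δ → ∀ i {u v} → u ∈ S → δ u < i → v ∈ S → i < δ v → 2 ≤ ∣ Lev S δ i ∣
  level-2 δ lip i {u} {v} uS u< vS >v with 2 ≤? ∣ Lev S δ i ∣
  ... | yes p = p
  ... | no np = ⊥-elim (true≢false (trans (sym g-const) (dec-true (δ u <? i) u<)) (dec-false (δ v <? i) (<⇒≯ >v)))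
    where
    g : Sub N
    g y = does (δ y <? i)
    loc : ∀ {a b} → Dart a b → δ a ≢ i → δ b ≢ i → g a ≡ g b
    loc {a} {b} D ai bi = does-⇔ (δ a <? i) (δ b <? i)
      (λ p → ≤∧≢⇒< (≤-trans (lip (rev D)) p) bi) (λ p → ≤∧≢⇒< (≤-trans (lip D) p) ai)
    g-const : g u ≡ g v
    g-const with card-few (Lev S δ i) np
    ... | inj₁ none = connected g (λ D → loc D (none _ ∘ ∈Lev S δ i (Dart.src D)) (none _ ∘ ∈Lev S δ i (Dart.tgt D))) uS vS
    ... | inj₂ (z , zL , only) = separate z g
        (λ D az bz → loc D (az ∘ only _ ∘ ∈Lev S δ i (Dart.src D)) (bz ∘ only _ ∘ ∈Lev S δ i (Dart.tgt D))) uS vS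
        (λ { refl → <⇒≢ u< (proj₂ (Lev∈ S δ i zL)) }) (λ { refl → <⇒≢ >v (sym (proj₂ (Lev∈ S δ i zL))) })

-- Trees and cotrees

∥_∥ : ∀ {N} {P : Fin N → Fin N → Set} → (∀ u v → Dec (P u v)) → ℕ
∥ P? ∥ = ∑ (λ u → ∑ (λ v → 𝟙 (does (P? u v))))

-- Darts are pairs of vertices; coding them in one finite type makes the lemmas on subsets, orbits
-- and merging applicable to them.
module Code (N : ℕ) where
  enc : Fin N → Fin N → Fin (N * N)
  enc = combine

  src tgt : Fin (N * N) → Fin N
  src i = proj₁ (remQuot {N} N i)
  tgt i = proj₂ (remQuot {N} N i)

  src-enc : ∀ u v → src (enc u v) ≡ u
  src-enc u v = cong proj₁ (remQuot-combine u v)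

  tgt-enc : ∀ u v → tgt (enc u v) ≡ v
  tgt-enc u v = cong proj₂ (remQuot-combine u v)

  enc-eta : ∀ i → enc (src i) (tgt i) ≡ i
  enc-eta = combine-remQuot {N} N

  coded : {P : Fin N → Fin N → Set} → (∀ u v → Dec (P u v)) → Sub (N * N)
  coded P? = ⟦ (λ i → P? (src i) (tgt i)) ⟧

  coded-enc : ∀ {P : Fin N → Fin N → Set} (P? : ∀ u v → Dec (P u v)) u v → coded P? (enc u v) ≡ does (P? u v)
  coded-enc P? u v = cong₂ (λ a b → does (P? a b)) (src-enc u v) (tgt-enc u v)

  ∈coded : ∀ {P : Fin N → Fin N → Set} (P? : ∀ u v → Dec (P u v)) {u v} → P u v → enc u v ∈ coded P?
  ∈coded P? {u} {v} p = trans (coded-enc P? u v) (dec-true (P? u v) p)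

  card-coded : ∀ {P : Fin N → Fin N → Set} (P? : ∀ u v → Dec (P u v)) → ∣ coded P? ∣ ≡ ∥ P? ∥
  card-coded P? = trans (∑-pair N (𝟙 ∘ coded P?)) (∑-cong (λ u → ∑-cong (λ v → cong 𝟙 (coded-enc P? u v))))

module Cotree {N} {d : Fin N → Fin N → ℕ} (M : Metric d)
              {S : Sub N} {nx : Fin N → Fin N → Fin N} (G : Surf d S nx) where
  open Metric M
  open Surf G
  open Surface M G
  open Code N

  Dart? : ∀ u v → Dec (Dart u v)
  Dart? u v with (u ∈? S) ×-dec ((v ∈? S) ×-dec (d u v ℕ.≟ 1))
  ... | yes (a , b , c) = yes (dart a b c)
  ... | no n = no λ { (dart a b c) → n (a , b , c) }

  al : Sub (N * N)
  al = coded Dart?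

  φ swap : Fin (N * N) → Fin (N * N)
  φ i = enc (tgt i) (nx (src i) (tgt i))
  swap i = enc (tgt i) (src i)

  φ-enc : ∀ u v → φ (enc u v) ≡ enc v (nx u v)
  φ-enc u v = cong₂ (λ a b → enc b (nx a b)) (src-enc u v) (tgt-enc u v)

  swap-enc : ∀ u v → swap (enc u v) ≡ enc v u
  swap-enc u v = cong₂ (λ a b → enc b a) (src-enc u v) (tgt-enc u v)

  al-dart : ∀ {i} → i ∈ al → Dart (src i) (tgt i)
  al-dart {i} = dec-true⁻ (Dart? (src i) (tgt i))

  φ-closed : ∀ {i} → i ∈ al → φ i ∈ al
  φ-closed p = ∈coded Dart? (next (al-dart p))

  φ⁴-enc : ∀ {u v} → Dart u v → φ (φ (φ (φ (enc u v)))) ≡ enc u v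
  φ⁴-enc {u} {v} D = begin
    φ (φ (φ (φ (enc u v))))      ≡⟨ cong (φ ∘ φ ∘ φ) (φ-enc u v) ⟩
    φ (φ (φ (enc v w)))          ≡⟨ cong (φ ∘ φ) (φ-enc v w) ⟩
    φ (φ (enc w x))              ≡⟨ cong φ (φ-enc w x) ⟩
    φ (enc x (nx w x))           ≡⟨ cong (λ z → φ (enc x z)) (nx-per′ D) ⟩
    φ (enc x u)                  ≡⟨ φ-enc x u ⟩
    enc u (nx x u)               ≡⟨ cong (enc u) (nx-per₂ D) ⟩
    enc u v                      ∎
    where
    open ≡-Reasoning
    w = nx u v
    x = nx v w

  φ⁴ : ∀ {i} → i ∈ al → φ (φ (φ (φ i))) ≡ i
  φ⁴ {i} p = trans (cong (φ ∘ φ ∘ φ ∘ φ) (sym (enc-eta i))) (trans (φ⁴-enc (al-dart p)) (enc-eta i))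

  φ² : ∀ {i} → i ∈ al → φ (φ i) ≢ i
  φ² {i} p e = nx-ne′ (al-dart p) (begin
    nx (src i) (tgt i)   ≡⟨ sym (tgt-enc _ _) ⟩
    tgt (φ i)            ≡⟨ sym (src-enc _ _) ⟩
    src (φ (φ i))        ≡⟨ cong src e ⟩
    src i                ∎)
    where open ≡-Reasoning

  open Orbit4 al φ φ-closed φ⁴ φ² using (Rep?; rep; rep-sum; four-reps) public

  FaceRep? : ∀ i → Dec (i ∈ al × rep i ≡ true)
  FaceRep? i = (i ∈? al) ×-dec (rep i Bool.≟ true)

  NonRep? : ∀ i → Dec (i ∈ al × rep i ≡ false)
  NonRep? i = (i ∈? al) ×-dec (rep i Bool.≟ false)

  𝟙-and : ∀ a b → 𝟙 (does ((a Bool.≟ true) ×-dec (b Bool.≟ true))) ≡ 𝟙 a * 𝟙 b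
  𝟙-and true true = refl
  𝟙-and true false = refl
  𝟙-and false b = refl

  al≡4reps : ∣ al ∣ ≡ 4 * ∣ ⟦ FaceRep? ⟧ ∣
  al≡4reps = begin
    ∣ al ∣                                           ≡⟨ ∑-cong (λ i → sym (*-identityʳ (𝟙 (al i)))) ⟩
    ∑ (λ i → 𝟙 (al i) * 1)                           ≡⟨ four-reps (λ _ → 1) (λ _ → refl) ⟩
    4 * ∑ (λ i → 𝟙 (al i) * (1 * 𝟙 (rep i)))         ≡⟨ cong (4 *_) (∑-cong (λ i → trans (cong (𝟙 (al i) *_) (*-identityˡ (𝟙 (rep i)))) (sym (𝟙-and (al i) (rep i))))) ⟩
    4 * ∣ ⟦ FaceRep? ⟧ ∣                             ∎
    where open ≡-Reasoning

  al-split : ∣ al ∣ ≡ ∣ ⟦ FaceRep? ⟧ ∣ + ∣ ⟦ NonRep? ⟧ ∣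
  al-split = card-∪ {S = ⟦ FaceRep? ⟧} {T = ⟦ NonRep? ⟧} (λ i → pt (al i) (rep i))
    where
    pt : ∀ a b → 𝟙 a ≡ 𝟙 (does ((a Bool.≟ true) ×-dec (b Bool.≟ true))) + 𝟙 (does ((a Bool.≟ true) ×-dec (b Bool.≟ false)))
    pt true true = refl
    pt true false = refl
    pt false _ = refl

  FaceInv : ∀ {L : Set} → (Fin N → Fin N → L) → Set
  FaceInv c = ∀ {u v} → Dart u v → c u v ≡ c v (nx u v)

  -- Only three of the four links x ~ φ x of each face are used, so the number
  -- of classes left is the number of faces.
  face-labelling : (E : Sub (N * N)) → (∀ {i} → i ∈ E → i ∈ al) →
    ∃ λ lab → ∃ λ R → Labelling al lab R × FaceInv (λ u v → lab (enc u v)) ×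
      (∀ {i} → i ∈ E → lab i ≡ lab (swap i)) × ∣ ⟦ FaceRep? ⟧ ∣ ≤ ∣ E ∣ + ∣ R ∣
  face-labelling E E⊆
    with merge-all ∣ ⟦ NonRep? ⟧ ∣ ⟦ NonRep? ⟧ φ refl (λ {i} p → proj₁ (dec-true⁻ (NonRep? i) p))
           (λ {i} p → φ-closed (proj₁ (dec-true⁻ (NonRep? i) p))) {id} {al}
           (record { lab∈R = id ; R⊆al = id ; fixR = λ _ → refl })
  ... | lab₁ , R₁ , L₁ , _ , eq₁ , le₁
    with merge-all ∣ E ∣ E swap refl E⊆ (λ p → ∈coded Dart? (rev (al-dart (E⊆ p)))) L₁
  ... | lab₂ , R₂ , L₂ , co , eq₂ , le₂ =
    lab₂ , R₂ , L₂ , inv , eq₂ ,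
    ≤-trans (+-cancelʳ-≤ ∣ ⟦ NonRep? ⟧ ∣ _ _ (≤-trans (≤-reflexive (sym al-split)) (≤-trans le₁ (≤-reflexive (+-comm ∣ ⟦ NonRep? ⟧ ∣ ∣ R₁ ∣))))) le₂
    where
    stay : ∀ {i} → i ∈ al → rep i ≡ false → lab₂ i ≡ lab₂ (φ i)
    stay {i} p q = co _ _ (eq₁ (dec-true (NonRep? i) (p , q)))
    zeros : ∀ a b c → 1 + (𝟙 a + (𝟙 b + 𝟙 c)) ≡ 1 → a ≡ false × b ≡ false × c ≡ false
    zeros false false false _ = refl , refl , refl
    zeros false false true ()
    zeros false true _ ()
    zeros true _ _ ()
    step : ∀ i → i ∈ al → lab₂ i ≡ lab₂ (φ i)
    step i p with rep i in eq
    ... | false = stay p eq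
    -- If i is the representative of its face, the other three links lead from `φ i` all the way
    -- around to i.
    ... | true with zeros (rep (φ i)) (rep (φ (φ i))) (rep (φ (φ (φ i))))
                    (trans (cong (λ b → 𝟙 b + (𝟙 (rep (φ i)) + (𝟙 (rep (φ (φ i))) + 𝟙 (rep (φ (φ (φ i))))))) (sym eq)) (rep-sum p))
    ...   | a , b , c = sym (trans (stay (φ-closed p) a) (trans (stay (φ-closed (φ-closed p)) b)
                          (trans (stay (φ-closed (φ-closed (φ-closed p))) c) (cong lab₂ (φ⁴ p)))))
    inv : FaceInv (λ u v → lab₂ (enc u v))
    inv {u} {v} D = trans (step _ (∈coded Dart? D)) (cong lab₂ (φ-enc u v))

  -- Any function that decreases towards the root excludes cycles, so `rank` can be the distance to
  -- the root in one tree, and attaching a leaf to another changes it at one place only.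
  record Tree (U : Sub N) (r : Fin N) (par : Fin N → Fin N) (rank : Fin N → ℕ) : Set where
    field
      root∈   : r ∈ U
      par∈    : ∀ {x} → x ∈ U → x ≢ r → par x ∈ U
      par-adj : ∀ {x} → x ∈ U → x ≢ r → d x (par x) ≡ 1
      par-<   : ∀ {x} → x ∈ U → x ≢ r → rank (par x) < rank x

  module _ {r par rank} (τ : Tree S r par rank) where
    open Tree τ

    IsPar : Fin N → Fin N → Set
    IsPar u v = u ≢ r × v ≡ par u

    IsPar? : ∀ u v → Dec (IsPar u v)
    IsPar? u v = ¬? (u ≟F r) ×-dec (v ≟F par u)

    Cot : Fin N → Fin N → Set
    Cot u v = Dart u v × ¬ IsPar u v × ¬ IsPar v u

    Cot? : ∀ u v → Dec (Cot u v)
    Cot? u v = Dart? u v ×-dec (¬? (IsPar? u v) ×-dec ¬? (IsPar? v u))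

    Cot-rev : ∀ {u v} → Cot u v → Cot v u
    Cot-rev (D , a , b) = rev D , b , a

    Cot<? : ∀ u v → Dec (Cot u v × toℕ u < toℕ v)
    Cot<? u v = Cot? u v ×-dec (toℕ u <? toℕ v)

    -- Turn around u, starting just behind the edge to its parent. Every other edge met is a cotree
    -- edge or leads to a child, where the claim holds by induction, so the label is carried to the
    -- other side of the parent edge. As `K` passes from parents to children, only cotree edges at
    -- the subtree below u are used.
    tree-sides : ∀ {L : Set} (_≟L_ : ∀ (a b : L) → Dec (a ≡ b)) (c : Fin N → Fin N → L) → FaceInv c →
      (K : Fin N → Set) → (∀ {x} → x ∈ S → x ≢ r → K (par x) → K x) →
      (∀ {u v} → K u → Cot u v → c u v ≡ c v u) →
      ∀ {u} → u ∈ S → K u → u ≢ r → c u (par u) ≡ c (par u) u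
    tree-sides _≟L_ c inv K down cot {u} = go (∑ rank) u (m≤n+m (∑ rank) (rank u))
      where
      -- No rank exceeds `∑ rank`, and ranks increase from parent to child, so the fuel bounds the
      -- remaining descent.
      go : ∀ fuel u → ∑ rank ≤ rank u + fuel → u ∈ S → K u → u ≢ r → c u (par u) ≡ c (par u) u
      go fuel u enough uS Ku u≢r =
        trans (dec-true⁻ (c u p ≟L c u s) (link uS (λ y → does (c u y ≟L c u s)) (λ xS xa → closed (dart xS uS xa))
                 (Dart.tgt P′) (Dart.adj (rev P′)) (dec-true (c u s ≟L c u s) refl)
                 (Dart.src P) (Dart.adj P)))
              (sym (inv P))
        where
        p = par u
        P : Dart p u
        P = rev (dart uS (par∈ uS u≢r) (par-adj uS u≢r))
        s = nx p u
        P′ : Dart u s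
        P′ = next P
        child : ∀ fuel → ∑ rank ≤ rank u + fuel → ∀ {x} → Dart x u → IsPar x u → c x u ≡ c u x
        child zero en {x} D (x≢r , refl) =
          ⊥-elim (<-irrefl refl (≤-trans (par-< (Dart.src D) x≢r) (≤-trans (∑-single rank x)
            (≤-trans en (≤-reflexive (+-identityʳ _))))))
        child (suc f) en {x} D (x≢r , refl) =
          go f x (≤-trans en (≤-trans (≤-reflexive (+-suc _ f)) (+-monoˡ-≤ f (par-< (Dart.src D) x≢r))))
             (Dart.src D) (down (Dart.src D) x≢r Ku) x≢r
        closed : ∀ {x} → Dart x u → does (c u x ≟L c u s) ≡ true → does (c u (nx x u) ≟L c u s) ≡ true
        closed {x} D h with x ≟F p
        ... | yes refl = dec-true (c u s ≟L c u s) refl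
        ... | no x≢p = dec-true (c u (nx x u) ≟L c u s) (trans (sym (inv D)) (trans sides (dec-true⁻ (c u x ≟L c u s) h)))
          where
          sides : c x u ≡ c u x
          sides with IsPar? x u
          ... | yes q = child fuel enough D q
          ... | no q = sym (cot Ku (rev D , (λ (_ , e) → x≢p e) , q))

    -- The cotree connects all faces.
    face-constant : ∀ {L : Set} (_≟L_ : ∀ (a b : L) → Dec (a ≡ b)) (c : Fin N → Fin N → L) → FaceInv c →
      (∀ {u v} → Cot u v → c u v ≡ c v u) → ∀ {u v u′ v′} → Dart u v → Dart u′ v′ → c u v ≡ c u′ v′
    face-constant _≟L_ c inv cot {u} {v} {u′} {v′} D D′ =
      trans (sym (proj₂ (proj₂ found))) (around (proj₁ (proj₂ found)) D′)
      where
      sides : ∀ {u v} → Dart u v → c u v ≡ c v u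
      sides {u} {v} D with IsPar? u v | IsPar? v u
      ... | yes (u≢r , refl) | _ = tree-sides _≟L_ c inv (λ _ → u ≡ u) (λ _ _ _ → refl) (λ _ → cot) (Dart.src D) refl u≢r
      ... | no _ | yes (v≢r , refl) = sym (tree-sides _≟L_ c inv (λ _ → u ≡ u) (λ _ _ _ → refl) (λ _ → cot) (Dart.tgt D) refl v≢r)
      ... | no a | no b = cot (D , a , b)
      around : ∀ {u x y} → Dart u x → Dart u y → c u x ≡ c u y
      around {u} {x} {y} X Y = sym (dec-true⁻ (c u y ≟L c u x) (link (Dart.src X) (λ y → does (c u y ≟L c u x))
        (λ {z} zS za h → dec-true (c u (nx z u) ≟L c u x) (trans (sym (inv (dart zS (Dart.src X) za)))
             (trans (sides (dart zS (Dart.src X) za)) (dec-true⁻ (c u z ≟L c u x) h))))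
        (Dart.tgt X) (Dart.adj (rev X)) (dec-true (c u x ≟L c u x) refl) (Dart.tgt Y) (Dart.adj (rev Y))))
      Some? : ∀ x → Dec (∃ λ y → Dart x y × c x y ≡ c u v)
      Some? x = any? (λ y → Dart? x y ×-dec (c x y ≟L c u v))
      pass : ∀ {a b} → Dart a b → (∃ λ y → Dart a y × c a y ≡ c u v) → ∃ λ y → Dart b y × c b y ≡ c u v
      pass {a} {b} A (y , Y , e) = a , rev A , trans (sym (sides A)) (trans (around A Y) e)
      found : ∃ λ y → Dart u′ y × c u′ y ≡ c u v
      found = dec-true⁻ (Some? u′) (trans (sym (connected (λ x → does (Some? x))
                (λ {a} {b} A → does-⇔ (Some? a) (Some? b) (pass A) (pass (rev A))) (Dart.src D) (Dart.src D′)))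
              (dec-true (Some? u) (v , D , refl)))

    TreeDart? : ∀ u v → Dec (u ∈ S × IsPar u v)
    TreeDart? u v = (u ∈? S) ×-dec IsPar? u v

    tree-darts : suc ∥ TreeDart? ∥ ≡ ∣ S ∣
    tree-darts = trans (cong suc (∑-cong row)) (sym (card-∖ S root∈))
      where
      row : ∀ u → ∑ (λ v → 𝟙 (does (TreeDart? u v))) ≡ 𝟙 ((S ∖ r) u)
      row u = trans (∑-cong (λ v → cell (S u) (u ≟F r) (v ≟F par u))) (∑-δ (par u) (λ _ → 𝟙 ((S ∖ r) u)))
        where
        cell : ∀ s {P Q : Set} (p : Dec P) (q : Dec Q) →
               𝟙 (does ((s Bool.≟ true) ×-dec (¬? p ×-dec q))) ≡ 𝟙 (does q) * 𝟙 (s ∧ not (does p))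
        cell true  (yes _) (yes _) = refl
        cell true  (yes _) (no _)  = refl
        cell true  (no _)  (yes _) = refl
        cell true  (no _)  (no _)  = refl
        cell false p       (yes _) = refl
        cell false p       (no _)  = refl

    cot< : Sub (N * N)
    cot< = coded Cot<?

    -- The ∣ S ∣ - 1 tree edges and the cotree edges, each taken in both directions, make up all
    -- darts.
    cot<-card : 2 * ∣ cot< ∣ + 2 * ∣ S ∣ ≡ ∣ al ∣ + 2
    cot<-card = begin
      2 * ∣ cot< ∣ + 2 * ∣ S ∣                        ≡⟨ cong₂ (λ a b → 2 * a + 2 * b) (card-coded Cot<?) (sym tree-darts) ⟩
      2 * ∥ Cot<? ∥ + 2 * suc ∥ TreeDart? ∥           ≡⟨ arith ∥ Cot<? ∥ ∥ TreeDart? ∥ ⟩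
      (∥ TreeDart? ∥ + (∥ TreeDart? ∥ + (∥ Cot<? ∥ + ∥ Cot<? ∥))) + 2 ≡⟨ cong (_+ 2) (sym total) ⟩
      ∥ Dart? ∥ + 2                                   ≡⟨ cong (_+ 2) (sym (card-coded Dart?)) ⟩
      ∣ al ∣ + 2                                      ∎
      where
      open ≡-Reasoning
      arith : ∀ k t → 2 * k + 2 * suc t ≡ (t + (t + (k + k))) + 2
      arith = solve-∀
      t t′ k k′ : Fin N → Fin N → ℕ
      t u v = 𝟙 (does (TreeDart? u v))
      t′ u v = t v u
      k u v = 𝟙 (does (Cot<? u v))
      k′ u v = k v u
      no-both : ∀ {u v} → u ∈ S → v ∈ S → IsPar u v → IsPar v u → ⊥
      no-both {u} uS vS (u≢r , refl) (v≢r , e) =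
        <-irrefl refl (<-trans (subst (λ z → rank z < rank (par u)) (sym e) (par-< vS v≢r)) (par-< uS u≢r))
      cell : ∀ u v → 𝟙 (does (Dart? u v)) ≡ t u v + (t v u + (k u v + k v u))
      cell u v = trans (𝟙-⊎ (Dart? u v) (TreeDart? u v) (Dart? u v ×-dec ¬? (TreeDart? u v)) f₁ tr⇒ proj₁ (λ a (_ , b) → b a))
        (cong (t u v +_)
        (trans (𝟙-⊎ (Dart? u v ×-dec ¬? (TreeDart? u v)) (TreeDart? v u) (Cot? u v) f₂ g₂
                 (λ { (D , a , b) → D , a ∘ proj₂ }) (λ { (_ , a) (_ , _ , b) → b a }))
        (cong (t v u +_) (𝟙-⊎ (Cot? u v) (Cot<? u v) (Cot<? v u) f₃ proj₁ (Cot-rev ∘ proj₁) (λ (_ , a) (_ , b) → <-asym a b)))))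
        where
        f₁ : Dart u v → (u ∈ S × IsPar u v) ⊎ (Dart u v × ¬ (u ∈ S × IsPar u v))
        f₁ D with TreeDart? u v
        ... | yes p = inj₁ p
        ... | no p = inj₂ (D , p)
        tr⇒ : ∀ {u v} → u ∈ S × IsPar u v → Dart u v
        tr⇒ (uS , u≢r , refl) = dart uS (par∈ uS u≢r) (par-adj uS u≢r)
        f₂ : Dart u v × ¬ (u ∈ S × IsPar u v) → (v ∈ S × IsPar v u) ⊎ Cot u v
        f₂ (D , a) with IsPar? v u
        ... | yes p = inj₁ (Dart.tgt D , p)
        ... | no p = inj₂ (D , (λ q → a (Dart.src D , q)) , p)
        g₂ : v ∈ S × IsPar v u → Dart u v × ¬ (u ∈ S × IsPar u v)
        g₂ (vS , p) = rev (tr⇒ (vS , p)) , λ (uS , q) → no-both uS vS q p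
        f₃ : Cot u v → (Cot u v × toℕ u < toℕ v) ⊎ (Cot v u × toℕ v < toℕ u)
        f₃ C with <-cmp (toℕ u) (toℕ v)
        ... | tri< a _ _ = inj₁ (C , a)
        ... | tri≈ _ e _ = ⊥-elim (adj-≢ (Dart.adj (proj₁ C)) (toℕ-injective e))
        ... | tri> _ _ a = inj₂ (Cot-rev C , a)
      ∑∑-+ : ∀ (f g : Fin N → Fin N → ℕ) → ∑ (λ u → ∑ (λ v → f u v + g u v)) ≡ ∑ (λ u → ∑ (f u)) + ∑ (λ u → ∑ (g u))
      ∑∑-+ f g = trans (∑-cong (λ u → ∑-+ (f u) (g u))) (∑-+ (λ u → ∑ (f u)) (λ u → ∑ (g u)))
      total : ∥ Dart? ∥ ≡ ∥ TreeDart? ∥ + (∥ TreeDart? ∥ + (∥ Cot<? ∥ + ∥ Cot<? ∥))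
      total = begin
        ∥ Dart? ∥                                           ≡⟨ ∑-cong (λ u → ∑-cong (λ v → cell u v)) ⟩
        ∑ (λ u → ∑ (λ v → t u v + (t′ u v + (k u v + k′ u v))))  ≡⟨ ∑∑-+ t (λ u v → t′ u v + (k u v + k′ u v)) ⟩
        ∥ TreeDart? ∥ + ∑ (λ u → ∑ (λ v → t′ u v + (k u v + k′ u v))) ≡⟨ cong (∥ TreeDart? ∥ +_) (∑∑-+ t′ (λ u v → k u v + k′ u v)) ⟩
        ∥ TreeDart? ∥ + (∑ (λ u → ∑ (t′ u)) + ∑ (λ u → ∑ (λ v → k u v + k′ u v))) ≡⟨ cong (∥ TreeDart? ∥ +_) (cong₂ _+_ (∑-swap t′) (trans (∑∑-+ k k′) (cong (∥ Cot<? ∥ +_) (∑-swap k′)))) ⟩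
        ∥ TreeDart? ∥ + (∥ TreeDart? ∥ + (∥ Cot<? ∥ + ∥ Cot<? ∥)) ∎

    cot<∈al : ∀ {i} → i ∈ cot< → i ∈ al
    cot<∈al {i} p = dec-true (Dart? (src i) (tgt i)) (proj₁ (proj₁ (dec-true⁻ (Cot<? (src i) (tgt i)) p)))

    -- Euler's inequality V - E + F ≤ 2, with F = E / 2.
    euler : 4 * ∣ S ∣ ≤ ∣ al ∣ + 8
    euler = ≤-from-slack 0 (*-monoʳ-≤ 4 (ρ≤ (face-labelling cot< cot<∈al))) count
      where
      ρ = ∣ ⟦ FaceRep? ⟧ ∣
      κ = ∣ cot< ∣
      ρ≤ : (∃ λ lab → ∃ λ R → Labelling al lab R × FaceInv (λ u v → lab (enc u v)) ×
             (∀ {i} → i ∈ cot< → lab i ≡ lab (swap i)) × ρ ≤ κ + ∣ R ∣) → ρ ≤ κ + 1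
      -- Crossing the κ cotree edges joins all ρ faces into at most one class, and each crossing
      -- loses at most one class.
      ρ≤ (lab , R , L , inv , eq , le) = ≤-trans le (+-monoʳ-≤ κ R≤1)
       where
       open Labelling L
       cot-eq : ∀ {u v} → Cot u v → lab (enc u v) ≡ lab (enc v u)
       cot-eq {u} {v} C with <-cmp (toℕ u) (toℕ v)
       ... | tri< a _ _ = trans (eq (∈coded Cot<? (C , a))) (cong lab (swap-enc u v))
       ... | tri≈ _ e _ = ⊥-elim (adj-≢ (Dart.adj (proj₁ C)) (toℕ-injective e))
       ... | tri> _ _ a = sym (trans (eq (∈coded Cot<? (Cot-rev C , a))) (cong lab (swap-enc v u)))
       const : ∀ {i j} → i ∈ al → j ∈ al → lab i ≡ lab j
       const {i} {j} p q = subst₂ (λ a b → lab a ≡ lab b) (enc-eta i) (enc-eta j)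
         (face-constant _≟F_ (λ u v → lab (enc u v)) inv cot-eq (al-dart p) (al-dart q))
       R≤1 : ∣ R ∣ ≤ 1
       R≤1 with ∣ R ∣ ≤? 1
       ... | yes p = p
       ... | no p with card-two R (≰⇒> p)
       ...   | x , y , xR , yR , ne = ⊥-elim (ne (trans (sym (fixR xR)) (trans (const (R⊆al xR) (R⊆al yR)) (fixR yR))))
      arith₁ : ∀ n κ → 4 * n + 4 * (κ + 1) + 0 ≡ 2 * (2 * κ + 2 * n) + 4
      arith₁ = solve-∀
      arith₂ : ∀ a → 2 * (a + 2) + 4 ≡ (a + 8) + a
      arith₂ = solve-∀
      count : 4 * ∣ S ∣ + 4 * (κ + 1) + 0 ≡ (∣ al ∣ + 8) + 4 * ρ
      count = begin
        4 * ∣ S ∣ + 4 * (κ + 1) + 0    ≡⟨ arith₁ ∣ S ∣ κ ⟩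
        2 * (2 * κ + 2 * ∣ S ∣) + 4    ≡⟨ cong (λ z → 2 * z + 4) cot<-card ⟩
        2 * (∣ al ∣ + 2) + 4           ≡⟨ arith₂ ∣ al ∣ ⟩
        (∣ al ∣ + 8) + ∣ al ∣          ≡⟨ cong ((∣ al ∣ + 8) +_) al≡4reps ⟩
        (∣ al ∣ + 8) + 4 * ρ           ∎
        where open ≡-Reasoning

    Colouring : Fin N → Fin N → Set
    Colouring u₀ v₀ = ∃ λ (X : Fin N → Fin N → Bool) → FaceInv X × X u₀ v₀ ≡ true × X v₀ u₀ ≡ false ×
      (∀ {u v} → Cot u v → ¬ (u ≡ u₀ × v ≡ v₀) → ¬ (u ≡ v₀ × v ≡ u₀) → X u v ≡ X v u)

    -- Jordan's theorem for the fundamental cycle of a cotree edge: in a sphere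
    -- the faces can be 2-coloured so that among the cotree edges only u₀v₀
    -- separates two colours.
    jordan : 4 * ∣ S ∣ ≡ ∣ al ∣ + 8 → ∀ {u₀ v₀} → Cot u₀ v₀ → Colouring u₀ v₀
    jordan tight {u₀} {v₀} C₀ = main (toℕ u₀ <? toℕ v₀)
      where
      Result : Set
      Result = Colouring u₀ v₀
      ρ = ∣ ⟦ FaceRep? ⟧ ∣
      κ = ∣ cot< ∣
      arith₁ : ∀ n κ → 4 * (κ + 1) + 4 * n ≡ 2 * (2 * κ + 2 * n) + 4
      arith₁ = solve-∀
      arith₂ : ∀ a → 2 * (a + 2) + 4 ≡ a + (a + 8)
      arith₂ = solve-∀
      -- Equality in Euler's formula: the cotree has one edge fewer than there are faces, so it is a
      -- spanning tree of the dual.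
      κ+1≡ρ : κ + 1 ≡ ρ
      κ+1≡ρ = *-cancelˡ-≡ (κ + 1) ρ 4 (+-cancelʳ-≡ (4 * ∣ S ∣) _ _ (begin
        4 * (κ + 1) + 4 * ∣ S ∣        ≡⟨ arith₁ ∣ S ∣ κ ⟩
        2 * (2 * κ + 2 * ∣ S ∣) + 4    ≡⟨ cong (λ z → 2 * z + 4) cot<-card ⟩
        2 * (∣ al ∣ + 2) + 4           ≡⟨ arith₂ ∣ al ∣ ⟩
        ∣ al ∣ + (∣ al ∣ + 8)          ≡⟨ cong₂ _+_ al≡4reps (sym tight) ⟩
        4 * ρ + 4 * ∣ S ∣              ∎))
        where open ≡-Reasoning
      from : ∀ {a b} → Cot a b → toℕ a < toℕ b → (∀ {u v} → u ≡ a × v ≡ b → (u ≡ u₀ × v ≡ v₀) ⊎ (u ≡ v₀ × v ≡ u₀)) → Result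
      from {a} {b} C a<b is = build (cot< ∖ enc a b) (λ p → cot<∈al (proj₁ (∖-∈⁻ cot< p)))
          (λ {u} {v} C q n → ∖-∈ cot< {enc a b} {enc u v} (∈coded Cot<? (C , q)) (λ e → n (is (combine-injective u v a b e))))
          (trans (+-suc ∣ cot< ∖ enc a b ∣ 1) (trans (cong (_+ 1) (sym (card-∖ cot< (∈coded Cot<? (C , a<b))))) κ+1≡ρ))
        where
        build : (E : Sub (N * N)) → (∀ {i} → i ∈ E → i ∈ al) →
                (∀ {u v} → Cot u v → toℕ u < toℕ v → ¬ ((u ≡ u₀ × v ≡ v₀) ⊎ (u ≡ v₀ × v ≡ u₀)) → enc u v ∈ E) →
                ∣ E ∣ + 2 ≡ ρ → Result
        build E E⊆ ∈E count with face-labelling E E⊆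
        ... | lab , R , L , inv , eq , le =
          (λ u v → does (lab (enc u v) ≟F ℓ)) , (λ D → cong (λ z → does (z ≟F ℓ)) (inv D)) ,
          dec-true (ℓ ≟F ℓ) refl , dec-false (lab (enc v₀ u₀) ≟F ℓ) (λ e → differ (sym e)) ,
          (λ C n₁ n₂ → cong (λ z → does (z ≟F ℓ)) (others C n₁ n₂))
          where
          open Labelling L
          ℓ = lab (enc u₀ v₀)
          others : ∀ {u v} → Cot u v → ¬ (u ≡ u₀ × v ≡ v₀) → ¬ (u ≡ v₀ × v ≡ u₀) → lab (enc u v) ≡ lab (enc v u)
          others {u} {v} C n₁ n₂ with <-cmp (toℕ u) (toℕ v)
          ... | tri< q _ _ = trans (eq (∈E C q [ n₁ , n₂ ]′)) (cong lab (swap-enc u v))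
          ... | tri≈ _ e _ = ⊥-elim (adj-≢ (Dart.adj (proj₁ C)) (toℕ-injective e))
          ... | tri> _ _ q = sym (trans (eq (∈E (Cot-rev C) q [ (λ (x , y) → n₂ (y , x)) , (λ (x , y) → n₁ (y , x)) ]′)) (cong lab (swap-enc v u)))
          -- Without the edge u₀v₀ only ρ - 2 identifications are made. If the two sides of u₀v₀
          -- nevertheless had the same label, `face-constant` would leave just one class.
          two : 2 ≤ ∣ R ∣
          two = +-cancelˡ-≤ ∣ E ∣ _ _ (≤-trans (≤-reflexive count) le)
          differ : lab (enc u₀ v₀) ≢ lab (enc v₀ u₀)
          differ e with card-two R two
          ... | x , y , xR , yR , ne = ne (trans (sym (fixR xR)) (trans (subst₂ (λ a b → lab a ≡ lab b) (enc-eta x) (enc-eta y)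
                  (face-constant _≟F_ (λ u v → lab (enc u v)) inv all-eq (al-dart (R⊆al xR)) (al-dart (R⊆al yR)))) (fixR yR)))
            where
            all-eq : ∀ {u v} → Cot u v → lab (enc u v) ≡ lab (enc v u)
            all-eq {u} {v} C with (u ≟F u₀) ×-dec (v ≟F v₀) | (u ≟F v₀) ×-dec (v ≟F u₀)
            ... | yes (refl , refl) | _ = e
            ... | no _ | yes (refl , refl) = sym e
            ... | no n₁ | no n₂ = others C n₁ n₂
      main : Dec (toℕ u₀ < toℕ v₀) → Result
      main (yes p) = from C₀ p inj₁
      main (no np) = from (Cot-rev C₀) (≤∧≢⇒< (≮⇒≥ np) (λ e → adj-≢ (Dart.adj (proj₁ C₀)) (toℕ-injective (sym e)))) inj₂

-- Bipartiteness of spheres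

card-ext : ∀ {N} {S T : Sub N} → (∀ x → x ∈ S → x ∈ T) → (∀ x → x ∈ T → x ∈ S) → ∣ S ∣ ≡ ∣ T ∣
card-ext {S = S} {T} f g = ≤-antisym (card-mono {S = S} {T} f) (card-mono {S = T} {S} g)

symmetric-even : ∀ {N} {P : Fin N → Fin N → Set} (P? : ∀ u v → Dec (P u v)) →
  (∀ {u v} → P u v → P v u) → (∀ {u v} → P u v → u ≢ v) → ∃ λ k → ∥ P? ∥ ≡ k + k
symmetric-even {N} {P} P? s irr = ∑ (λ u → ∑ (λ v → k u v)) , (begin
  ∥ P? ∥                                             ≡⟨ ∑-cong (λ u → trans (∑-cong (λ v → cell u v)) (∑-+ (k u) (λ v → k v u))) ⟩
  ∑ (λ u → ∑ (k u) + ∑ (λ v → k v u))                ≡⟨ ∑-+ (λ u → ∑ (k u)) (λ u → ∑ (λ v → k v u)) ⟩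
  ∑ (λ u → ∑ (k u)) + ∑ (λ u → ∑ (λ v → k v u))      ≡⟨ cong (∑ (λ u → ∑ (k u)) +_) (∑-swap (λ u v → k v u)) ⟩
  ∑ (λ u → ∑ (k u)) + ∑ (λ u → ∑ (k u))              ∎)
  where
  open ≡-Reasoning
  P<? : ∀ u v → Dec (P u v × toℕ u < toℕ v)
  P<? u v = P? u v ×-dec (toℕ u <? toℕ v)
  k : Fin N → Fin N → ℕ
  k u v = 𝟙 (does (P<? u v))
  cell : ∀ u v → 𝟙 (does (P? u v)) ≡ k u v + k v u
  cell u v = 𝟙-⊎ (P? u v) (P<? u v) (P<? v u) f proj₁ (s ∘ proj₁) (λ (_ , a) (_ , b) → <-asym a b)
    where
    f : P u v → (P u v × toℕ u < toℕ v) ⊎ (P v u × toℕ v < toℕ u)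
    f p with <-cmp (toℕ u) (toℕ v)
    ... | tri< a _ _ = inj₁ (p , a)
    ... | tri≈ _ e _ = ⊥-elim (irr p (toℕ-injective e))
    ... | tri> _ _ a = inj₂ (s p , a)

a+a≢1+b+b : ∀ a b → a + a ≢ suc (b + b)
a+a≢1+b+b a b e = even≢odd a b (trans (cong (a +_) (+-identityʳ a)) (trans e (cong (λ z → suc (b + z)) (sym (+-identityʳ b)))))

module Bipartite {N} {d : Fin N → Fin N → ℕ} (M : Metric d)
                 {S : Sub N} {nx : Fin N → Fin N → Fin N} (G : Surf d S nx) where
  open Metric M
  open Surf G
  open Surface M G
  open Code N
  open Cotree M G

  module _ {r : Fin N} (rS : r ∈ S) where
    bfs-par : Fin N → Fin N
    bfs-par x with x ∈? S | x ≟F r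
    ... | yes p | no ne = proj₁ (geo p rS ne)
    ... | _     | _     = x

    bfs-spec : ∀ {x} → x ∈ S → x ≢ r → bfs-par x ∈ S × d x (bfs-par x) ≡ 1 × suc (d (bfs-par x) r) ≡ d x r
    bfs-spec {x} p ne with x ∈? S | x ≟F r
    ... | yes p′ | no ne′ = proj₂ (geo p′ rS ne′)
    ... | yes _  | yes e = ⊥-elim (ne e)
    ... | no n   | _ = ⊥-elim (n p)

    bfs : Tree S r bfs-par (λ x → d x r)
    bfs = record
      { root∈ = rS
      ; par∈ = λ p ne → proj₁ (bfs-spec p ne)
      ; par-adj = λ p ne → proj₁ (proj₂ (bfs-spec p ne))
      ; par-< = λ p ne → ≤-reflexive (proj₂ (proj₂ (bfs-spec p ne))) }

    -- The closed walks bounding the faces on one side of the fundamental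
    -- cycle of an edge u₀v₀ inside a level use an even number of such edges,
    -- and u₀v₀ is the only one used exactly once.
    bipartite : 4 * ∣ S ∣ ≡ ∣ al ∣ + 8 → ∀ {u v} → Dart u v → d u r ≢ d v r
    bipartite tight {u₀} {v₀} D₀ e₀ = contra (jordan bfs tight (bad⇒Cot D₀ e₀))
      where
      bad⇒Cot : ∀ {u v} → Dart u v → d u r ≡ d v r → Cot bfs u v
      bad⇒Cot D e = D , (λ { (ne , refl) → <⇒≢ (≤-reflexive (proj₂ (proj₂ (bfs-spec (Dart.src D) ne)))) (sym e) })
                      , (λ { (ne , refl) → <⇒≢ (≤-reflexive (proj₂ (proj₂ (bfs-spec (Dart.tgt D) ne)))) e })
      contra : Colouring bfs u₀ v₀ → ⊥
      contra (X , inv , X₀ , X₀′ , cot) = a+a≢1+b+b (q + q) (∣ coded Up? ∣ + proj₁ B-even) (begin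
          q + q + (q + q)                                          ≡⟨ sym (quad q) ⟩
          4 * q                                                    ≡⟨ sym X-mod-4 ⟩
          ∣ coded DX? ∣                                            ≡⟨ split₁ ⟩
          ∣ coded Up? ∣ + ∣ coded Rest? ∣                          ≡⟨ cong (∣ coded Up? ∣ +_) split₂ ⟩
          ∣ coded Up? ∣ + (∣ coded Down? ∣ + ∣ coded Bad? ∣)       ≡⟨ cong₂ (λ a b → ∣ coded Up? ∣ + (a + b)) (sym up≡down) bad-odd ⟩
          ∣ coded Up? ∣ + (∣ coded Up? ∣ + suc (b + b))            ≡⟨ regroup ∣ coded Up? ∣ b ⟩
          suc (∣ coded Up? ∣ + b + (∣ coded Up? ∣ + b))            ∎)
        where
        open ≡-Reasoning
        ℓ : Fin N → ℕ
        ℓ x = d x r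
        DX? : ∀ u v → Dec (Dart u v × X u v ≡ true)
        DX? u v = Dart? u v ×-dec (X u v Bool.≟ true)
        Up? : ∀ u v → Dec ((Dart u v × X u v ≡ true) × ℓ v ≡ suc (ℓ u))
        Up? u v = DX? u v ×-dec (ℓ v ℕ.≟ suc (ℓ u))
        Down? : ∀ u v → Dec ((Dart u v × X u v ≡ true) × ℓ u ≡ suc (ℓ v))
        Down? u v = DX? u v ×-dec (ℓ u ℕ.≟ suc (ℓ v))
        Bad? : ∀ u v → Dec ((Dart u v × X u v ≡ true) × ℓ u ≡ ℓ v)
        Bad? u v = DX? u v ×-dec (ℓ u ℕ.≟ ℓ v)
        Rest? : ∀ u v → Dec ((Dart u v × X u v ≡ true) × ℓ v ≢ suc (ℓ u))
        Rest? u v = DX? u v ×-dec ¬? (ℓ v ℕ.≟ suc (ℓ u))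
        B : Fin N → Fin N → Set
        B u v = ((Dart u v × X u v ≡ true) × ℓ u ≡ ℓ v) × ¬ (u ≡ u₀ × v ≡ v₀)
        B? : ∀ u v → Dec (B u v)
        B? u v = Bad? u v ×-dec ¬? ((u ≟F u₀) ×-dec (v ≟F v₀))
        lip : ∀ {u v} → Dart u v → ℓ u ≤ suc (ℓ v)
        lip {u} {v} D = subst₂ (λ a b → a ≤ suc b) (d-sym r u) (d-sym r v) (d-lip r D)
        split₁ : ∣ coded DX? ∣ ≡ ∣ coded Up? ∣ + ∣ coded Rest? ∣
        split₁ = card-∪ {S = coded Up?} {T = coded Rest?} (λ i → 𝟙-⊎ (DX? (src i) (tgt i)) (Up? (src i) (tgt i)) (Rest? (src i) (tgt i))
          (λ D → case ℓ (tgt i) ℕ.≟ suc (ℓ (src i)) of λ where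
            (yes e) → inj₁ (D , e)
            (no ne) → inj₂ (D , ne)) proj₁ proj₁ (λ (_ , e) (_ , ne) → ne e))
        split₂ : ∣ coded Rest? ∣ ≡ ∣ coded Down? ∣ + ∣ coded Bad? ∣
        split₂ = card-∪ {S = coded Down?} {T = coded Bad?} (λ i → 𝟙-⊎ (Rest? (src i) (tgt i)) (Down? (src i) (tgt i)) (Bad? (src i) (tgt i))
          (λ (D , ne) → case <-cmp (ℓ (src i)) (ℓ (tgt i)) of λ where
            (tri< a _ _) → ⊥-elim (ne (≤-antisym (lip (rev (proj₁ D))) a))
            (tri≈ _ e _) → inj₂ (D , e)
            (tri> _ _ a) → inj₁ (D , ≤-antisym (lip (proj₁ D)) a))
          (λ (D , e) → D , λ e′ → <-irrefl (trans e′ (cong suc e)) (m≤n⇒m≤1+n ≤-refl))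
          (λ (D , e) → D , λ e′ → <-irrefl (trans e e′) ≤-refl)
          (λ (_ , e) (_ , e′) → <-irrefl (trans (sym e′) e) ≤-refl))
        w : Fin (N * N) → ℕ
        w i = 𝟙 (X (src i) (tgt i))
        X-enc : ∀ {i} → i ∈ al → X (src (φ i)) (tgt (φ i)) ≡ X (src i) (tgt i)
        X-enc {i} p = trans (cong₂ X (src-enc _ _) (tgt-enc _ _)) (sym (inv (al-dart p)))
        DX-𝟙 : ∀ i → 𝟙 (coded DX? i) ≡ 𝟙 (al i) * w i
        DX-𝟙 i with Dart? (src i) (tgt i) | X (src i) (tgt i)
        ... | yes _ | true = refl
        ... | yes _ | false = refl
        ... | no _ | _ = refl
        q = ∑ (λ i → 𝟙 (al i) * (w i * 𝟙 (rep i)))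
        X-mod-4 : ∣ coded DX? ∣ ≡ 4 * q
        X-mod-4 = trans (∑-cong DX-𝟙) (four-reps w (λ p → cong 𝟙 (X-enc p)))
        quad : ∀ x → 4 * x ≡ x + x + (x + x)
        quad = solve-∀
        regroup : ∀ u b → u + (u + suc (b + b)) ≡ suc (u + b + (u + b))
        regroup = solve-∀
        -- `φ` permutes the darts of the coloured faces, and the target of a dart is the source of
        -- the next one.
        flow : ∑ (λ i → 𝟙 (al i) * (w i * ℓ (tgt i))) ≡ ∑ (λ i → 𝟙 (al i) * (w i * ℓ (src i)))
        flow = trans (∑-cong pt) (reindex al φ (φ ∘ φ ∘ φ) φ-closed (φ-closed ∘ φ-closed ∘ φ-closed) φ⁴ φ⁴ (λ i → w i * ℓ (src i)))
          where
          pt : ∀ i → 𝟙 (al i) * (w i * ℓ (tgt i)) ≡ 𝟙 (al i) * (w (φ i) * ℓ (src (φ i)))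
          pt i with al i in p
          ... | false = refl
          ... | true = cong₂ (λ a b → a * ℓ b + 0) (sym (cong 𝟙 (X-enc p))) (sym (src-enc _ _))
        -- The level changes by 1, -1 or 0 along a dart, and by `flow` these changes cancel in
        -- total.
        up≡down : ∣ coded Up? ∣ ≡ ∣ coded Down? ∣
        up≡down = +-cancelˡ-≡ (∑ (λ i → 𝟙 (al i) * (w i * ℓ (src i)))) _ _ (begin
          ∑ ws + ∣ coded Up? ∣                                ≡⟨ sym (∑-+ ws (𝟙 ∘ coded Up?)) ⟩
          ∑ (λ i → ws i + 𝟙 (coded Up? i))                    ≡⟨ ∑-cong pt ⟩
          ∑ (λ i → wt i + 𝟙 (coded Down? i))                  ≡⟨ ∑-+ wt (𝟙 ∘ coded Down?) ⟩
          ∑ wt + ∣ coded Down? ∣                              ≡⟨ cong (_+ ∣ coded Down? ∣) flow ⟩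
          ∑ ws + ∣ coded Down? ∣                              ∎)
          where
          ws wt : Fin (N * N) → ℕ
          ws i = 𝟙 (al i) * (w i * ℓ (src i))
          wt i = 𝟙 (al i) * (w i * ℓ (tgt i))
          num : ∀ a b → a ≤ suc b → b ≤ suc a →
                a + 0 + 0 + 𝟙 (does (b ℕ.≟ suc a)) ≡ b + 0 + 0 + 𝟙 (does (a ℕ.≟ suc b))
          num a b p q with <-cmp a b
          ... | tri≈ _ refl _ rewrite dec-false (a ℕ.≟ suc a) (<⇒≢ ≤-refl) = refl
          ... | tri< l _ _ with ≤-antisym l q
          ...   | refl rewrite dec-true (suc a ℕ.≟ suc a) refl | dec-false (a ℕ.≟ suc (suc a)) (<⇒≢ (m<n⇒m<1+n ≤-refl)) = s a
            where
            s : ∀ a → a + 0 + 0 + 1 ≡ suc a + 0 + 0 + 0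
            s = solve-∀
          num a b p q | tri> _ _ l with ≤-antisym l p
          ...   | refl rewrite dec-true (suc b ℕ.≟ suc b) refl | dec-false (b ℕ.≟ suc (suc b)) (<⇒≢ (m<n⇒m<1+n ≤-refl)) = s b
            where
            s : ∀ a → suc a + 0 + 0 + 0 ≡ a + 0 + 0 + 1
            s = solve-∀
          pt : ∀ i → ws i + 𝟙 (coded Up? i) ≡ wt i + 𝟙 (coded Down? i)
          pt i with Dart? (src i) (tgt i) | X (src i) (tgt i)
          ... | no _ | _ = refl
          ... | yes _ | false = refl
          ... | yes D | true = num (ℓ (src i)) (ℓ (tgt i)) (lip D) (lip (rev D))
        B-even : ∃ λ k → ∥ B? ∥ ≡ k + k
        B-even = symmetric-even B? B-sym (λ (((D , _) , _) , _) → adj-≢ (Dart.adj D))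
          where
          B-sym : ∀ {u v} → B u v → B v u
          B-sym {u} {v} (((D , x) , e) , n) = ((rev D , trans (sym (cot (bad⇒Cot D e) n n′)) x) , sym e) , λ (a , b) → n′ (b , a)
            where
            n′ : ¬ (u ≡ v₀ × v ≡ u₀)
            n′ (refl , refl) = true≢false x X₀′
        b = proj₁ B-even
        -- The reverse of u₀v₀ belongs to the other colour by `X₀′`, whereas every other dart inside
        -- a level occurs together with its reverse.
        bad-odd : ∣ coded Bad? ∣ ≡ suc (b + b)
        bad-odd = trans (card-∖ (coded Bad?) (∈coded Bad? ((D₀ , X₀) , e₀))) (cong suc (trans (card-ext {S = coded Bad? ∖ enc u₀ v₀} {T = coded B?} f g)
                    (trans (card-coded B?) (proj₂ B-even))))
          where
          f : ∀ i → i ∈ (coded Bad? ∖ enc u₀ v₀) → i ∈ coded B?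
          f i p with ∖-∈⁻ (coded Bad?) p
          ... | q , ne = dec-true (B? (src i) (tgt i)) (dec-true⁻ (Bad? (src i) (tgt i)) q ,
                  λ (a , c) → ne (trans (sym (enc-eta i)) (cong₂ enc a c)))
          g : ∀ i → i ∈ coded B? → i ∈ (coded Bad? ∖ enc u₀ v₀)
          g i p with dec-true⁻ (B? (src i) (tgt i)) p
          ... | q , n = ∖-∈ (coded Bad?) (dec-true (Bad? (src i) (tgt i)) q)
                  λ e → n (trans (cong src e) (src-enc _ _) , trans (cong tgt e) (tgt-enc _ _))

-- Growing spanning trees

Bool-ext : ∀ {b c} → (b ≡ true → c ≡ true) → (c ≡ true → b ≡ true) → b ≡ c
Bool-ext {true} {true} f g = refl
Bool-ext {false} {false} f g = refl
Bool-ext {true} {false} f g = sym (f refl)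
Bool-ext {false} {true} f g = g refl

_[_↦_] : ∀ {N} {L : Set} → (Fin N → L) → Fin N → L → Fin N → L
(f [ y ↦ z ]) x = if does (x ≟F y) then z else f x

update-at : ∀ {N} {L : Set} (f : Fin N → L) y z → (f [ y ↦ z ]) y ≡ z
update-at f y z rewrite dec-true (y ≟F y) refl = refl

update-off : ∀ {N} {L : Set} (f : Fin N → L) {y x} z → x ≢ y → (f [ y ↦ z ]) x ≡ f x
update-off f {y} {x} z ne rewrite dec-false (x ≟F y) ne = refl

-- A property of the whole metric space and not of a subset, so that every piece inherits it.
Bip : ∀ {N} → (Fin N → Fin N → ℕ) → Set
Bip d = ∀ {u v} r → d u v ≡ 1 → d u r ≢ d v r

module Grow {N} {d : Fin N → Fin N → ℕ} (M : Metric d)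
            {S : Sub N} {nx : Fin N → Fin N → Fin N} (G : Surf d S nx) where
  open Metric M
  open Surf G
  open Surface M G
  open Cotree M G using (Tree)

  attach : ∀ {U r par rank} → Tree U r par rank → ∀ y x → ¬ (y ∈ U) → x ∈ U → d y x ≡ 1 →
           Tree (U [ y ↦ true ]) r (par [ y ↦ x ]) (rank [ y ↦ suc (rank x) ])
  attach {U} {r} {par} {rank} τ y x y∉ xU e = record
    { root∈ = old root∈ ; par∈ = P∈ ; par-adj = Padj ; par-< = P< }
    where
    open Tree τ
    old≢ : ∀ {z} → z ∈ U → z ≢ y
    old≢ zU refl = y∉ zU
    old : ∀ {z} → z ∈ U → z ∈ (U [ y ↦ true ])
    old zU = trans (update-off U true (old≢ zU)) zU
    inv : ∀ {z} → z ∈ (U [ y ↦ true ]) → z ≢ y → z ∈ U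
    inv p ne = trans (sym (update-off U true ne)) p
    P∈ : ∀ {z} → z ∈ (U [ y ↦ true ]) → z ≢ r → (par [ y ↦ x ]) z ∈ (U [ y ↦ true ])
    P∈ {z} p ne with z ≟F y
    ... | yes refl = old xU
    ... | no h = old (par∈ p ne)
    Padj : ∀ {z} → z ∈ (U [ y ↦ true ]) → z ≢ r → d z ((par [ y ↦ x ]) z) ≡ 1
    Padj {z} p ne with z ≟F y
    ... | yes refl = e
    ... | no h = par-adj p ne
    P< : ∀ {z} → z ∈ (U [ y ↦ true ]) → z ≢ r →
         (rank [ y ↦ suc (rank x) ]) ((par [ y ↦ x ]) z) < (rank [ y ↦ suc (rank x) ]) z
    P< {z} p ne with z ≟F y
    ... | yes refl = ≤-reflexive (cong suc (update-off rank _ (old≢ xU)))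
    ... | no h = subst (_< rank z) (sym (update-off rank _ (old≢ (par∈ p ne)))) (par-< p ne)

  -- Parents already chosen on U are kept, so that tree paths prescribed there survive.
  Extends : Sub N → Fin N → (Fin N → Fin N) → Sub N → Set
  Extends U r par T = ∃ λ par′ → ∃ λ rank′ → Tree T r par′ rank′ × (∀ {x} → x ∈ U → par′ x ≡ par x)

  Stuck : Sub N → Sub N → Set
  Stuck U T = ∃ λ U′ → (∀ {x} → x ∈ U → x ∈ U′) × (∀ {x} → x ∈ U′ → x ∈ T) ×
    (∃ λ y → y ∈ T × ¬ (y ∈ U′)) × (∀ {x y} → x ∈ U′ → y ∈ T → ¬ (y ∈ U′) → d y x ≢ 1)

  -- Adjacent vertices of T are attached while there are any. If some of T is never reached, the
  -- vertices reached have no edge to the rest; `side-tree` turns this into a smaller cut.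
  grow : ∀ fuel {U T r par rank} → (∀ {x} → x ∈ U → x ∈ T) →
         ∣ ⟦ (λ x → (x ∈? T) ×-dec ¬? (x ∈? U)) ⟧ ∣ ≤ fuel → Tree U r par rank → Extends U r par T ⊎ Stuck U T
  grow fuel {U} {T} {r} {par} {rank} U⊆T le τ
    with any? (λ y → any? (λ x → ((y ∈? T) ×-dec ¬? (y ∈? U)) ×-dec ((x ∈? U) ×-dec (d y x ℕ.≟ 1))))
  ... | no none = rest (any? (λ y → (y ∈? T) ×-dec ¬? (y ∈? U)))
    where
    rest : Dec (∃ λ y → y ∈ T × ¬ (y ∈ U)) → Extends U r par T ⊎ Stuck U T
    rest (yes missing) = inj₂ (U , id , U⊆T , missing , λ {x} {y} xU yT yU e → none (y , x , (yT , yU) , xU , e))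
    rest (no all) = inj₁ (par , rank , record
      { root∈ = U⊆T root∈ ; par∈ = λ p ne → U⊆T (par∈ (back p) ne)
      ; par-adj = λ p → par-adj (back p) ; par-< = λ p → par-< (back p) } , λ _ → refl)
      where
      open Tree τ
      back : ∀ {x} → x ∈ T → x ∈ U
      back {x} p with x ∈? U
      ... | yes q = q
      ... | no q = ⊥-elim (all (x , p , q))
  grow zero {U} {T} U⊆T le τ | yes (y , x , (yT , yU) , _) =
    ⊥-elim (<⇒≱ (card-≥1 ⟦ (λ x → (x ∈? T) ×-dec ¬? (x ∈? U)) ⟧ (dec-true ((y ∈? T) ×-dec ¬? (y ∈? U)) (yT , yU))) le)
  grow (suc fuel) {U} {T} {r} {par} {rank} U⊆T le τ | yes (y , x , (yT , yU) , xU , e)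
    with grow fuel {U [ y ↦ true ]} {T} U′⊆T (≤-pred (≤-trans less le)) (attach τ y x yU xU e)
    where
    U′ = U [ y ↦ true ]
    old : ∀ {z} → z ∈ U → z ∈ U′
    old {z} p = trans (update-off U true (λ { refl → yU p })) p
    U′⊆T : ∀ {z} → z ∈ U′ → z ∈ T
    U′⊆T {z} p with z ≟F y
    ... | yes refl = yT
    ... | no ne = U⊆T p
    less : ∣ ⟦ (λ x → (x ∈? T) ×-dec ¬? (x ∈? U′)) ⟧ ∣ < ∣ ⟦ (λ x → (x ∈? T) ×-dec ¬? (x ∈? U)) ⟧ ∣
    less = card-< {S = ⟦ (λ x → (x ∈? T) ×-dec ¬? (x ∈? U′)) ⟧} {T = ⟦ (λ x → (x ∈? T) ×-dec ¬? (x ∈? U)) ⟧} y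
      (λ z p → case dec-true⁻ ((z ∈? T) ×-dec ¬? (z ∈? U′)) p of λ (a , b) → dec-true ((z ∈? T) ×-dec ¬? (z ∈? U)) (a , b ∘ old))
      (dec-true ((y ∈? T) ×-dec ¬? (y ∈? U)) (yT , yU))
      (λ p → proj₂ (dec-true⁻ ((y ∈? T) ×-dec ¬? (y ∈? U′)) p) (update-at U y true))
  ... | inj₁ (par′ , rank′ , τ′ , ag) =
        inj₁ (par′ , rank′ , τ′ , λ {z} p → trans (ag (trans (update-off U true (λ { refl → yU p })) p)) (update-off par x (λ { refl → yU p })))
  ... | inj₂ (U″ , sub , sub′ , miss , sep) =
        inj₂ (U″ , (λ {z} p → sub (trans (update-off U true (λ { refl → yU p })) p)) , sub′ , miss , sep)

  singleton : ∀ r → Tree ⟦ (λ x → x ≟F r) ⟧ r id (λ _ → 0)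
  singleton r = record
    { root∈ = dec-true (r ≟F r) refl
    ; par∈ = λ p _ → p
    ; par-adj = λ {x} p ne → ⊥-elim (ne (dec-true⁻ (x ≟F r) p))
    ; par-< = λ {x} p ne → ⊥-elim (ne (dec-true⁻ (x ≟F r) p)) }

  spanning : ∀ {U r par rank} → (∀ {x} → x ∈ U → x ∈ S) → Tree U r par rank → Extends U r par S
  spanning {U} {r} U⊆S τ with grow ∣ ⟦ (λ x → (x ∈? S) ×-dec ¬? (x ∈? U)) ⟧ ∣ U⊆S ≤-refl τ
  ... | inj₁ e = e
  ... | inj₂ (U′ , sub , sub′ , (y , yS , yU) , sep) =
    ⊥-elim (yU (trans (connected U′ loc yS (U⊆S (Tree.root∈ τ))) (sub (Tree.root∈ τ))))
    where
    loc : ∀ {u v} → Dart u v → U′ u ≡ U′ v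
    loc {u} {v} D with u ∈? U′ | v ∈? U′
    ... | yes p | yes q = trans p (sym q)
    ... | no p | no q = trans (¬true p) (sym (¬true q))
    ... | yes p | no q = ⊥-elim (sep p (Dart.tgt D) q (Dart.adj (rev D)))
    ... | no p | yes q = ⊥-elim (sep q (Dart.src D) p (Dart.adj D))

-- Cuts

record Cut {N} (d : Fin N → Fin N → ℕ) (S : Sub N) (a c : Fin N) (A C : Sub N) : Set where
  field
    a∈   : a ∈ S
    c∈   : c ∈ S
    a≢c  : a ≢ c
    A⊆   : ∀ {x} → x ∈ A → x ∈ S
    C⊆   : ∀ {x} → x ∈ C → x ∈ S
    part : ∀ {x} → x ∈ S → x ∈ A ⊎ x ∈ C ⊎ x ≡ a ⊎ x ≡ c
    disj : ∀ {x} → x ∈ A → ¬ (x ∈ C)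
    a∉A  : ¬ (a ∈ A)
    a∉C  : ¬ (a ∈ C)
    c∉A  : ¬ (c ∈ A)
    c∉C  : ¬ (c ∈ C)
    noE  : ∀ {x y} → x ∈ A → y ∈ C → d x y ≢ 1
    A-in : ∃ λ x → x ∈ A
    C-in : ∃ λ x → x ∈ C

module _ {N} {d : Fin N → Fin N → ℕ} (M : Metric d) {S : Sub N} where
  open Metric M

  swap-sides : ∀ {a c A C} → Cut d S a c A C → Cut d S a c C A
  swap-sides K = record
    { a∈ = a∈ ; c∈ = c∈ ; a≢c = a≢c ; A⊆ = C⊆ ; C⊆ = A⊆
    ; part = λ p → case part p of λ where
        (inj₁ q) → inj₂ (inj₁ q)
        (inj₂ (inj₁ q)) → inj₁ q
        (inj₂ (inj₂ q)) → inj₂ (inj₂ q)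
    ; disj = λ p q → disj q p ; a∉A = a∉C ; a∉C = a∉A ; c∉A = c∉C ; c∉C = c∉A
    ; noE = λ p q e → noE q p (trans (d-sym _ _) e) ; A-in = C-in ; C-in = A-in }
    where open Cut K

  swap-poles : ∀ {a c A C} → Cut d S a c A C → Cut d S c a A C
  swap-poles K = record
    { a∈ = c∈ ; c∈ = a∈ ; a≢c = a≢c ∘ sym ; A⊆ = A⊆ ; C⊆ = C⊆
    ; part = λ p → case part p of λ where
        (inj₁ q) → inj₁ q
        (inj₂ (inj₁ q)) → inj₂ (inj₁ q)
        (inj₂ (inj₂ (inj₁ q))) → inj₂ (inj₂ (inj₂ q))
        (inj₂ (inj₂ (inj₂ q))) → inj₂ (inj₂ (inj₁ q))
    ; disj = disj ; a∉A = c∉A ; a∉C = c∉C ; c∉A = a∉A ; c∉C = a∉C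
    ; noE = noE ; A-in = A-in ; C-in = C-in }
    where open Cut K

module Corners {N} {d : Fin N → Fin N → ℕ} (M : Metric d) (bip : Bip d)
               {S : Sub N} {nx : Fin N → Fin N → Fin N} (G : Surf d S nx) where
  open Metric M
  open Surf G
  open Surface M G
  open Cotree M G hiding (φ; swap)
  open Code N
  open Grow M G

  Corner : Fin N → Sub N → Sub N → Fin N → Set
  Corner a A C x = x ∈ A × d x a ≡ 1 × nx x a ∈ C

  Tight : Set
  Tight = 4 * ∣ S ∣ ≡ ∣ al ∣ + 8

  module _ {a c A C} (K : Cut d S a c A C) where
    open Cut K

    -- Otherwise c alone would separate A from a, against `separate`.
    A-neighbour : ∃ λ x → x ∈ A × d x a ≡ 1
    A-neighbour with any? (λ x → (x ∈? A) ×-dec (d x a ℕ.≟ 1))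
    ... | yes e = e
    ... | no none = ⊥-elim (a∉A (trans (sym (separate c A loc (A⊆ (proj₂ A-in)) a∈ (λ e → c∉A (subst (_∈ A) e (proj₂ A-in))) a≢c)) (proj₂ A-in)))
      where
      half : ∀ {u v} → Dart u v → v ≢ c → u ∈ A → v ∈ A
      half D v≢c p with part (Dart.tgt D)
      ... | inj₁ q = q
      ... | inj₂ (inj₁ q) = ⊥-elim (noE p q (Dart.adj D))
      ... | inj₂ (inj₂ (inj₁ refl)) = ⊥-elim (none (_ , p , Dart.adj D))
      ... | inj₂ (inj₂ (inj₂ q)) = ⊥-elim (v≢c q)
      loc : ∀ {u v} → Dart u v → u ≢ c → v ≢ c → A u ≡ A v
      loc D u≢c v≢c = Bool-ext (half D v≢c) (half (rev D) u≢c)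

    corner-dart : ∀ {x} → Corner a A C x → Dart x a
    corner-dart (p , e , _) = dart (A⊆ p) a∈ e

    -- The fourth vertex of the face is adjacent to a vertex of A and to one of C, so it is a pole,
    -- and it is not a because opposite vertices of a face differ.
    corner : ∀ {x} → Corner a A C x → nx a (nx x a) ≡ c
    corner {x} κ@(p , e , q) with part (Dart.tgt (next (next (corner-dart κ))))
    ... | inj₁ w∈A = ⊥-elim (noE w∈A q (Dart.adj (rev (next (next (corner-dart κ))))))
    ... | inj₂ (inj₁ w∈C) = ⊥-elim (noE p w∈C (Dart.adj (rev (last (corner-dart κ)))))
    ... | inj₂ (inj₂ (inj₁ w≡a)) = ⊥-elim (nx-ne′ (next (corner-dart κ)) w≡a)
    ... | inj₂ (inj₂ (inj₂ w≡c)) = w≡c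

    -- A turn around a that starts in A must leave A before it reaches the neighbour in C.
    leave : (∃ λ x → x ∈ C × d x a ≡ 1) → ∃ λ x → x ∈ A × d x a ≡ 1 × ¬ (nx x a ∈ A)
    leave (y , yC , ye) with any? (λ x → (x ∈? A) ×-dec ((d x a ℕ.≟ 1) ×-dec ¬? (nx x a ∈? A)))
    ... | yes e = e
    ... | no none = ⊥-elim (disj (link a∈ A closed (A⊆ xA) xe xA (C⊆ yC) ye) yC)
      where
      xA = proj₁ (proj₂ A-neighbour)
      xe = proj₂ (proj₂ A-neighbour)
      closed : ∀ {x} → x ∈ S → d x a ≡ 1 → x ∈ A → nx x a ∈ A
      closed {x} _ e p with nx x a ∈? A
      ... | yes q = q
      ... | no q = ⊥-elim (none (x , p , e , q))

    leave-cases : ∀ {x} → x ∈ A → d x a ≡ 1 → ¬ (nx x a ∈ A) → Corner a A C x ⊎ nx x a ≡ c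
    leave-cases p e q with part (Dart.tgt (next (dart (A⊆ p) a∈ e)))
    ... | inj₁ r = ⊥-elim (q r)
    ... | inj₂ (inj₁ r) = inj₁ (p , e , r)
    ... | inj₂ (inj₂ (inj₁ r)) = ⊥-elim (adj-≢ (Dart.adj (next (dart (A⊆ p) a∈ e))) (sym r))
    ... | inj₂ (inj₂ (inj₂ r)) = inj₂ r

    corner-c : ∀ {x} → Corner a A C x → d c x ≡ 1
    corner-c κ = subst (λ z → d z _ ≡ 1) (corner κ) (Dart.adj (last (corner-dart κ)))

    corner⇒nonadj : ∀ {x} → Corner a A C x → d a c ≢ 1
    corner⇒nonadj {x} κ e = bip x e (trans (Dart.adj (rev (corner-dart κ))) (sym (corner-c κ)))

  module _ {a c A C} (K : Cut d S a c A C) where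
    open Cut K
    private K′ = swap-sides M K

    -- A corner makes a and c neighbours of the same vertex, and then bipartiteness excludes the
    -- edge ac. Without a corner in either direction the turn around a would pass to c both from A
    -- and from C, but c has only one predecessor there.
    nonadjacent : d a c ≢ 1
    nonadjacent with leave K (A-neighbour K′) | leave K′ (A-neighbour K)
    ... | x , p , e , q | y , p′ , e′ , q′ with leave-cases K p e q | leave-cases K′ p′ e′ q′
    ...   | inj₁ κ | _ = corner⇒nonadj K κ
    ...   | inj₂ _ | inj₁ κ = corner⇒nonadj K′ κ
    ...   | inj₂ r | inj₂ r′ = ⊥-elim (disj p (subst (_∈ C) (sym (nx-inj (dart (A⊆ p) a∈ e) (dart (C⊆ p′) a∈ e′) (trans r (sym r′)))) p′))

    a-corner : ∃ λ x → Corner a A C x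
    a-corner with leave K (A-neighbour K′)
    ... | x , p , e , q with leave-cases K p e q
    ...   | inj₁ κ = x , κ
    ...   | inj₂ r = ⊥-elim (nonadjacent (subst (λ z → d a z ≡ 1) r (nx-adj (A⊆ p) a∈ e)))

    -- A second corner p₂ would give a cycle p₁ … p₂ a through A with corners
    -- into C on both sides, although C ∪ {c} is connected around it.
    corner-unique : Tight → ∀ {p₁ par rank} → Corner a A C p₁ → Tree A p₁ par rank →
                    ∀ {p₂} → Corner a A C p₂ → p₂ ≡ p₁
    corner-unique tight {p₁} {par₀} {rank₀} κ₁@(p₁A , p₁a , q₁C) τ₀ {p₂} κ₂@(p₂A , p₂a , q₂C) with p₂ ≟F p₁
    ... | yes e = e
    -- Attaching a directly to p₁ keeps the fundamental cycle of the edge ap₂ inside A together with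
    -- a.
    ... | no p₂≢p₁ = ⊥-elim (go (spanning U⊆S (attach τ₀ a p₁ a∉A p₁A (Dart.adj (rev (corner-dart K κ₁))))))
      where
      U : Sub N
      U = A [ a ↦ true ]
      U⊆S : ∀ {x} → x ∈ U → x ∈ S
      U⊆S {x} p with x ≟F a
      ... | yes refl = a∈
      ... | no ne = A⊆ p
      x≢a : ∀ {x} → x ∈ A → x ≢ a
      x≢a p refl = a∉A p
      q₁ = nx p₁ a
      q₂ = nx p₂ a
      go : Extends U p₁ (par₀ [ a ↦ p₁ ]) S → ⊥
      go (par , rank , τ , agree) = main (jordan τ tight e₀)
        where
        par-A : ∀ {x} → x ∈ A → x ≢ p₁ → par x ∈ A
        par-A {x} p ne = subst (_∈ A) (sym (trans (agree (trans (update-off A true (x≢a p)) p)) (update-off par₀ p₁ (x≢a p)))) (Tree.par∈ τ₀ p ne)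
        par-a : par a ≡ p₁
        par-a = trans (agree (update-at A a true)) (update-at par₀ a p₁)
        spoke : ∀ {x} → x ∈ A → d x a ≡ 1 → x ≢ p₁ → Cot τ a x
        spoke p e ne = rev (dart (A⊆ p) a∈ e) , (λ (_ , r) → ne (trans r par-a)) , (λ (_ , r) → a∉A (subst (_∈ A) (sym r) (par-A p ne)))
        e₀ : Cot τ a p₂
        e₀ = spoke p₂A p₂a p₂≢p₁
        main : Colouring τ a p₂ → ⊥
        main (X , inv , X₀ , X₀′ , cot) =
          true≢false X₀ (Boolₚ.not-injective (link a∈ (λ y → not (X a y)) closed (C⊆ q₁C) (Dart.adj (rev (next D₁)))
            (cong not aq₁) (A⊆ p₂A) p₂a))
          where
          D₁ = corner-dart K κ₁
          D₂ = corner-dart K κ₂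
          Q : Fin N → Set
          Q u = u ∈ C ⊎ u ≡ c
          -- All tree parents of vertices of A other than p₁ are in A, and the parent of a is p₁; so
          -- nothing in A and not a hangs below C or c.
          down : ∀ {x} → x ∈ S → x ≢ p₁ → Q (par x) → Q x
          down {x} xS ne q with part xS
          ... | inj₁ xA = ⊥-elim ([ disj (par-A xA ne) , (λ e → c∉A (subst (_∈ A) e (par-A xA ne))) ]′ q)
          ... | inj₂ (inj₁ xC) = inj₁ xC
          ... | inj₂ (inj₂ (inj₁ refl)) = ⊥-elim ([ disj (subst (_∈ A) (sym par-a) p₁A) , (λ e → c∉A (subst (_∈ A) (trans (sym par-a) e) p₁A)) ]′ q)
          ... | inj₂ (inj₂ (inj₂ e)) = inj₂ e
          Q≢a : ∀ {u} → Q u → u ≢ a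
          Q≢a (inj₁ p) refl = a∉C p
          Q≢a (inj₂ e) refl = a≢c e
          Q≢A : ∀ {u x} → x ∈ A → Q u → u ≢ x
          Q≢A xA (inj₁ p) refl = disj xA p
          Q≢A xA (inj₂ refl) refl = c∉A xA
          cotQ : ∀ {u v} → Q u → Cot τ u v → X u v ≡ X v u
          cotQ q C′ = cot C′ (Q≢a q ∘ proj₁) (Q≢A p₂A q ∘ proj₁)
          tree-edge : ∀ {u} → u ∈ S → Q u → u ≢ p₁ → X u (par u) ≡ X (par u) u
          tree-edge = tree-sides τ Bool._≟_ X inv Q down cotQ
          sides : ∀ {u v} → Q u → Dart u v → X u v ≡ X v u
          sides {u} {v} q D with IsPar? τ u v | IsPar? τ v u
          ... | yes (ne , refl) | _ = tree-edge (Dart.src D) q ne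
          ... | no _ | yes (ne , refl) = sym (tree-edge (Dart.tgt D) (down (Dart.tgt D) ne q) ne)
          ... | no m | no n = cotQ q (D , m , n)
          around : ∀ {u x y} → Q u → Dart x u → Dart y u → X u x ≡ X u y
          around {u} q Dx Dy = rotate-constant (Dart.tgt Dx) (X u) (λ D → trans (sides q (rev D)) (inv D)) Dx Dy
          qc₁ : Dart q₁ c
          qc₁ = subst (Dart q₁) (corner K κ₁) (next (next D₁))
          qc₂ : Dart q₂ c
          qc₂ = subst (Dart q₂) (corner K κ₂) (next (next D₂))
          Qc : Q c
          Qc = inj₂ refl
          toC : ∀ {q} → q ∈ C → Dart a q → Dart q c → X a q ≡ X c q
          toC qC D E = trans (sym (sides (inj₁ qC) (rev D))) (trans (around (inj₁ qC) D (rev E)) (sides (inj₁ qC) E))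
          aq₂ : X a q₂ ≡ false
          aq₂ = trans (sym (inv D₂)) X₀′
          -- The colour is carried from aq₂ around q₂, c and q₁ to aq₁; none of these three vertices
          -- lies on the cycle.
          aq₁ : X a q₁ ≡ false
          aq₁ = trans (toC q₁C (next D₁) qc₁) (trans (around Qc qc₁ qc₂) (trans (sym (toC q₂C (next D₂) qc₂)) aq₂))
          -- Turning around a from q₁, the colour false persists: the corners at p₁ and p₂ are known
          -- to lead to false, and no other edge at a changes the colour. The turn reaches p₂, in
          -- contradiction to `X₀`.
          closed : ∀ {x} → x ∈ S → d x a ≡ 1 → not (X a x) ≡ true → not (X a (nx x a)) ≡ true
          closed {x} xS e h with x ≟F p₁ | x ≟F p₂
          ... | yes refl | _ = cong not aq₁
          ... | no _ | yes refl = cong not aq₂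
          ... | no n₁ | no n₂ = trans (cong not (trans (sym (inv D)) same)) h
            where
            D = dart xS a∈ e
            same : X x a ≡ X a x
            same with part xS
            ... | inj₁ xA = sym (cot (spoke xA e n₁) (n₂ ∘ proj₂) (adj-≢ e ∘ proj₂))
            ... | inj₂ (inj₁ xC) = sides (inj₁ xC) D
            ... | inj₂ (inj₂ (inj₁ refl)) = ⊥-elim (adj-≢ e refl)
            ... | inj₂ (inj₂ (inj₂ r)) = sides (inj₂ r) D

    Smaller : Set
    Smaller = ∃ λ A′ → ∃ λ C′ → Cut d S a c A′ C′ × ∣ A′ ∣ < ∣ A ∣

    -- If A is disconnected, the component of r can be moved over to C, which leaves a cut with the
    -- same poles and a smaller A.
    side-tree : ∀ r → r ∈ A → (∃ λ par → ∃ λ rank → Tree A r par rank) ⊎ Smaller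
    side-tree r rA with grow ∣ ⟦ (λ x → (x ∈? A) ×-dec ¬? (x ∈? ⟦ (λ y → y ≟F r) ⟧)) ⟧ ∣ {T = A} (λ {x} p → subst (_∈ A) (sym (dec-true⁻ (x ≟F r) p)) rA) ≤-refl (singleton r)
    ... | inj₁ (par , rank , τ , _) = inj₁ (par , rank , τ)
    ... | inj₂ (U , sub , sub′ , (y , yA , yU) , sep) = inj₂ (A′ , C′ , cut , less)
      where
      A′? : ∀ x → Dec (x ∈ A × ¬ (x ∈ U))
      A′? x = (x ∈? A) ×-dec ¬? (x ∈? U)
      C′? : ∀ x → Dec (x ∈ C ⊎ x ∈ U)
      C′? x = (x ∈? C) ⊎-dec (x ∈? U)
      A′ C′ : Sub N
      A′ = ⟦ A′? ⟧
      C′ = ⟦ C′? ⟧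
      A∈ : ∀ {x} → x ∈ A′ → x ∈ A × ¬ (x ∈ U)
      A∈ {x} = dec-true⁻ (A′? x)
      C∈ : ∀ {x} → x ∈ C′ → x ∈ C ⊎ x ∈ U
      C∈ {x} = dec-true⁻ (C′? x)
      rU : r ∈ U
      rU = sub (dec-true (r ≟F r) refl)
      cut : Cut d S a c A′ C′
      cut = record
        { a∈ = a∈ ; c∈ = c∈ ; a≢c = a≢c ; A⊆ = A⊆ ∘ proj₁ ∘ A∈ ; C⊆ = λ p → [ C⊆ , A⊆ ∘ sub′ ]′ (C∈ p)
        ; part = part′
        ; disj = λ p q → [ disj (proj₁ (A∈ p)) , proj₂ (A∈ p) ]′ (C∈ q)
        ; a∉A = a∉A ∘ proj₁ ∘ A∈ ; a∉C = λ p → [ a∉C , a∉A ∘ sub′ ]′ (C∈ p)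
        ; c∉A = c∉A ∘ proj₁ ∘ A∈ ; c∉C = λ p → [ c∉C , c∉A ∘ sub′ ]′ (C∈ p)
        ; noE = λ p q → [ noE (proj₁ (A∈ p)) , (λ u → sep u (proj₁ (A∈ p)) (proj₂ (A∈ p))) ]′ (C∈ q)
        ; A-in = y , dec-true (A′? y) (yA , yU)
        ; C-in = r , dec-true (C′? r) (inj₂ rU) }
        where
        part′ : ∀ {x} → x ∈ S → x ∈ A′ ⊎ x ∈ C′ ⊎ x ≡ a ⊎ x ≡ c
        part′ {x} p = split (part p) (x ∈? U)
          where
          split : x ∈ A ⊎ x ∈ C ⊎ x ≡ a ⊎ x ≡ c → Dec (x ∈ U) → x ∈ A′ ⊎ x ∈ C′ ⊎ x ≡ a ⊎ x ≡ c
          split (inj₁ q)        (yes u) = inj₂ (inj₁ (dec-true (C′? x) (inj₂ u)))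
          split (inj₁ q)        (no u)  = inj₁ (dec-true (A′? x) (q , u))
          split (inj₂ (inj₁ q)) _       = inj₂ (inj₁ (dec-true (C′? x) (inj₁ q)))
          split (inj₂ (inj₂ q)) _       = inj₂ (inj₂ q)
      less : ∣ A′ ∣ < ∣ A ∣
      less = card-< {S = A′} {T = A} r (λ x p → proj₁ (A∈ p)) rA (λ p → proj₂ (A∈ p) rU)

-- The two faces (p₁ a q₁ c) and (q₂ a p₂ c) are the only ones that meet both
-- sides of the cut.
record Cross {N} (d : Fin N → Fin N → ℕ) (S : Sub N) (nx : Fin N → Fin N → Fin N)
             (a c : Fin N) (A C : Sub N) (p₁ p₂ q₁ q₂ : Fin N) : Set where
  field
    a≁c   : d a c ≢ 1
    p₁∈   : p₁ ∈ A
    p₂∈   : p₂ ∈ A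
    q₁∈   : q₁ ∈ C
    q₂∈   : q₂ ∈ C
    p₁a   : d p₁ a ≡ 1
    aq₁   : d a q₁ ≡ 1
    q₁c   : d q₁ c ≡ 1
    cp₁   : d c p₁ ≡ 1
    q₂a   : d q₂ a ≡ 1
    ap₂   : d a p₂ ≡ 1
    p₂c   : d p₂ c ≡ 1
    cq₂   : d c q₂ ≡ 1
    p₁a→  : nx p₁ a ≡ q₁
    aq₁→  : nx a q₁ ≡ c
    q₁c→  : nx q₁ c ≡ p₁
    cp₁→  : nx c p₁ ≡ a
    q₂a→  : nx q₂ a ≡ p₂
    ap₂→  : nx a p₂ ≡ c
    p₂c→  : nx p₂ c ≡ q₂
    cq₂→  : nx c q₂ ≡ a
    a-out : ∀ {x} → x ∈ A → d x a ≡ 1 → nx x a ∈ C → x ≡ p₁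
    a-in  : ∀ {x} → x ∈ C → d x a ≡ 1 → nx x a ∈ A → x ≡ q₂
    c-in  : ∀ {x} → x ∈ C → d x c ≡ 1 → nx x c ∈ A → x ≡ q₁
    c-out : ∀ {x} → x ∈ A → d x c ≡ 1 → nx x c ∈ C → x ≡ p₂

flip-cross : ∀ {N} {d : Fin N → Fin N → ℕ} {S nx a c A C p₁ p₂ q₁ q₂} →
             Cross d S nx a c A C p₁ p₂ q₁ q₂ → Cross d S nx a c C A q₂ q₁ p₂ p₁
flip-cross X = record
  { a≁c = a≁c ; p₁∈ = q₂∈ ; p₂∈ = q₁∈ ; q₁∈ = p₂∈ ; q₂∈ = p₁∈
  ; p₁a = q₂a ; aq₁ = ap₂ ; q₁c = p₂c ; cp₁ = cq₂ ; q₂a = p₁a ; ap₂ = aq₁ ; p₂c = q₁c ; cq₂ = cp₁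
  ; p₁a→ = q₂a→ ; aq₁→ = ap₂→ ; q₁c→ = p₂c→ ; cp₁→ = cq₂→ ; q₂a→ = p₁a→ ; ap₂→ = aq₁→ ; p₂c→ = q₁c→ ; cq₂→ = cp₁→
  ; a-out = a-in ; a-in = a-out ; c-in = c-out ; c-out = c-in }
  where open Cross X

-- Closing up the pieces of a cut

Piece : ∀ {N} → Fin N → Fin N → Sub N → Sub N
Piece a c C = ⟦ (λ x → (x ∈? C) ⊎-dec ((x ≟F a) ⊎-dec (x ≟F c))) ⟧

module Pieces {N} {d : Fin N → Fin N → ℕ} (M : Metric d) (bip : Bip d)
              {S : Sub N} {nx : Fin N → Fin N → Fin N} (G : Surf d S nx) where
  open Metric M
  open Surf G
  open Surface M G
  open Cotree M G using (Tree)
  open Corners M bip G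

  -- A corner from C to A at one pole is, on the same face, a corner from A to C at the other pole.
  -- Hence spanning trees of A settle the uniqueness of the corners in both directions.
  cross : Tight → ∀ {a c A C} (K : Cut d S a c A C) →
          (∃ λ p₁ → ∃ λ p₂ → ∃ λ q₁ → ∃ λ q₂ → Cross d S nx a c A C p₁ p₂ q₁ q₂) ⊎ Smaller K
  cross tight {a} {c} {A} {C} K with a-corner K | a-corner (swap-sides M K)
  ... | p₁ , κ₁ | q₂ , κ₂ with side-tree K p₁ (proj₁ κ₁) | side-tree K (nx q₂ a) (proj₂ (proj₂ κ₂))
  ...   | inj₂ s | _ = inj₂ s
  ...   | inj₁ _ | inj₂ s = inj₂ s
  ...   | inj₁ (_ , _ , τ₁) | inj₁ (_ , _ , τ₂) = inj₁ (p₁ , p₂ , q₁ , q₂ , X)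
    where
    open Cut K
    K′ = swap-sides M K
    p₂ = nx q₂ a
    q₁ = nx p₁ a
    D₁ = corner-dart K κ₁
    D₂ = corner-dart K′ κ₂
    c₁ : nx a q₁ ≡ c
    c₁ = corner K κ₁
    c₂ : nx a p₂ ≡ c
    c₂ = corner K′ κ₂
    E₁ : Dart q₁ c
    E₁ = subst (Dart q₁) c₁ (next (next D₁))
    E₂ : Dart p₂ c
    E₂ = subst (Dart p₂) c₂ (next (next D₂))
    p₂c→′ : nx p₂ c ≡ q₂
    p₂c→′ = trans (cong (nx p₂) (sym c₂)) (nx-per′ D₂)
    q₁c→′ : nx q₁ c ≡ p₁
    q₁c→′ = trans (cong (nx q₁) (sym c₁)) (nx-per′ D₁)
    out : ∀ {x} → x ∈ A → d x a ≡ 1 → nx x a ∈ C → x ≡ p₁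
    out p e q = corner-unique K tight κ₁ τ₁ (p , e , q)
    out′ : ∀ {x} → x ∈ A → d x c ≡ 1 → nx x c ∈ C → x ≡ p₂
    out′ p e q = corner-unique (swap-poles M K) tight
      (proj₂ (proj₂ κ₂) , Dart.adj E₂ , subst (_∈ C) (sym p₂c→′) (proj₁ κ₂)) τ₂ (p , e , q)
    X : Cross d S nx a c A C p₁ p₂ q₁ q₂
    X = record
      { a≁c = nonadjacent K
      ; p₁∈ = proj₁ κ₁ ; p₂∈ = proj₂ (proj₂ κ₂) ; q₁∈ = proj₂ (proj₂ κ₁) ; q₂∈ = proj₁ κ₂
      ; p₁a = proj₁ (proj₂ κ₁) ; aq₁ = Dart.adj (next D₁) ; q₁c = Dart.adj E₁ ; cp₁ = corner-c K κ₁
      ; q₂a = proj₁ (proj₂ κ₂) ; ap₂ = Dart.adj (next D₂) ; p₂c = Dart.adj E₂ ; cq₂ = corner-c K′ κ₂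
      ; p₁a→ = refl ; aq₁→ = c₁ ; q₁c→ = q₁c→′ ; cp₁→ = trans (cong (λ z → nx z p₁) (sym c₁)) (nx-per₂ D₁)
      ; q₂a→ = refl ; ap₂→ = c₂ ; p₂c→ = p₂c→′ ; cq₂→ = trans (cong (λ z → nx z q₂) (sym c₂)) (nx-per₂ D₂)
      ; a-out = out
      ; a-in = λ {x} p e q → let κ = (p , e , q) ; D = corner-dart K′ κ in
          nx-inj D D₂ (out′ q (trans (d-sym _ c) (corner-p κ)) (subst (_∈ C) (sym (nx-around κ)) p))
      ; c-in = λ {x} p e q → let κ = (p , e , q) in
          trans (sym (nx-around′ κ)) (cong (λ z → nx z a) (out q (trans (d-sym _ a) (corner-p′ κ)) (subst (_∈ C) (sym (nx-around′ κ)) p)))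
      ; c-out = out′ }
      where
      Kc = swap-poles M K′
      corner-p : ∀ {x} → Corner a C A x → d c (nx x a) ≡ 1
      corner-p {x} κ = trans (d-sym c _) (subst (λ z → d (nx x a) z ≡ 1) (corner K′ κ) (Dart.adj (next (next (corner-dart K′ κ)))))
      nx-around : ∀ {x} → Corner a C A x → nx (nx x a) c ≡ x
      nx-around {x} κ = trans (cong (nx (nx x a)) (sym (corner K′ κ))) (nx-per′ (corner-dart K′ κ))
      corner-p′ : ∀ {x} → Corner c C A x → d a (nx x c) ≡ 1
      corner-p′ {x} κ = trans (d-sym a _) (subst (λ z → d (nx x c) z ≡ 1) (corner Kc κ) (Dart.adj (next (next (corner-dart Kc κ)))))
      nx-around′ : ∀ {x} → Corner c C A x → nx (nx x c) a ≡ x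
      nx-around′ {x} κ = trans (cong (nx (nx x c)) (sym (corner Kc κ))) (nx-per′ (corner-dart Kc κ))

  module _ {a c A C} (K : Cut d S a c A C) where
    open Cut K

    InPiece : Fin N → Set
    InPiece x = x ∈ C ⊎ x ≡ a ⊎ x ≡ c

    InPiece? : ∀ x → Dec (InPiece x)
    InPiece? x = (x ∈? C) ⊎-dec ((x ≟F a) ⊎-dec (x ≟F c))

    ∈Piece : ∀ {x} → InPiece x → x ∈ Piece a c C
    ∈Piece {x} = dec-true (InPiece? x)

    Piece∈ : ∀ {x} → x ∈ Piece a c C → InPiece x
    Piece∈ {x} = dec-true⁻ (InPiece? x)

    Piece⊆ : ∀ {x} → InPiece x → x ∈ S
    Piece⊆ (inj₁ p) = C⊆ p
    Piece⊆ (inj₂ (inj₁ refl)) = a∈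
    Piece⊆ (inj₂ (inj₂ refl)) = c∈

    piece∉A : ∀ {x} → InPiece x → ¬ (x ∈ A)
    piece∉A (inj₁ p) q = disj q p
    piece∉A (inj₂ (inj₁ refl)) q = a∉A q
    piece∉A (inj₂ (inj₂ refl)) q = c∉A q

    inside : ∀ {x} → x ∈ S → ¬ (x ∈ A) → InPiece x
    inside p n with part p
    ... | inj₁ q = ⊥-elim (n q)
    ... | inj₂ q = q

    -- Follow a shortest path from x: the first vertex outside A cannot be in C, so it is a pole.
    through : ∀ {x y} → x ∈ A → InPiece y → d x y ≡ d x a + d a y ⊎ d x y ≡ d x c + d c y
    through {x} {y} xA yP = go (d x y) refl xA
      where
      via : ∀ {x w} z → d x w ≡ 1 → suc (d w y) ≡ d x y → d w y ≡ d w z + d z y → d x y ≡ d x z + d z y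
      via {x} {w} z e f g = ≤-antisym (d-tri x z y) (begin
        d x z + d z y              ≤⟨ +-monoˡ-≤ (d z y) (d-tri x w z) ⟩
        d x w + d w z + d z y      ≡⟨ cong (λ k → k + d w z + d z y) e ⟩
        suc (d w z + d z y)        ≡⟨ cong suc (sym g) ⟩
        suc (d w y)                ≡⟨ f ⟩
        d x y                      ∎)
        where open ≤-Reasoning
      go : ∀ k {x} → d x y ≡ k → x ∈ A → d x y ≡ d x a + d a y ⊎ d x y ≡ d x c + d c y
      go k {x} e xA with geo (A⊆ xA) (Piece⊆ yP) (λ { refl → piece∉A yP xA })
      go zero e xA | w , wS , xw , s = case trans s e of λ ()
      go (suc k) e xA | w , wS , xw , s with part wS
      ... | inj₁ wA with go k (suc-injective (trans s e)) wA
      ...   | inj₁ g = inj₁ (via a xw s g)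
      ...   | inj₂ g = inj₂ (via c xw s g)
      go (suc k) e xA | w , wS , xw , s | inj₂ (inj₁ wC) = ⊥-elim (noE xA wC xw)
      go (suc k) e xA | w , wS , xw , s | inj₂ (inj₂ (inj₁ refl)) = inj₁ (trans (sym s) (cong (_+ d a y) (sym xw)))
      go (suc k) e xA | w , wS , xw , s | inj₂ (inj₂ (inj₂ refl)) = inj₂ (trans (sym s) (cong (_+ d c y) (sym xw)))

  module _ {a c A C p₁ p₂ q₁ q₂} (K : Cut d S a c A C) (X : Cross d S nx a c A C p₁ p₂ q₁ q₂) where
    open Cut K
    open Cross X

    -- Every neighbour of a pole in C is q₁, and q₁ has no neighbours but the poles.
    only-q : q₁ ≡ q₂ → ∀ {y} → y ∈ C → y ≡ q₁
    only-q refl {y} yC with y ≟F q₁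
    ... | yes e = e
    ... | no ne = ⊥-elim contra
      where
      R? : ∀ x → Dec (x ∈ C × x ≢ q₁)
      R? x = (x ∈? C) ×-dec ¬? (x ≟F q₁)
      q-nbrs : ∀ {x} → x ∈ S → d x q₁ ≡ 1 → x ≡ a ⊎ x ≡ c
      q-nbrs {x} xS e = dec-true⁻ (P? x) (link (C⊆ q₁∈) ⟦ P? ⟧
          (λ {z} zS ze h → dec-true (P? (nx z q₁)) (turn (dec-true⁻ (P? z) h)))
          a∈ aq₁ (dec-true (P? a) (inj₁ refl)) xS e)
        where
        P? : ∀ x → Dec (x ≡ a ⊎ x ≡ c)
        P? x = (x ≟F a) ⊎-dec (x ≟F c)
        turn : ∀ {z} → z ≡ a ⊎ z ≡ c → nx z q₁ ≡ a ⊎ nx z q₁ ≡ c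
        turn (inj₁ refl) = inj₂ aq₁→
        turn (inj₂ refl) = inj₁ cq₂→
      pole-nbrs : ∀ {z} → z ∈ S → (p : Fin N) → p ∈ A → d p z ≡ 1 →
                  (∀ {x} → x ∈ A → d x z ≡ 1 → nx x z ∈ A ⊎ nx x z ≡ q₁) → nx q₁ z ∈ A →
                  ∀ {x} → x ∈ S → d x z ≡ 1 → x ∈ A ⊎ x ≡ q₁
      pole-nbrs {z} zS p pA pz step qstep {x} xS e = dec-true⁻ (P? x) (link zS ⟦ P? ⟧
          (λ {y} yS ye h → dec-true (P? (nx y z)) (turn ye (dec-true⁻ (P? y) h)))
          (A⊆ pA) pz (dec-true (P? p) (inj₁ pA)) xS e)
        where
        P? : ∀ x → Dec (x ∈ A ⊎ x ≡ q₁)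
        P? x = (x ∈? A) ⊎-dec (x ≟F q₁)
        turn : ∀ {y} → d y z ≡ 1 → y ∈ A ⊎ y ≡ q₁ → nx y z ∈ A ⊎ nx y z ≡ q₁
        turn ye (inj₁ yA) = step yA ye
        turn ye (inj₂ refl) = inj₁ qstep
      after-a : ∀ {x} → x ∈ A → d x a ≡ 1 → nx x a ∈ A ⊎ nx x a ≡ q₁
      after-a xA e with part (Dart.tgt (next (dart (A⊆ xA) a∈ e)))
      ... | inj₁ r = inj₁ r
      ... | inj₂ (inj₁ r) with a-out xA e r
      ...   | refl = inj₂ p₁a→
      after-a xA e | inj₂ (inj₂ (inj₁ r)) = ⊥-elim (adj-≢ (Dart.adj (next (dart (A⊆ xA) a∈ e))) (sym r))
      after-a xA e | inj₂ (inj₂ (inj₂ r)) = ⊥-elim (a≁c (subst (λ z → d a z ≡ 1) r (Dart.adj (next (dart (A⊆ xA) a∈ e)))))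
      after-c : ∀ {x} → x ∈ A → d x c ≡ 1 → nx x c ∈ A ⊎ nx x c ≡ q₁
      after-c xA e with part (Dart.tgt (next (dart (A⊆ xA) c∈ e)))
      ... | inj₁ r = inj₁ r
      ... | inj₂ (inj₁ r) with c-out xA e r
      ...   | refl = inj₂ p₂c→
      after-c xA e | inj₂ (inj₂ (inj₁ r)) = ⊥-elim (a≁c (trans (d-sym a c) (subst (λ z → d c z ≡ 1) r (Dart.adj (next (dart (A⊆ xA) c∈ e))))))
      after-c xA e | inj₂ (inj₂ (inj₂ r)) = ⊥-elim (adj-≢ (Dart.adj (next (dart (A⊆ xA) c∈ e))) (sym r))
      half : ∀ {u v} → Dart u v → u ∈ C × u ≢ q₁ → v ∈ C × v ≢ q₁
      half {u} {v} D (uC , ne) with part (Dart.tgt D)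
      ... | inj₁ vA = ⊥-elim (noE vA uC (Dart.adj (rev D)))
      ... | inj₂ (inj₁ vC) = vC , λ { refl → [ (λ { refl → a∉C uC }) , (λ { refl → c∉C uC }) ]′ (q-nbrs (Dart.src D) (Dart.adj D)) }
      ... | inj₂ (inj₂ (inj₁ refl)) = ⊥-elim ([ (λ uA → disj uA uC) , ne ]′
              (pole-nbrs a∈ p₁ p₁∈ p₁a after-a (subst (_∈ A) (sym q₂a→) p₂∈) (Dart.src D) (Dart.adj D)))
      ... | inj₂ (inj₂ (inj₂ refl)) = ⊥-elim ([ (λ uA → disj uA uC) , ne ]′
              (pole-nbrs c∈ p₂ p₂∈ p₂c after-c (subst (_∈ A) (sym q₁c→) p₁∈) (Dart.src D) (Dart.adj D)))
      contra : ⊥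
      contra = a∉C (proj₁ (dec-true⁻ (R? a) (trans (sym (connected ⟦ R? ⟧ loc (C⊆ yC) a∈)) (dec-true (R? y) (yC , ne)))))
        where
        loc : ∀ {u v} → Dart u v → does (R? u) ≡ does (R? v)
        loc {u} {v} D = does-⇔ (R? u) (R? v) (half D) (half (rev D))

    -- All faces on the side of A are replaced by the single face q₂ a q₁ c: a turn that would enter
    -- A continues to q₁ at the pole a and to q₂ at the pole c.
    nx′ : Fin N → Fin N → Fin N
    nx′ u v = if A (nx u v) then (if does (v ≟F a) then q₁ else q₂) else nx u v

    module _ (q₁≢q₂ : q₁ ≢ q₂) where
      nx′-keep : ∀ {u v} → ¬ (nx u v ∈ A) → nx′ u v ≡ nx u v
      nx′-keep h rewrite ¬true h = refl

      nx′-a : ∀ {u} → nx u a ∈ A → nx′ u a ≡ q₁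
      nx′-a h rewrite h | dec-true (a ≟F a) refl = refl

      nx′-c : ∀ {u} → nx u c ∈ A → nx′ u c ≡ q₂
      nx′-c h rewrite h | dec-false (c ≟F a) (a≢c ∘ sym) = refl

      q₂a→′ : nx′ q₂ a ≡ q₁
      q₂a→′ = nx′-a (subst (_∈ A) (sym q₂a→) p₂∈)

      aq₁→′ : nx′ a q₁ ≡ c
      aq₁→′ = trans (nx′-keep (λ h → c∉A (subst (_∈ A) aq₁→ h))) aq₁→

      q₁c→′ : nx′ q₁ c ≡ q₂
      q₁c→′ = nx′-c (subst (_∈ A) (sym q₁c→) p₁∈)

      cq₂→′ : nx′ c q₂ ≡ a
      cq₂→′ = trans (nx′-keep (λ h → a∉A (subst (_∈ A) cq₂→ h))) cq₂→

      -- Uniqueness of the crossing faces leaves only two darts of the piece whose successor is in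
      -- A.
      data View (u v : Fin N) : Set where
        into-a : u ≡ q₂ → v ≡ a → View u v
        into-c : u ≡ q₁ → v ≡ c → View u v
        plain  : ¬ (nx u v ∈ A) → View u v

      view : ∀ {u v} → Dart u v → InPiece K u → InPiece K v → View u v
      view {u} {v} D uP vP with nx u v ∈? A
      ... | no h = plain h
      view D uP (inj₁ vC) | yes h = ⊥-elim (noE h vC (Dart.adj (rev (next D))))
      view D (inj₁ uC) (inj₂ (inj₁ refl)) | yes h = into-a (a-in uC (Dart.adj D) h) refl
      view D (inj₂ (inj₁ refl)) (inj₂ (inj₁ refl)) | yes h = ⊥-elim (adj-≢ (Dart.adj D) refl)
      view D (inj₂ (inj₂ refl)) (inj₂ (inj₁ refl)) | yes h = ⊥-elim (a≁c (Dart.adj (rev D)))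
      view D (inj₁ uC) (inj₂ (inj₂ refl)) | yes h = into-c (c-in uC (Dart.adj D) h) refl
      view D (inj₂ (inj₁ refl)) (inj₂ (inj₂ refl)) | yes h = ⊥-elim (a≁c (Dart.adj D))
      view D (inj₂ (inj₂ refl)) (inj₂ (inj₂ refl)) | yes h = ⊥-elim (adj-≢ (Dart.adj D) refl)

      target : ∀ {u v} → Dart u v → InPiece K u → InPiece K v → InPiece K (nx′ u v) × d v (nx′ u v) ≡ 1
      target D uP vP with view D uP vP
      ... | into-a refl refl rewrite q₂a→′ = inj₁ q₁∈ , aq₁
      ... | into-c refl refl rewrite q₁c→′ = inj₁ q₂∈ , cq₂
      ... | plain h rewrite nx′-keep h = inside K (Dart.tgt (next D)) h , Dart.adj (next D)

      differs : ∀ {u v} → Dart u v → InPiece K u → InPiece K v → nx′ u v ≢ u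
      differs D uP vP with view D uP vP
      ... | into-a refl refl rewrite q₂a→′ = q₁≢q₂
      ... | into-c refl refl rewrite q₁c→′ = q₁≢q₂ ∘ sym
      ... | plain h rewrite nx′-keep h = nx-ne′ D

      periodic : ∀ {u v} → Dart u v → InPiece K u → InPiece K v → nx′ (nx′ u v) (nx′ v (nx′ u v)) ≡ u
      periodic {u} {v} D uP vP with view D uP vP
      ... | into-a refl refl rewrite q₂a→′ | aq₁→′ = q₁c→′
      ... | into-c refl refl rewrite q₁c→′ | cq₂→′ = q₂a→′
      ... | plain h with view (next D) vP (inside K (Dart.tgt (next D)) h)
      ...   | into-a refl w≡a = trans (cong (λ z → nx′ z (nx′ v z)) (trans (nx′-keep h) w≡a))
                (trans (cong (nx′ a) q₂a→′) (trans aq₁→′ (nx-inj (dart c∈ (C⊆ q₂∈) cq₂) D (trans cq₂→ (sym w≡a)))))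
      ...   | into-c refl w≡c = trans (cong (λ z → nx′ z (nx′ v z)) (trans (nx′-keep h) w≡c))
                (trans (cong (nx′ c) q₁c→′) (trans cq₂→′ (nx-inj (dart a∈ (C⊆ q₁∈) aq₁) D (trans aq₁→ (sym w≡c)))))
      ...   | plain h′ = trans (cong (λ z → nx′ z (nx′ v z)) (nx′-keep h)) (trans (cong (nx′ (nx u v)) (nx′-keep h′))
                (trans (nx′-keep (λ q → piece∉A K uP (subst (_∈ A) (nx-per′ D) q))) (nx-per′ D)))

      -- A shortest path that enters A from one pole cannot come back to it, so it reaches the piece
      -- again at the other pole. The path of length 2 through q₁ is no longer.
      geodesic : ∀ {u v} → InPiece K u → InPiece K v → u ≢ v → ∃ λ w → w ∈ Piece a c C × d u w ≡ 1 × suc (d w v) ≡ d u v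
      geodesic {u} {v} uP vP ne with geo (Piece⊆ K uP) (Piece⊆ K vP) ne
      ... | w , wS , uw , s with w ∈? A
      ...   | no h = w , ∈Piece K (inside K wS h) , uw , s
      ...   | yes wA = pole uP
        where
        around : ∀ z z′ → u ≡ z → (∀ {x} → x ∈ A → ¬ (d x z′ ≡ 0)) → d w v ≡ d w z + d z v ⊎ d w v ≡ d w z′ + d z′ v →
                 d z q₁ ≡ 1 → d q₁ z′ ≡ 1 → ∃ λ w → w ∈ Piece a c C × d u w ≡ 1 × suc (d w v) ≡ d u v
        around z z′ refl _ (inj₁ g) _ _ = ⊥-elim (<-irrefl refl (begin-strict
          d u v                   <⟨ s≤s (m≤n+m (d u v) (d w u)) ⟩
          suc (d w u + d u v)     ≡⟨ cong suc (sym g) ⟩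
          suc (d w v)             ≡⟨ s ⟩
          d u v                   ∎))
          where open ≤-Reasoning
        around z z′ refl nz (inj₂ g) e e′ = q₁ , ∈Piece K (inj₁ q₁∈) , e , ≤-antisym
          (begin
            suc (d q₁ v)              ≤⟨ s≤s (d-tri q₁ z′ v) ⟩
            suc (d q₁ z′ + d z′ v)    ≡⟨ cong (λ k → suc (k + d z′ v)) e′ ⟩
            suc (1 + d z′ v)          ≤⟨ s≤s (+-monoˡ-≤ (d z′ v) (n≢0⇒n>0 (nz wA))) ⟩
            suc (d w z′ + d z′ v)     ≡⟨ cong suc (sym g) ⟩
            suc (d w v)               ≡⟨ s ⟩
            d u v                     ∎)
          (≤-trans (d-tri u q₁ v) (≤-reflexive (cong (_+ d q₁ v) e)))
          where open ≤-Reasoning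
        pole : InPiece K u → ∃ λ w → w ∈ Piece a c C × d u w ≡ 1 × suc (d w v) ≡ d u v
        pole (inj₁ uC) = ⊥-elim (noE wA uC (trans (d-sym w u) uw))
        pole (inj₂ (inj₁ e)) = around a c e (λ p z → c∉A (subst (_∈ A) (d-zero z) p)) (through K wA vP) aq₁ q₁c
        pole (inj₂ (inj₂ e)) = around c a e (λ p z → a∉A (subst (_∈ A) (d-zero z) p))
          ([ inj₂ , inj₁ ]′ (through K wA vP)) (trans (d-sym c q₁) q₁c) (trans (d-sym q₁ a) aq₁)

      piece-link : ∀ {v} → InPiece K v → (g : Sub N) → (∀ {x} → x ∈ Piece a c C → d x v ≡ 1 → x ∈ g → nx′ x v ∈ g) →
                   ∀ {x y} → InPiece K x → d x v ≡ 1 → x ∈ g → InPiece K y → d y v ≡ 1 → y ∈ g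
      piece-link {v} (inj₁ vC) g cl {x} {y} xP xa xg yP ya =
        link (C⊆ vC) g (λ {z} zS za zg → subst (_∈ g)
          (nx′-keep (λ h → noE h vC (Dart.adj (rev (next (dart zS (C⊆ vC) za))))))
          (cl (∈Piece K (inside K zS (λ h → noE h vC za))) za zg))
          (Piece⊆ K xP) xa xg (Piece⊆ K yP) ya
      piece-link {v} (inj₂ pole) g cl {x} {y} xP xa xg yP ya = at pole
        where
        general : v ∈ S → (i : Fin N) → i ∈ C → (∀ {u} → nx u v ∈ A → nx′ u v ≡ i) →
                  (∀ {z} → z ∈ A → d z v ≡ 1 → nx z v ∈ A ⊎ nx z v ≡ i) → y ∈ g
        general vS i iC new after = trans (sym (out yP)) (link vS g̃ closed (Piece⊆ K xP) xa (trans (out xP) xg) (Piece⊆ K yP) ya)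
          where
          -- All of A gets the value of the vertex that stands in for it at v, so a whole turn
          -- through A in S mirrors one step of `nx′`.
          g̃ : Sub N
          g̃ z = if A z then g i else g z
          out : ∀ {z} → InPiece K z → g̃ z ≡ g z
          out zP rewrite ¬true (piece∉A K zP) = refl
          inA : ∀ {z} → z ∈ A → g̃ z ≡ g i
          inA h rewrite h = refl
          closed : ∀ {z} → z ∈ S → d z v ≡ 1 → g̃ z ≡ true → g̃ (nx z v) ≡ true
          closed {z} zS za h with z ∈? A
          ... | yes zA with after zA za
          ...   | inj₁ r = trans (inA r) (trans (sym (inA zA)) h)
          ...   | inj₂ r = trans (cong g̃ r) (trans (out (inj₁ iC)) (trans (sym (inA zA)) h))
          closed {z} zS za h | no zA with cl (∈Piece K (inside K zS zA)) za (trans (sym (out (inside K zS zA))) h) | nx z v ∈? A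
          ...   | r | yes nA = trans (inA nA) (trans (cong g (sym (new nA))) r)
          ...   | r | no nA = trans (out (inside K (Dart.tgt (next (dart zS vS za))) nA)) (trans (cong g (sym (nx′-keep nA))) r)
        at : v ≡ a ⊎ v ≡ c → y ∈ g
        at (inj₁ refl) = general a∈ q₁ q₁∈ nx′-a after
          where
          after : ∀ {z} → z ∈ A → d z a ≡ 1 → nx z a ∈ A ⊎ nx z a ≡ q₁
          after zA e with part (Dart.tgt (next (dart (A⊆ zA) a∈ e)))
          ... | inj₁ r = inj₁ r
          ... | inj₂ (inj₁ r) = inj₂ (trans (cong (λ z → nx z a) (a-out zA e r)) p₁a→)
          ... | inj₂ (inj₂ (inj₁ r)) = ⊥-elim (adj-≢ (Dart.adj (next (dart (A⊆ zA) a∈ e))) (sym r))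
          ... | inj₂ (inj₂ (inj₂ r)) = ⊥-elim (a≁c (subst (λ z → d a z ≡ 1) r (Dart.adj (next (dart (A⊆ zA) a∈ e)))))
        at (inj₂ refl) = general c∈ q₂ q₂∈ nx′-c after
          where
          after : ∀ {z} → z ∈ A → d z c ≡ 1 → nx z c ∈ A ⊎ nx z c ≡ q₂
          after zA e with part (Dart.tgt (next (dart (A⊆ zA) c∈ e)))
          ... | inj₁ r = inj₁ r
          ... | inj₂ (inj₁ r) = inj₂ (trans (cong (λ z → nx z c) (c-out zA e r)) p₂c→)
          ... | inj₂ (inj₂ (inj₁ r)) = ⊥-elim (a≁c (trans (d-sym a c) (subst (λ z → d c z ≡ 1) r (Dart.adj (next (dart (A⊆ zA) c∈ e))))))
          ... | inj₂ (inj₂ (inj₂ r)) = ⊥-elim (adj-≢ (Dart.adj (next (dart (A⊆ zA) c∈ e))) (sym r))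

      piece : Surf d (Piece a c C) nx′
      piece = record
        { geo = λ p q → geodesic (Piece∈ K p) (Piece∈ K q)
        ; nx-in = λ p q e → ∈Piece K (proj₁ (target (D p q e) (Piece∈ K p) (Piece∈ K q)))
        ; nx-adj = λ p q e → proj₂ (target (D p q e) (Piece∈ K p) (Piece∈ K q))
        ; nx-per = λ p q e → periodic (D p q e) (Piece∈ K p) (Piece∈ K q)
        ; nx-ne = λ p q e → differs (D p q e) (Piece∈ K p) (Piece∈ K q)
        ; link = λ p g cl xP xa xg yP ya → piece-link (Piece∈ K p) g cl (Piece∈ K xP) xa xg (Piece∈ K yP) ya }
        where
        D : ∀ {u v} → u ∈ Piece a c C → v ∈ Piece a c C → d u v ≡ 1 → Dart u v
        D p q e = dart (Piece⊆ K (Piece∈ K p)) (Piece⊆ K (Piece∈ K q)) e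

-- Sizes and Wiener indices of the pieces

-- With indicator functions for f and g this gives the Wiener index, the degree sum and the sum over
-- A × C alike, so gluing becomes the expansion of a symmetric bilinear form.
form : ∀ {N} → (Fin N → Fin N → ℕ) → (Fin N → ℕ) → (Fin N → ℕ) → ℕ
form K f g = ∑ (λ u → f u * ∑ (λ v → g v * K u v))

δ : ∀ {N} → Fin N → Fin N → ℕ
δ a x = 𝟙 (does (x ≟F a))

module Form {N} (K : Fin N → Fin N → ℕ) (K-sym : ∀ u v → K u v ≡ K v u) where
  form-cong : ∀ {f f′ g g′} → (∀ x → f x ≡ f′ x) → (∀ x → g x ≡ g′ x) → form K f g ≡ form K f′ g′
  form-cong h k = ∑-cong (λ u → cong₂ _*_ (h u) (∑-cong (λ v → cong (_* K u v) (k v))))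

  form-sym : ∀ f g → form K f g ≡ form K g f
  form-sym f g = begin
    ∑ (λ u → f u * ∑ (λ v → g v * K u v))        ≡⟨ ∑-cong (λ u → sym (∑-* (f u) (λ v → g v * K u v))) ⟩
    ∑ (λ u → ∑ (λ v → f u * (g v * K u v)))      ≡⟨ ∑-swap (λ u v → f u * (g v * K u v)) ⟩
    ∑ (λ v → ∑ (λ u → f u * (g v * K u v)))      ≡⟨ ∑-cong (λ v → ∑-cong (λ u → trans (comm (f u) (g v) (K u v)) (cong (λ k → g v * (f u * k)) (K-sym u v)))) ⟩
    ∑ (λ v → ∑ (λ u → g v * (f u * K v u)))      ≡⟨ ∑-cong (λ v → ∑-* (g v) (λ u → f u * K v u)) ⟩
    ∑ (λ v → g v * ∑ (λ u → f u * K v u))        ∎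
    where
    open ≡-Reasoning
    comm : ∀ a b k → a * (b * k) ≡ b * (a * k)
    comm = solve-∀

  form-+ˡ : ∀ f f′ g → form K (λ x → f x + f′ x) g ≡ form K f g + form K f′ g
  form-+ˡ f f′ g = trans (∑-cong (λ u → *-distribʳ-+ (∑ (λ v → g v * K u v)) (f u) (f′ u)))
                         (∑-+ (λ u → f u * ∑ (λ v → g v * K u v)) (λ u → f′ u * ∑ (λ v → g v * K u v)))

  form-square : ∀ f g → form K (λ x → f x + g x) (λ x → f x + g x) ≡ form K f f + 2 * form K f g + form K g g
  form-square f g = begin
    form K f+g f+g                                                   ≡⟨ form-+ˡ f g f+g ⟩
    form K f f+g + form K g f+g                                      ≡⟨ cong₂ _+_ (right f) (right g) ⟩
    (form K f f + form K g f) + (form K f g + form K g g)            ≡⟨ cong (λ z → (form K f f + z) + (form K f g + form K g g)) (form-sym g f) ⟩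
    (form K f f + form K f g) + (form K f g + form K g g)            ≡⟨ regroup (form K f f) (form K f g) (form K g g) ⟩
    form K f f + 2 * form K f g + form K g g                         ∎
    where
    open ≡-Reasoning
    f+g : Fin N → ℕ
    f+g x = f x + g x
    right : ∀ h → form K h f+g ≡ form K f h + form K g h
    right h = trans (form-sym h f+g) (form-+ˡ f g h)
    regroup : ∀ a b c → (a + b) + (b + c) ≡ a + 2 * b + c
    regroup = solve-∀

  form-glue : ∀ α γ e → form K (λ x → (α x + γ x) + e x) (λ x → (α x + γ x) + e x) + form K e e
              ≡ form K (λ x → α x + e x) (λ x → α x + e x) + form K (λ x → γ x + e x) (λ x → γ x + e x) + 2 * form K α γ
  form-glue α γ e
    rewrite form-square (λ x → α x + γ x) e | form-square α γ | form-square α e | form-square γ e | form-+ˡ α γ e =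
    regroup (form K α α) (form K α γ) (form K γ γ) (form K α e) (form K γ e) (form K e e)
    where
    regroup : ∀ aa ac cc ae ce ee → (aa + 2 * ac + cc + 2 * (ae + ce) + ee) + ee
              ≡ (aa + 2 * ae + ee) + (cc + 2 * ce + ee) + 2 * ac
    regroup = solve-∀

  form-δ : ∀ a g → form K (δ a) g ≡ ∑ (λ v → g v * K a v)
  form-δ a g = ∑-δ a (λ u → ∑ (λ v → g v * K u v))

  form-poles : ∀ a c → form K (λ x → δ a x + δ c x) (λ x → δ a x + δ c x) ≡ K a a + 2 * K a c + K c c
  form-poles a c = trans (form-square (δ a) (δ c)) (cong₂ _+_ (cong₂ (λ x y → x + 2 * y) (at a a) (at a c)) (at c c))
    where
    at : ∀ a c → form K (δ a) (δ c) ≡ K a c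
    at a c = trans (form-δ a (δ c)) (∑-δ c (K a))

wiener : ∀ {N} → (Fin N → Fin N → ℕ) → Sub N → ℕ
wiener d S = form d (𝟙 ∘ S) (𝟙 ∘ S)

adj : ∀ {N} → (Fin N → Fin N → ℕ) → Fin N → Fin N → ℕ
adj d u v = 𝟙 (does (d u v ℕ.≟ 1))

module Sizes {N} {d : Fin N → Fin N → ℕ} (M : Metric d) (bip : Bip d) where
  open Metric M

  adj-sym : ∀ u v → adj d u v ≡ adj d v u
  adj-sym u v = cong (λ k → 𝟙 (does (k ℕ.≟ 1))) (d-sym u v)

  module Dist = Form d d-sym
  module Adj = Form (adj d) adj-sym

  degrees : Sub N → ℕ
  degrees S = form (adj d) (𝟙 ∘ S) (𝟙 ∘ S)

  module _ {S nx} (G : Surf d S nx) where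
    open Surface M G
    open Cotree M G hiding (φ; swap)
    open Code N

    al≡degrees : ∣ al ∣ ≡ degrees S
    al≡degrees = trans (card-coded Dart?) (∑-cong (λ u → trans (∑-cong (cell u)) (∑-* (𝟙 (S u)) (λ v → 𝟙 (S v) * adj d u v))))
      where
      cell : ∀ u v → 𝟙 (does (Dart? u v)) ≡ 𝟙 (S u) * (𝟙 (S v) * adj d u v)
      cell u v = trans (𝟙-dec (Dart? u v) ((u ∈? S) ×-dec ((v ∈? S) ×-dec (d u v ℕ.≟ 1)))
          (λ (dart a b c) → a , b , c) (λ (a , b , c) → dart a b c)) (pt (S u) (S v) (does (d u v ℕ.≟ 1)))
        where
        pt : ∀ x y z → 𝟙 (does (x Bool.≟ true) ∧ (does (y Bool.≟ true) ∧ z)) ≡ 𝟙 x * (𝟙 y * 𝟙 z)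
        pt true true true = refl
        pt true true false = refl
        pt true false z = refl
        pt false y z = refl

    euler-degrees : ∀ {r} → r ∈ S → 4 * ∣ S ∣ ≤ degrees S + 8
    euler-degrees rS = subst (λ k → 4 * ∣ S ∣ ≤ k + 8) al≡degrees (euler (Bipartite.bfs M G rS))

  module _ {S a c A C} (K : Cut d S a c A C) where
    open Cut K

    poles : Fin N → ℕ
    poles x = δ a x + δ c x

    S-weight : ∀ x → 𝟙 (S x) ≡ (𝟙 (A x) + 𝟙 (C x)) + poles x
    S-weight x with x ≟F a | x ≟F c
    ... | yes refl | yes refl = ⊥-elim (a≢c refl)
    ... | yes refl | no _ rewrite a∈ | ¬true a∉A | ¬true a∉C = refl
    ... | no _ | yes refl rewrite c∈ | ¬true c∉A | ¬true c∉C = refl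
    ... | no n₁ | no n₂ = trans (pt (S x) (A x) (C x) (λ p → case part p of λ where
          (inj₁ q) → inj₁ q
          (inj₂ (inj₁ q)) → inj₂ q
          (inj₂ (inj₂ (inj₁ e))) → ⊥-elim (n₁ e)
          (inj₂ (inj₂ (inj₂ e))) → ⊥-elim (n₂ e)) A⊆ C⊆ disj) (sym (+-identityʳ _))
      where
      pt : ∀ s α γ → (s ≡ true → α ≡ true ⊎ γ ≡ true) → (α ≡ true → s ≡ true) → (γ ≡ true → s ≡ true) →
           (α ≡ true → ¬ (γ ≡ true)) → 𝟙 s ≡ 𝟙 α + 𝟙 γ
      pt true true true f g h i = ⊥-elim (i refl refl)
      pt true true false f g h i = refl
      pt true false true f g h i = refl
      pt true false false f g h i = case f refl of λ { (inj₁ ()) ; (inj₂ ()) }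
      pt false true γ f g h i = case g refl of λ ()
      pt false false true f g h i = case h refl of λ ()
      pt false false false f g h i = refl

    Piece-weight : ∀ x → 𝟙 (Piece a c C x) ≡ 𝟙 (C x) + poles x
    Piece-weight x = trans (𝟙-⊎ ((x ∈? C) ⊎-dec ((x ≟F a) ⊎-dec (x ≟F c))) (x ∈? C) ((x ≟F a) ⊎-dec (x ≟F c)) id inj₁ inj₂
        (λ p → [ (λ { refl → a∉C p }) , (λ { refl → c∉C p }) ]′))
      (cong₂ _+_ (𝟙-≟ (C x)) (𝟙-⊎ ((x ≟F a) ⊎-dec (x ≟F c)) (x ≟F a) (x ≟F c) id inj₁ inj₂ (λ { refl e → a≢c e })))

    private
      ∑δ : ∀ (z : Fin N) → ∑ (δ z) ≡ 1
      ∑δ z = trans (∑-cong (λ x → sym (*-identityʳ (δ z x)))) (∑-δ z (λ _ → 1))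
      ∑poles : ∑ poles ≡ 2
      ∑poles = trans (∑-+ (δ a) (δ c)) (cong₂ _+_ (∑δ a) (∑δ c))

    Piece-size : ∣ Piece a c C ∣ ≡ ∣ C ∣ + 2
    Piece-size = trans (∑-cong Piece-weight) (trans (∑-+ (𝟙 ∘ C) poles) (cong (∣ C ∣ +_) ∑poles))

    S-size : ∣ S ∣ ≡ (∣ A ∣ + ∣ C ∣) + 2
    S-size = trans (∑-cong S-weight) (trans (∑-+ (λ x → 𝟙 (A x) + 𝟙 (C x)) poles) (cong₂ _+_ (∑-+ (𝟙 ∘ A) (𝟙 ∘ C)) ∑poles))

  module _ {S a c A C} (K : Cut d S a c A C) where
    open Cut K
    private
      K′ = swap-sides M K
      e = poles K

    glue-dist : wiener d S + 2 * d a c ≡ wiener d (Piece a c A) + wiener d (Piece a c C) + 2 * form d (𝟙 ∘ A) (𝟙 ∘ C)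
    glue-dist = begin
      wiener d S + 2 * d a c                    ≡⟨ cong₂ _+_ (Dist.form-cong (S-weight K) (S-weight K)) (sym ee) ⟩
      form d s s + form d e e                   ≡⟨ Dist.form-glue (𝟙 ∘ A) (𝟙 ∘ C) e ⟩
      _                                         ≡⟨ cong₂ (λ x y → x + y + 2 * form d (𝟙 ∘ A) (𝟙 ∘ C)) (sym (Dist.form-cong (Piece-weight K′) (Piece-weight K′))) (sym (Dist.form-cong (Piece-weight K) (Piece-weight K))) ⟩
      _ ∎
      where
      open ≡-Reasoning
      s : Fin N → ℕ
      s x = (𝟙 (A x) + 𝟙 (C x)) + e x
      ee : form d e e ≡ 2 * d a c
      ee = trans (Dist.form-poles a c) (trans (cong₂ (λ x y → x + 2 * d a c + y) (d-refl a) (d-refl c)) (+-identityʳ _))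

    glue-degrees : d a c ≢ 1 → degrees S ≡ degrees (Piece a c A) + degrees (Piece a c C)
    glue-degrees a≁c = begin
      degrees S                                 ≡⟨ Adj.form-cong (S-weight K) (S-weight K) ⟩
      form (adj d) s s                          ≡⟨ sym (+-identityʳ _) ⟩
      form (adj d) s s + 0                      ≡⟨ cong (form (adj d) s s +_) (sym ee) ⟩
      form (adj d) s s + form (adj d) e e       ≡⟨ Adj.form-glue (𝟙 ∘ A) (𝟙 ∘ C) e ⟩
      _                                         ≡⟨ cong₂ _+_ (cong₂ _+_ (sym (Adj.form-cong (Piece-weight K′) (Piece-weight K′))) (sym (Adj.form-cong (Piece-weight K) (Piece-weight K)))) (cong (2 *_) ac) ⟩
      degrees (Piece a c A) + degrees (Piece a c C) + 0  ≡⟨ +-identityʳ _ ⟩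
      degrees (Piece a c A) + degrees (Piece a c C) ∎
      where
      open ≡-Reasoning
      s : Fin N → ℕ
      s x = (𝟙 (A x) + 𝟙 (C x)) + e x
      off : ∀ {u v} → d u v ≢ 1 → adj d u v ≡ 0
      off {u} {v} ne = cong 𝟙 (dec-false (d u v ℕ.≟ 1) ne)
      loop : ∀ u → adj d u u ≡ 0
      loop u = off (λ h → case trans (sym (d-refl u)) h of λ ())
      ee : form (adj d) e e ≡ 0
      ee = trans (Adj.form-poles a c) (trans (cong₂ (λ x y → x + 2 * adj d a c + y) (loop a) (loop c)) (trans (+-identityʳ _) (cong (2 *_) (off a≁c))))
      ac : form (adj d) (𝟙 ∘ A) (𝟙 ∘ C) ≡ 0
      ac = trans (∑-cong row) (∑-zero N)
        where
        row : ∀ u → 𝟙 (A u) * ∑ (λ v → 𝟙 (C v) * adj d u v) ≡ 0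
        row u with u ∈? A
        ... | no h rewrite ¬true h = refl
        ... | yes uA = trans (cong (𝟙 (A u) *_) (trans (∑-cong cell) (∑-zero N))) (*-zeroʳ (𝟙 (A u)))
          where
          cell : ∀ v → 𝟙 (C v) * adj d u v ≡ 0
          cell v with v ∈? C
          ... | no h rewrite ¬true h = refl
          ... | yes vC = trans (cong (𝟙 (C v) *_) (off (noE uA vC))) (*-zeroʳ (𝟙 (C v)))

    path-degrees : ∀ {p} → p ∈ C → d a p ≡ 1 → d c p ≡ 1 → 4 ≤ degrees (Piece a c C)
    path-degrees {p} pC ap cp = begin
      4                                                        ≤⟨ *-monoʳ-≤ 2 (+-mono-≤ (one ap) (one cp)) ⟩
      2 * (∑ (λ v → 𝟙 (C v) * adj d a v) + ∑ (λ v → 𝟙 (C v) * adj d c v)) ≡⟨ cong (2 *_) (sym (cong₂ _+_ (Adj.form-δ a (𝟙 ∘ C)) (Adj.form-δ c (𝟙 ∘ C)))) ⟩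
      2 * (form (adj d) (δ a) (𝟙 ∘ C) + form (adj d) (δ c) (𝟙 ∘ C)) ≡⟨ cong (2 *_) (trans (sym (Adj.form-+ˡ (δ a) (δ c) (𝟙 ∘ C))) (Adj.form-sym e (𝟙 ∘ C))) ⟩
      2 * form (adj d) (𝟙 ∘ C) e                               ≤⟨ ≤-trans (m≤n+m _ (form (adj d) (𝟙 ∘ C) (𝟙 ∘ C))) (m≤m+n _ (form (adj d) e e)) ⟩
      form (adj d) (𝟙 ∘ C) (𝟙 ∘ C) + 2 * form (adj d) (𝟙 ∘ C) e + form (adj d) e e ≡⟨ sym (Adj.form-square (𝟙 ∘ C) e) ⟩
      _                                                        ≡⟨ sym (Adj.form-cong (Piece-weight K) (Piece-weight K)) ⟩
      degrees (Piece a c C)                                    ∎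
      where
      open ≤-Reasoning
      one : ∀ {z} → d z p ≡ 1 → 1 ≤ ∑ (λ v → 𝟙 (C v) * adj d z v)
      one {z} zp = ≤-trans (≤-reflexive (sym (cong₂ _*_ (𝟙≡1 pC) (cong 𝟙 (dec-true (d z p ℕ.≟ 1) zp)))))
                           (∑-single (λ v → 𝟙 (C v) * adj d z v) p)

  -- Both pieces of a sphere are spheres, by Euler's inequality for each.
  module _ {S nx} (G : Surf d S nx) (tight : 4 * ∣ S ∣ ≡ degrees S + 8) where
    open Pieces M bip G

    side-euler : ∀ {a c A C p₁ p₂ q₁ q₂} (K : Cut d S a c A C) → Cross d S nx a c A C p₁ p₂ q₁ q₂ →
                 4 * ∣ Piece a c C ∣ ≤ degrees (Piece a c C) + 8
    side-euler {a} {c} {A} {C} {q₁ = q₁} {q₂} K X with q₁ ≟F q₂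
    ... | no ne = euler-degrees (piece K X ne) (∈Piece K (inj₂ (inj₁ refl)))
    -- Here C is one vertex and the piece is a path with 3 vertices. It is no surface, but 4 * 3 = 4
    -- + 8 still holds.
    ... | yes e = ≤-trans (*-monoʳ-≤ 4 (≤-trans (≤-reflexive (Piece-size K)) (+-monoˡ-≤ 2 small)))
                          (+-monoˡ-≤ 8 (path-degrees K q₁∈ aq₁ (trans (d-sym c q₁) q₁c)))
      where
      open Cross X
      small : ∣ C ∣ ≤ 1
      small with ∣ C ∣ ≤? 1
      ... | yes p = p
      ... | no p with card-two C (≰⇒> p)
      ...   | x , y , xC , yC , ne = ⊥-elim (ne (trans (only-q K X e xC) (sym (only-q K X e yC))))

    -- The Euler inequalities of the two pieces add up to the equation for S, so neither can be
    -- strict.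
    piece-tight : ∀ {a c A C p₁ p₂ q₁ q₂} (K : Cut d S a c A C) → Cross d S nx a c A C p₁ p₂ q₁ q₂ →
                  4 * ∣ Piece a c C ∣ ≡ degrees (Piece a c C) + 8
    piece-tight {a} {c} {A} {C} K X = ≤-antisym (side-euler K X)
      (≤-from-slack 0 (side-euler K′ (flip-cross X)) (begin
        degrees (Piece a c C) + 8 + (degrees (Piece a c A) + 8) + 0 ≡⟨ r₁ (degrees (Piece a c C)) (degrees (Piece a c A)) ⟩
        degrees (Piece a c A) + degrees (Piece a c C) + 8 + 8  ≡⟨ cong (λ z → z + 8 + 8) (sym (glue-degrees K (Cross.a≁c X))) ⟩
        degrees S + 8 + 8                                ≡⟨ cong (_+ 8) (sym tight) ⟩
        4 * ∣ S ∣ + 8                                    ≡⟨ cong (λ z → 4 * z + 8) (S-size K) ⟩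
        4 * (∣ A ∣ + ∣ C ∣ + 2) + 8                      ≡⟨ r₂ ∣ A ∣ ∣ C ∣ ⟩
        4 * (∣ C ∣ + 2) + 4 * (∣ A ∣ + 2)                ≡⟨ cong₂ (λ x y → 4 * x + 4 * y) (sym (Piece-size K)) (sym (Piece-size K′)) ⟩
        4 * ∣ Piece a c C ∣ + 4 * ∣ Piece a c A ∣        ∎))
      where
      open ≡-Reasoning
      K′ = swap-sides M K
      r₁ : ∀ c a → c + 8 + (a + 8) + 0 ≡ a + c + 8 + 8
      r₁ = solve-∀
      r₂ : ∀ a c → 4 * (a + c + 2) + 8 ≡ 4 * (c + 2) + 4 * (a + 2)
      r₂ = solve-∀

-- Arithmetic of the bound

-- The bound of the theorem, multiplied by 3, for the sum P over ordered pairs.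
Goal : ℕ → ℕ → Set
Goal n P = (∀ k → n ≡ k + k → 3 * P + 12 ≤ 4 * (k * (k * k)) + 14 * k) ×
           (∀ k → n ≡ suc (k + k) → 3 * P ≤ 4 * (k * (k * k)) + 6 * (k * k) + 14 * k)

double-inj : ∀ j k → j + j ≡ k + k → j ≡ k
double-inj j k e = *-cancelˡ-≡ j k 2 (trans (cong (j +_) (+-identityʳ j)) (trans e (cong (k +_) (sym (+-identityʳ k)))))

goal-even : ∀ {n P} k → n ≡ k + k → 3 * P + 12 ≤ 4 * (k * (k * k)) + 14 * k → Goal n P
goal-even {P = P} k e h =
  (λ j e′ → subst (λ z → 3 * P + 12 ≤ 4 * (z * (z * z)) + 14 * z) (double-inj k j (trans (sym e) e′)) h) ,
  (λ j e′ → ⊥-elim (a+a≢1+b+b k j (trans (sym e) e′)))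

goal-odd : ∀ {n P} k → n ≡ suc (k + k) → 3 * P ≤ 4 * (k * (k * k)) + 6 * (k * k) + 14 * k → Goal n P
goal-odd {P = P} k e h =
  (λ j e′ → ⊥-elim (a+a≢1+b+b j k (trans (sym e′) e))) ,
  (λ j e′ → subst (λ z → 3 * P ≤ 4 * (z * (z * z)) + 6 * (z * z) + 14 * z) (double-inj k j (suc-injective (trans (sym e) e′))) h)

-- Permits the induction step to assume that the bound fails and to refute the existence of cuts
-- from that.
goal-stable : ∀ {n P} → ¬ ¬ Goal n P → Goal n P
goal-stable h = (λ k e → decidable-stable (_ ≤? _) (λ n → h (λ g → n (proj₁ g k e)))) ,
                (λ k e → decidable-stable (_ ≤? _) (λ n → h (λ g → n (proj₂ g k e))))

W₂-step : ∀ m → W₂ (suc m) ≤ W₂ m + suc ⌊ m /2⌋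
W₂-step 0 = ≤-refl
W₂-step 1 = ≤-refl
W₂-step (suc (suc m)) = ≤-from-slack 0 (W₂-step m) (eq m (W₂ (suc m)) (W₂ m) ⌊ m /2⌋)
  where
  eq : ∀ m a b h → 3 + m + a + (b + suc h) + 0 ≡ 2 + m + b + suc (suc h) + a
  eq = solve-∀

-- The price of one level with a single vertex, charged later to each vertex of A that is not
-- equidistant from the poles.
W₁≤ : ∀ m → W₁ m ≤ W₂ m + ⌊ m /2⌋
W₁≤ 0 = ≤-refl
W₁≤ 1 = ≤-refl
W₁≤ (suc (suc m)) = ≤-trans (+-monoʳ-≤ (2 + m) (W₂-step m)) (≤-reflexive (sym (+-assoc (2 + m) (W₂ m) _)))

-- s and t are the sizes of A and C, Y sums the distances from A to the nearer pole, F sums the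
-- distances between A and C, and u counts the vertices of A that are not equidistant from the
-- poles. The 3 in `u≤` matters: for s = 3 and t = 2y + 2 the slack is 2y + 8, and from y = 1 on one
-- more exception, at the cost 6 (y + 1), would not fit.
module GlueBound (s t Y F u P P₁ P₂ : ℕ) (3≤s : 3 ≤ s) (2≤t : 2 ≤ t)
                 (Y≤ : 6 * Y ≤ suc s * suc (suc s))
                 (F≤ : F ≤ t * Y + s * W₂ t + u * ⌊ t /2⌋) (u≤ : u + 3 ≤ s)
                 (P≡ : P + 4 ≡ P₁ + P₂ + 2 * F)
                 (g₁ : Goal (s + 2) P₁) (g₂ : Goal (t + 2) P₂) where

  6F≤ : ∀ w h r → W₂ t ≡ w → ⌊ t /2⌋ ≡ h → s ≡ r + 3 →
        6 * F ≤ t * (suc s * suc (suc s)) + 6 * (s * w) + 6 * (r * h)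
  6F≤ w h r refl refl e = begin
    6 * F                                               ≤⟨ *-monoʳ-≤ 6 F≤ ⟩
    6 * (t * Y + s * w + u * h)                         ≡⟨ dist t Y (s * w) (u * h) ⟩
    t * (6 * Y) + 6 * (s * w) + 6 * (u * h)             ≤⟨ +-mono-≤ (+-monoˡ-≤ (6 * (s * w)) (*-monoʳ-≤ t Y≤)) (*-monoʳ-≤ 6 (*-monoˡ-≤ h (+-cancelʳ-≤ 3 u r (≤-trans u≤ (≤-reflexive e))))) ⟩
    t * (suc s * suc (suc s)) + 6 * (s * w) + 6 * (r * h) ∎
    where
    open ≤-Reasoning
    dist : ∀ t y a b → 6 * (t * y + a + b) ≡ t * (6 * y) + 6 * a + 6 * b
    dist = solve-∀

  3P+12 : 3 * P + 12 ≡ 3 * (P₁ + P₂ + 2 * F)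
  3P+12 = trans (sym (*-distribˡ-+ 3 P 4)) (cong (3 *_) P≡)

  n = s + t + 2

  combine₃ : ∀ {R₁ R₂ R₃ H} sl → 3 * P₁ + 12 ≤ R₁ → 3 * P₂ + 12 ≤ R₂ → 6 * F ≤ R₃ →
             R₁ + R₂ + R₃ + sl ≡ H + 24 → 3 * P + 12 ≤ H
  combine₃ {R₁} {R₂} {R₃} {H} sl h₁ h₂ h₃ e = ≤-from-slack sl (+-mono-≤ (+-mono-≤ h₁ h₂) h₃) (begin
    3 * P + 12 + (R₁ + R₂ + R₃) + sl                 ≡⟨ +-assoc (3 * P + 12) _ sl ⟩
    3 * P + 12 + (R₁ + R₂ + R₃ + sl)                 ≡⟨ cong₂ _+_ 3P+12 e ⟩
    3 * (P₁ + P₂ + 2 * F) + (H + 24)                 ≡⟨ eq P₁ P₂ F H ⟩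
    H + (3 * P₁ + 12 + (3 * P₂ + 12) + 6 * F)        ∎)
    where
    open ≡-Reasoning
    eq : ∀ p q f h → 3 * (p + q + 2 * f) + (h + 24) ≡ h + (3 * p + 12 + (3 * q + 12) + 6 * f)
    eq = solve-∀

  -- The odd bound lacks the summand 12 of the even one; adding it lets `combine₃` serve all four
  -- parities.
  pad : ∀ {a b} → a ≤ b → a + 12 ≤ b + 12
  pad = +-monoˡ-≤ 12

  even-even : ∀ x y → s ≡ (2 + x) + (2 + x) → t ≡ (1 + y) + (1 + y) → Goal n P
  even-even x y refl refl = goal-even {P = P} (4 + x + y) (e₀ x y)
    (combine₃ (4 * (x * (x * y)) + 4 * (x * x) + 4 * (x * y) + 4 * x + 6 * y + 12)
      (proj₁ g₁ (3 + x) (e₁ x)) (proj₁ g₂ (2 + y) (e₂ y))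
      (6F≤ ((1 + y) * (1 + y) + (1 + y)) (1 + y) (1 + x + x) (W₂-even (1 + y)) (sym (n≡⌊n+n/2⌋ (1 + y))) (e₃ x)) (main x y))
    where
    e₀ : ∀ x y → (2 + x) + (2 + x) + ((1 + y) + (1 + y)) + 2 ≡ (4 + x + y) + (4 + x + y)
    e₀ = solve-∀
    e₁ : ∀ x → (2 + x) + (2 + x) + 2 ≡ (3 + x) + (3 + x)
    e₁ = solve-∀
    e₂ : ∀ x → (1 + x) + (1 + x) + 2 ≡ (2 + x) + (2 + x)
    e₂ = solve-∀
    e₃ : ∀ x → (2 + x) + (2 + x) ≡ 1 + x + x + 3
    e₃ = solve-∀
    main : ∀ x y → 4 * ((3 + x) * ((3 + x) * (3 + x))) + 14 * (3 + x) + (4 * ((2 + y) * ((2 + y) * (2 + y))) + 14 * (2 + y)) +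
        (((1 + y) + (1 + y)) * (suc ((2 + x) + (2 + x)) * suc (suc ((2 + x) + (2 + x)))) + 6 * (((2 + x) + (2 + x)) * ((1 + y) * (1 + y) + (1 + y))) + 6 * ((1 + x + x) * (1 + y)))
        + (4 * (x * (x * y)) + 4 * (x * x) + 4 * (x * y) + 4 * x + 6 * y + 12)
        ≡ 4 * ((4 + x + y) * ((4 + x + y) * (4 + x + y))) + 14 * (4 + x + y) + 24
    main = solve-∀

  even-odd : ∀ x y → s ≡ (2 + x) + (2 + x) → t ≡ suc ((1 + y) + (1 + y)) → Goal n P
  even-odd x y refl refl = goal-odd {P = P} (4 + x + y) (e₀ x y) (+-cancelʳ-≤ 12 (3 * P) _
    (combine₃ (4 * (x * (x * y)) + 6 * (x * x) + 4 * (x * y) + 6 * x + 6 * y + 6)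
      (proj₁ g₁ (3 + x) (e₁ x)) (pad (proj₂ g₂ (2 + y) (e₂ y)))
      (6F≤ ((2 + y) * (2 + y)) (1 + y) (1 + x + x) (W₂-odd (1 + y)) (sym (n≡⌈n+n/2⌉ (1 + y))) (e₃ x)) (main x y)))
    where
    e₀ : ∀ x y → (2 + x) + (2 + x) + suc ((1 + y) + (1 + y)) + 2 ≡ suc ((4 + x + y) + (4 + x + y))
    e₀ = solve-∀
    e₁ : ∀ x → (2 + x) + (2 + x) + 2 ≡ (3 + x) + (3 + x)
    e₁ = solve-∀
    e₂ : ∀ x → suc ((1 + x) + (1 + x)) + 2 ≡ suc ((2 + x) + (2 + x))
    e₂ = solve-∀
    e₃ : ∀ x → (2 + x) + (2 + x) ≡ 1 + x + x + 3
    e₃ = solve-∀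
    main : ∀ x y → 4 * ((3 + x) * ((3 + x) * (3 + x))) + 14 * (3 + x) + (4 * ((2 + y) * ((2 + y) * (2 + y))) + 6 * ((2 + y) * (2 + y)) + 14 * (2 + y) + 12) +
        (suc ((1 + y) + (1 + y)) * (suc ((2 + x) + (2 + x)) * suc (suc ((2 + x) + (2 + x)))) + 6 * (((2 + x) + (2 + x)) * ((2 + y) * (2 + y))) + 6 * ((1 + x + x) * (1 + y)))
        + (4 * (x * (x * y)) + 6 * (x * x) + 4 * (x * y) + 6 * x + 6 * y + 6)
        ≡ 4 * ((4 + x + y) * ((4 + x + y) * (4 + x + y))) + 6 * ((4 + x + y) * (4 + x + y)) + 14 * (4 + x + y) + 12 + 24
    main = solve-∀

  odd-even : ∀ x y → s ≡ suc ((1 + x) + (1 + x)) → t ≡ (1 + y) + (1 + y) → Goal n P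
  odd-even x y refl refl = goal-odd {P = P} (3 + x + y) (e₀ x y) (+-cancelʳ-≤ 12 (3 * P) _
    (combine₃ (4 * (x * (x * y)) + 4 * (x * x) + 2 * y + 8)
      (pad (proj₂ g₁ (2 + x) (e₁ x))) (proj₁ g₂ (2 + y) (e₂ y))
      (6F≤ ((1 + y) * (1 + y) + (1 + y)) (1 + y) (x + x) (W₂-even (1 + y)) (sym (n≡⌊n+n/2⌋ (1 + y))) (e₃ x)) (main x y)))
    where
    e₀ : ∀ x y → suc ((1 + x) + (1 + x)) + ((1 + y) + (1 + y)) + 2 ≡ suc ((3 + x + y) + (3 + x + y))
    e₀ = solve-∀
    e₁ : ∀ x → suc ((1 + x) + (1 + x)) + 2 ≡ suc ((2 + x) + (2 + x))
    e₁ = solve-∀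
    e₂ : ∀ x → (1 + x) + (1 + x) + 2 ≡ (2 + x) + (2 + x)
    e₂ = solve-∀
    e₃ : ∀ x → suc ((1 + x) + (1 + x)) ≡ x + x + 3
    e₃ = solve-∀
    main : ∀ x y → 4 * ((2 + x) * ((2 + x) * (2 + x))) + 6 * ((2 + x) * (2 + x)) + 14 * (2 + x) + 12 + (4 * ((2 + y) * ((2 + y) * (2 + y))) + 14 * (2 + y)) +
        (((1 + y) + (1 + y)) * (suc (suc ((1 + x) + (1 + x))) * suc (suc (suc ((1 + x) + (1 + x))))) + 6 * (suc ((1 + x) + (1 + x)) * ((1 + y) * (1 + y) + (1 + y))) + 6 * ((x + x) * (1 + y)))
        + (4 * (x * (x * y)) + 4 * (x * x) + 2 * y + 8)
        ≡ 4 * ((3 + x + y) * ((3 + x + y) * (3 + x + y))) + 6 * ((3 + x + y) * (3 + x + y)) + 14 * (3 + x + y) + 12 + 24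
    main = solve-∀

  odd-odd : ∀ x y → s ≡ suc ((1 + x) + (1 + x)) → t ≡ suc ((1 + y) + (1 + y)) → Goal n P
  odd-odd x y refl refl = goal-even {P = P} (4 + x + y) (e₀ x y)
    (combine₃ (4 * (x * (x * y)) + 6 * (x * x) + 6 * x + 8 * y + 12)
      (pad (proj₂ g₁ (2 + x) (e₁ x))) (pad (proj₂ g₂ (2 + y) (e₁ y)))
      (6F≤ ((2 + y) * (2 + y)) (1 + y) (x + x) (W₂-odd (1 + y)) (sym (n≡⌈n+n/2⌉ (1 + y))) (e₃ x)) (main x y))
    where
    e₀ : ∀ x y → suc ((1 + x) + (1 + x)) + suc ((1 + y) + (1 + y)) + 2 ≡ (4 + x + y) + (4 + x + y)
    e₀ = solve-∀
    e₁ : ∀ x → suc ((1 + x) + (1 + x)) + 2 ≡ suc ((2 + x) + (2 + x))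
    e₁ = solve-∀
    e₃ : ∀ x → suc ((1 + x) + (1 + x)) ≡ x + x + 3
    e₃ = solve-∀
    main : ∀ x y → 4 * ((2 + x) * ((2 + x) * (2 + x))) + 6 * ((2 + x) * (2 + x)) + 14 * (2 + x) + 12 + (4 * ((2 + y) * ((2 + y) * (2 + y))) + 6 * ((2 + y) * (2 + y)) + 14 * (2 + y) + 12) +
        (suc ((1 + y) + (1 + y)) * (suc (suc ((1 + x) + (1 + x))) * suc (suc (suc ((1 + x) + (1 + x))))) + 6 * (suc ((1 + x) + (1 + x)) * ((2 + y) * (2 + y))) + 6 * ((x + x) * (1 + y)))
        + (4 * (x * (x * y)) + 6 * (x * x) + 6 * x + 8 * y + 12)
        ≡ 4 * ((4 + x + y) * ((4 + x + y) * (4 + x + y))) + 14 * (4 + x + y) + 24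
    main = solve-∀

  goal : Goal n P
  goal with parity s | parity t
  ... | inj₁ (suc (suc x) , e) | inj₁ (suc y , f) = even-even x y e f
  ... | inj₁ (suc (suc x) , e) | inj₂ (suc y , f) = even-odd x y e f
  ... | inj₂ (suc x , e) | inj₁ (suc y , f) = odd-even x y e f
  ... | inj₂ (suc x , e) | inj₂ (suc y , f) = odd-odd x y e f
  ... | inj₁ (0 , e) | _ = ⊥-elim (<⇒≱ (s≤s z≤n) (subst (3 ≤_) e 3≤s))
  ... | inj₁ (1 , e) | _ = ⊥-elim (<⇒≱ (s≤s (s≤s (s≤s z≤n))) (subst (3 ≤_) e 3≤s))
  ... | inj₂ (0 , e) | _ = ⊥-elim (<⇒≱ (s≤s (s≤s z≤n)) (subst (3 ≤_) e 3≤s))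
  ... | _ | inj₁ (0 , f) = ⊥-elim (<⇒≱ (s≤s z≤n) (subst (2 ≤_) f 2≤t))
  ... | _ | inj₂ (0 , f) = ⊥-elim (<⇒≱ (s≤s (s≤s z≤n)) (subst (2 ≤_) f 2≤t))

-- Vertices of degree 2

module Status {N} {d : Fin N → Fin N → ℕ} (M : Metric d) (bip : Bip d) where
  open Metric M
  open Sizes M bip

  status : Sub N → Fin N → ℕ
  status X v = ∑ (λ y → 𝟙 (X y) * d v y)

  tight-al : ∀ {S nx} (G : Surf d S nx) → 4 * ∣ S ∣ ≡ degrees S + 8 → Corners.Tight M bip G
  tight-al {S} G t = subst (λ k → 4 * ∣ S ∣ ≡ k + 8) (sym (al≡degrees G)) t

  Far-from : Sub N → Fin N → ℕ → Set
  Far-from S v k = ∃ λ x → x ∈ S × k < d v x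

  far? : ∀ S v k → Dec (Far-from S v k)
  far? S v k = any? (λ x → (x ∈? S) ×-dec (k <? d v x))

  -- X stands for S without v in the form in which it happens to arise: as a set difference, or as
  -- the piece that remains after a deletion.
  module Punctured {S nx} (G : Surf d S nx) {v : Fin N} (vS : v ∈ S) (X : Sub N)
                   (X⊆S : ∀ {x} → x ∈ X → x ∈ S) (S⊆X : ∀ {x} → x ∈ S → x ≢ v → x ∈ X) where
    open Surface M G

    lev-S : ∀ {k} → Far-from S v (suc k) → 2 ≤ ∣ Lev S (d v) (suc k) ∣
    lev-S {k} (x , xS , far) = level-2 (d v) (d-lip v) (suc k) vS (subst (_< suc k) (sym (d-refl v)) (s≤s z≤n)) xS far

    lev-X : ∀ k → ∣ Lev S (d v) (suc k) ∣ ≤ ∣ Lev X (d v) (suc k) ∣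
    lev-X k = card-mono {S = Lev S (d v) (suc k)} {T = Lev X (d v) (suc k)} (λ y p → case Lev∈ S (d v) (suc k) p of λ where
      (yS , e) → ∈Lev X (d v) (suc k) (S⊆X yS (λ { refl → case trans (sym e) (d-refl v) of λ () })) e)

    wide-2 : ∀ k → Profile.Wide X (d v) 2 (suc k)
    wide-2 k x xX far = ≤-trans (lev-S (x , X⊆S xX , far)) (lev-X k)

    status-2 : status X v ≤ W₂ ∣ X ∣
    status-2 = Profile.total-2 X (d v) wide-2

    status-232 : (Far-from S v 2 → 3 ≤ ∣ Lev S (d v) 2 ∣) → status X v ≤ W₂₃ ∣ X ∣
    status-232 h = Profile.total-232 X (d v) wide-2 (λ x xX far → ≤-trans (h (x , X⊆S xX , far)) (lev-X 1))

  Single : Fin N → Sub N → Set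
  Single v A = ∀ {x} → x ∈ A → x ≡ v

  -- A vertex of degree 2 is a side A with one element, so its deletion is the passage to the piece
  -- on the other side of the cut.
  module Drop {S nx} (G : Surf d S nx) (tight : 4 * ∣ S ∣ ≡ degrees S + 8)
              {a c A C} (K : Cut d S a c A C) {v} (vA : v ∈ A) (only : Single v A) (big : 2 ≤ ∣ C ∣) where
    open Cut K
    open Surface M G
    open Pieces M bip G

    ∣A∣≡1 : ∣ A ∣ ≡ 1
    ∣A∣≡1 = card-single A vA only

    private
      got : ∃ λ p₁ → ∃ λ p₂ → ∃ λ q₁ → ∃ λ q₂ → Cross d S nx a c A C p₁ p₂ q₁ q₂
      got with cross (tight-al G tight) K
      ... | inj₁ X = X
      ... | inj₂ (A′ , C′ , K′ , less) = ⊥-elim (<⇒≱ less (≤-trans (≤-reflexive ∣A∣≡1) (card-≥1 A′ (proj₂ (Cut.A-in K′)))))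
      X = proj₂ (proj₂ (proj₂ (proj₂ got)))

    open Cross X

    va : d v a ≡ 1
    va = subst (λ z → d z a ≡ 1) (only p₁∈) p₁a

    vc : d v c ≡ 1
    vc = subst (λ z → d z c ≡ 1) (only p₂∈) p₂c

    nonadj : d a c ≢ 1
    nonadj = a≁c

    q₁≢q₂ : _ ≢ _
    q₁≢q₂ e with card-two C big
    ... | x , y , xC , yC , ne = ne (trans (only-q K X e xC) (sym (only-q K X e yC)))

    S′ : Sub N
    S′ = Piece a c C

    surf : Surf d S′ (nx′ K X)
    surf = piece K X q₁≢q₂

    tight′ : 4 * ∣ S′ ∣ ≡ degrees S′ + 8
    tight′ = piece-tight G tight K X

    v∉S′ : ¬ (v ∈ S′)
    v∉S′ p = piece∉A K (Piece∈ K p) vA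

    S′⊆ : ∀ {x} → x ∈ S′ → x ∈ S
    S′⊆ p = Piece⊆ K (Piece∈ K p)

    ⊆S′ : ∀ {x} → x ∈ S → x ≢ v → x ∈ S′
    ⊆S′ p ne = ∈Piece K (inside K p (ne ∘ only))

    S-size′ : ∣ S ∣ ≡ suc ∣ S′ ∣
    S-size′ = trans (S-size K) (trans (cong (λ z → z + ∣ C ∣ + 2) ∣A∣≡1) (cong suc (sym (Piece-size K))))

    wiener-drop : wiener d S ≡ wiener d S′ + 2 * status S′ v
    wiener-drop = begin
      wiener d S                                          ≡⟨ Dist.form-cong weight weight ⟩
      form d (λ x → 𝟙 (S′ x) + δ v x) (λ x → 𝟙 (S′ x) + δ v x) ≡⟨ Dist.form-square (𝟙 ∘ S′) (δ v) ⟩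
      wiener d S′ + 2 * form d (𝟙 ∘ S′) (δ v) + form d (δ v) (δ v) ≡⟨ cong₂ (λ x y → wiener d S′ + 2 * x + y) (trans (Dist.form-sym (𝟙 ∘ S′) (δ v)) (Dist.form-δ v (𝟙 ∘ S′))) (trans (Dist.form-δ v (δ v)) (trans (∑-δ v (d v)) (d-refl v))) ⟩
      wiener d S′ + 2 * status S′ v + 0                   ≡⟨ +-identityʳ _ ⟩
      wiener d S′ + 2 * status S′ v                       ∎
      where
      open ≡-Reasoning
      weight : ∀ x → 𝟙 (S x) ≡ 𝟙 (S′ x) + δ v x
      weight x with x ≟F v
      ... | yes refl = trans (𝟙≡1 (A⊆ vA)) (cong (_+ 1) (sym (𝟙≡0 v∉S′)))
      ... | no ne = trans (cong 𝟙 (Bool-ext (λ p → ⊆S′ p ne) S′⊆)) (sym (+-identityʳ _))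

  IH : ℕ → Set
  IH n = ∀ S nx → Surf d S nx → 4 * ∣ S ∣ ≡ degrees S + 8 → 4 ≤ ∣ S ∣ → ∣ S ∣ < n → Goal ∣ S ∣ (wiener d S)

  small-case : ∀ {S nx} → Surf d S nx → ∣ S ∣ ≡ 4 → Goal ∣ S ∣ (wiener d S)
  small-case {S} G e = goal-even {P = wiener d S} 2 e (≤-trans (+-monoˡ-≤ 12 (*-monoʳ-≤ 3 bound)) ≤-refl)
    where
    row : ∀ u → 𝟙 (S u) * status S u ≤ 𝟙 (S u) * 4
    row u with u ∈? S
    ... | no n rewrite ¬true n = z≤n
    ... | yes uS = *-monoʳ-≤ (𝟙 (S u)) (≤-trans (≤-reflexive same)
        (≤-trans (Punctured.status-2 G uS (S ∖ u) (proj₁ ∘ ∖-∈⁻ S) (∖-∈ S)) (≤-reflexive (cong W₂ (suc-injective (trans (sym (card-∖ S uS)) e))))))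
      where
      same : status S u ≡ status (S ∖ u) u
      same = ∑-cong λ y → case y ≟F u of λ where
        (yes refl) → trans (cong (𝟙 (S u) *_) (d-refl u)) (trans (*-zeroʳ (𝟙 (S u))) (sym (trans (cong (𝟙 ((S ∖ u) u) *_) (d-refl u)) (*-zeroʳ (𝟙 ((S ∖ u) u))))))
        (no ne) → cong (λ z → 𝟙 z * d u y) (Bool-ext (λ p → ∖-∈ S p ne) (proj₁ ∘ ∖-∈⁻ S))
    -- Four vertices of distance sum at most `W₂ 3` = 4; the value 16 meets the bound with equality.
    bound : wiener d S ≤ 16
    bound = begin
      wiener d S                   ≤⟨ ∑-mono row ⟩
      ∑ (λ u → 𝟙 (S u) * 4)        ≡⟨ ∑-cong (λ u → *-comm (𝟙 (S u)) 4) ⟩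
      ∑ (λ u → 4 * 𝟙 (S u))        ≡⟨ ∑-* 4 (𝟙 ∘ S) ⟩
      4 * ∣ S ∣                    ≡⟨ cong (4 *_) e ⟩
      16                           ∎
      where open ≤-Reasoning

  module Degree2 {S nx} (G : Surf d S nx) (tight : 4 * ∣ S ∣ ≡ degrees S + 8) (5≤ : 5 ≤ ∣ S ∣) (ih : IH ∣ S ∣)
                 {a c A C} (K : Cut d S a c A C) {v} (vA : v ∈ A) (only : Single v A) where
    private
      big : 2 ≤ ∣ C ∣
      big = ≤-pred (≤-pred (≤-pred (≤-trans 5≤ (≤-reflexive (trans (S-size K) (trans (cong (λ z → z + ∣ C ∣ + 2) one) (cong suc (+-comm ∣ C ∣ 2))))))))
        where
        one : ∣ A ∣ ≡ 1
        one = card-single A vA only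

    open Drop G tight K vA only big
    open Punctured G (Cut.A⊆ K vA) S′ S′⊆ ⊆S′
    open Surface M G

    private
      P P′ Q : ℕ
      P = wiener d S
      P′ = wiener d S′
      Q = status S′ v

      4≤S′ : 4 ≤ ∣ S′ ∣
      4≤S′ = ≤-pred (≤-trans 5≤ (≤-reflexive S-size′))

      goal′ : Goal ∣ S′ ∣ P′
      goal′ = ih S′ _ surf tight′ 4≤S′ (≤-reflexive (sym S-size′))

    -- (j + 1)² is both the value of `W₂` at 2j + 1 and exactly what the bound allows for one more
    -- vertex.
    even-case : ∀ j → ∣ S′ ∣ ≡ suc (j + j) → Goal ∣ S ∣ P
    even-case j e = goal-even {P = P} (suc j) (trans S-size′ (trans (cong suc e) (cong suc (sym (+-suc j j)))))
      (≤-from-slack 0 (+-mono-≤ (proj₂ goal′ j e) Q≤) (trans (cong (λ z → 3 * z + 12 + _ + 0) wiener-drop) (eq P′ Q j)))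
      where
      Q≤ : 6 * Q ≤ 6 * (suc j * suc j)
      Q≤ = *-monoʳ-≤ 6 (≤-trans status-2 (≤-reflexive (trans (cong W₂ e) (W₂-odd j))))
      eq : ∀ p q j → 3 * (p + 2 * q) + 12 + (4 * (j * (j * j)) + 6 * (j * j) + 14 * j + 6 * (suc j * suc j)) + 0
           ≡ 4 * (suc j * (suc j * suc j)) + 14 * suc j + (3 * p + 6 * q)
      eq = solve-∀

    -- From 2k to 2k + 1 vertices the bound allows only k² + 2, whereas `W₂` at 2k is k² + k. So one
    -- more vertex on level 2 is wanted, and k² + 2 is what `W₂₃` then yields for k ≥ 3.
    odd-case : ∀ k → ∣ S′ ∣ ≡ k + k → Q ≤ k * k + 2 → Goal ∣ S ∣ P
    odd-case k e h = goal-odd {P = P} k (trans S-size′ (cong suc e))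
      (≤-from-slack 0 (+-mono-≤ (proj₁ goal′ k e) 6Q≤) (trans (cong (λ z → 3 * z + _ + 0) wiener-drop) (eq P′ Q k)))
      where
      6Q≤ : 6 * Q ≤ 6 * (k * k + 2)
      6Q≤ = *-monoʳ-≤ 6 h
      eq : ∀ p q k → 3 * (p + 2 * q) + (4 * (k * (k * k)) + 14 * k + 6 * (k * k + 2)) + 0
           ≡ 4 * (k * (k * k)) + 6 * (k * k) + 14 * k + (3 * p + 12 + 6 * q)
      eq = solve-∀

    -- Levels 1 and 2 around v have two vertices each: the chain v, {a, c}, {b, b′}.
    module Chain (k₀ : ℕ) (e : ∣ S′ ∣ ≡ (3 + k₀) + (3 + k₀)) {b b′} (b≢b′ : b ≢ b′) (bS : b ∈ S) (b′S : b′ ∈ S) (vb : d v b ≡ 2) (vb′ : d v b′ ≡ 2)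
                 (only-b : ∀ {x} → x ∈ S → d v x ≡ 2 → x ≡ b ⊎ x ≡ b′) where
      private
        aS′ : a ∈ S′
        aS′ = ⊆S′ (Cut.a∈ K) (λ { refl → adj-≢ va refl })
        cS′ : c ∈ S′
        cS′ = ⊆S′ (Cut.c∈ K) (λ { refl → adj-≢ vc refl })
        a≢ : ∀ {x} → d v x ≡ 2 → a ≢ x
        a≢ h refl = case trans (sym va) h of λ ()
        c≢ : ∀ {x} → d v x ≡ 2 → c ≢ x
        c≢ h refl = case trans (sym vc) h of λ ()
        v≢ : ∀ {x} → d v x ≡ 2 → x ≢ v
        v≢ h refl = case trans (sym (d-refl v)) h of λ ()
        a≢c = Cut.a≢c K

        A₂? : ∀ x → Dec (x ≡ a)
        A₂? x = x ≟F a
        C₂? : ∀ x → Dec (x ∈ S′ × x ≢ a × x ≢ b × x ≢ b′)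
        C₂? x = (x ∈? S′) ×-dec (¬? (x ≟F a) ×-dec (¬? (x ≟F b) ×-dec ¬? (x ≟F b′)))
        A₂ C₂ : Sub N
        A₂ = ⟦ A₂? ⟧
        C₂ = ⟦ C₂? ⟧
        A₂∈ : ∀ {x} → x ∈ A₂ → x ≡ a
        A₂∈ {x} = dec-true⁻ (A₂? x)
        C₂∈ : ∀ {x} → x ∈ C₂ → x ∈ S′ × x ≢ a × x ≢ b × x ≢ b′
        C₂∈ {x} = dec-true⁻ (C₂? x)

        nbr-a : ∀ {x} → x ∈ S′ → d a x ≡ 1 → x ≡ b ⊎ x ≡ b′
        nbr-a {x} xS′ ax = only-b (S′⊆ xS′) (at (d v x) refl)
          where
          at : ∀ k → d v x ≡ k → d v x ≡ 2
          at 0 h = ⊥-elim (v∉S′ (subst (_∈ S′) (sym (d-zero h)) xS′))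
          at 1 h = ⊥-elim (bip v ax (trans (trans (d-sym a v) va) (sym (trans (d-sym x v) h))))
          at 2 h = h
          at (suc (suc (suc k))) h = ⊥-elim (<⇒≱ (s≤s (s≤s (s≤s z≤n))) (≤-trans (≤-reflexive (sym h)) (≤-trans (d-tri v a x) (≤-reflexive (cong₂ _+_ va ax)))))

        -- Once v is gone, all neighbours of a are on level 2 around v, so b and b′ cut off a.
        K₂ : Cut d S′ b b′ A₂ C₂
        K₂ = record
          { a∈ = ⊆S′ bS (v≢ vb) ; c∈ = ⊆S′ b′S (v≢ vb′) ; a≢c = b≢b′
          ; A⊆ = λ p → subst (_∈ S′) (sym (A₂∈ p)) aS′ ; C⊆ = proj₁ ∘ C₂∈
          ; part = part₂
          ; disj = λ p q → proj₁ (proj₂ (C₂∈ q)) (A₂∈ p)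
          ; a∉A = λ p → a≢ vb (sym (A₂∈ p)) ; a∉C = λ p → proj₁ (proj₂ (proj₂ (C₂∈ p))) refl
          ; c∉A = λ p → a≢ vb′ (sym (A₂∈ p)) ; c∉C = λ p → proj₂ (proj₂ (proj₂ (C₂∈ p))) refl
          ; noE = λ p q ax → [ proj₁ (proj₂ (proj₂ (C₂∈ q))) , proj₂ (proj₂ (proj₂ (C₂∈ q))) ]′
                    (nbr-a (proj₁ (C₂∈ q)) (subst (λ z → d z _ ≡ 1) (A₂∈ p) ax))
          ; A-in = a , dec-true (A₂? a) refl
          ; C-in = c , dec-true (C₂? c) (cS′ , a≢c ∘ sym , c≢ vb , c≢ vb′) }
          where
          part₂ : ∀ {x} → x ∈ S′ → x ∈ A₂ ⊎ x ∈ C₂ ⊎ x ≡ b ⊎ x ≡ b′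
          part₂ {x} p = split (x ≟F a) (x ≟F b) (x ≟F b′)
            where
            split : Dec (x ≡ a) → Dec (x ≡ b) → Dec (x ≡ b′) → x ∈ A₂ ⊎ x ∈ C₂ ⊎ x ≡ b ⊎ x ≡ b′
            split (yes q) _ _ = inj₁ (dec-true (A₂? x) q)
            split _ (yes q) _ = inj₂ (inj₂ (inj₁ q))
            split _ _ (yes q) = inj₂ (inj₂ (inj₂ q))
            split (no n₁) (no n₂) (no n₃) = inj₂ (inj₁ (dec-true (C₂? x) (p , n₁ , n₂ , n₃)))

        aA₂ : a ∈ A₂
        aA₂ = dec-true (A₂? a) refl

        size₂ : ∣ S′ ∣ ≡ 1 + ∣ C₂ ∣ + 2
        size₂ = trans (S-size K₂) (cong (λ z → z + ∣ C₂ ∣ + 2)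
          (card-single A₂ aA₂ (λ {x} → A₂∈ {x})))

        big₂ : 2 ≤ ∣ C₂ ∣
        big₂ = +-cancelʳ-≤ 3 2 ∣ C₂ ∣ (≤-trans (≤-trans (m≤m+n 5 (suc (k₀ + k₀))) (≤-reflexive (eq k₀))) (≤-reflexive (trans (sym e) (trans size₂ (r ∣ C₂ ∣)))))
          where
          eq : ∀ k → 5 + suc (k + k) ≡ (3 + k) + (3 + k)
          eq = solve-∀
          r : ∀ c → 1 + c + 2 ≡ c + 3
          r = solve-∀

        module D₂ = Drop surf tight′ K₂ aA₂ A₂∈ big₂
        module Pt = Punctured surf aS′ D₂.S′ D₂.S′⊆ D₂.⊆S′

        ab : d a b ≡ 1
        ab = D₂.va
        ab′ : d a b′ ≡ 1
        ab′ = D₂.vc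

        near : ∀ {y} → y ∈ S → d v y ≡ 3 → d a y ≤ 2
        near {y} yS h with Surf.geo G yS (Cut.A⊆ K vA) (λ { refl → case trans (sym (d-refl v)) h of λ () })
        ... | w , wS , yw , s with only-b wS (trans (d-sym v w) (suc-injective (trans s (trans (d-sym y v) h))))
        ...   | inj₁ refl = ≤-trans (d-tri a w y) (≤-reflexive (cong₂ _+_ ab (trans (d-sym w y) yw)))
        ...   | inj₂ refl = ≤-trans (d-tri a w y) (≤-reflexive (cong₂ _+_ ab′ (trans (d-sym w y) yw)))

        exact : ∀ {y} → y ∈ S → d v y ≡ 3 → d a y ≡ 2
        exact {y} yS h = ≤-antisym (near yS h) (≤-pred (≤-trans (≤-reflexive (sym h)) (≤-trans (d-tri v a y) (≤-reflexive (cong (_+ d a y) va)))))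

        ac : d a c ≡ 2
        ac = at (d a c) refl
          where
          at : ∀ k → d a c ≡ k → d a c ≡ 2
          at 0 h = ⊥-elim (a≢c (d-zero h))
          at 1 h = ⊥-elim (nonadj h)
          at 2 h = h
          at (suc (suc (suc k))) h = ⊥-elim (<⇒≱ (s≤s (s≤s (s≤s z≤n))) (≤-trans (≤-reflexive (sym h))
            (≤-trans (d-tri a v c) (≤-reflexive (cong₂ _+_ (trans (d-sym a v) va) vc)))))

        -- Around a, level 2 contains c and all vertices at distance 3 from v. There are at least
        -- two of the latter, because a vertex beyond distance 2 from a is beyond distance 3 from v.
        wide : Far-from S′ a 2 → 3 ≤ ∣ Lev S′ (d a) 2 ∣
        wide (x , xS′ , far) with card-two (Lev S (d v) 3) (lev-S (x , S′⊆ xS′ , deep (d v x) refl))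
          where
          deep : ∀ k → d v x ≡ k → 3 < d v x
          deep 0 h = ⊥-elim (v∉S′ (subst (_∈ S′) (sym (d-zero h)) xS′))
          deep 1 h = ⊥-elim (<⇒≱ far (≤-trans (d-tri a v x) (≤-reflexive (cong₂ _+_ (trans (d-sym a v) va) h))))
          deep 2 h with only-b (S′⊆ xS′) h
          ... | inj₁ refl = ⊥-elim (<⇒≱ far (≤-trans (≤-reflexive ab) (s≤s z≤n)))
          ... | inj₂ refl = ⊥-elim (<⇒≱ far (≤-trans (≤-reflexive ab′) (s≤s z≤n)))
          deep 3 h = ⊥-elim (<⇒≱ far (near (S′⊆ xS′) h))
          deep (suc (suc (suc (suc k)))) h = subst (3 <_) (sym h) (s≤s (s≤s (s≤s (s≤s z≤n))))
        ... | y , z , yL , zL , y≢z =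
          card-≥3 (Lev S′ (d a) 2) (∈Lev S′ (d a) 2 cS′ ac) (put yL) (put zL) (c≢₃ yL) (c≢₃ zL) y≢z
          where
          put : ∀ {y} → y ∈ Lev S (d v) 3 → y ∈ Lev S′ (d a) 2
          put p = case Lev∈ S (d v) 3 p of λ where
            (yS , h) → ∈Lev S′ (d a) 2 (⊆S′ yS (λ { refl → case trans (sym (d-refl v)) h of λ () })) (exact yS h)
          c≢₃ : ∀ {y} → y ∈ Lev S (d v) 3 → c ≢ y
          c≢₃ p refl = case trans (sym vc) (proj₂ (Lev∈ S (d v) 3 p)) of λ ()

        size₃ : ∣ D₂.S′ ∣ ≡ suc ((2 + k₀) + (2 + k₀))
        size₃ = suc-injective (trans (sym D₂.S-size′) (trans e (eq k₀)))
          where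
          eq : ∀ k → (3 + k) + (3 + k) ≡ suc (suc ((2 + k) + (2 + k)))
          eq = solve-∀

        goal″ : Goal ∣ D₂.S′ ∣ (wiener d D₂.S′)
        goal″ = ih D₂.S′ _ D₂.surf D₂.tight′ (≤-trans (m≤m+n 4 (suc (k₀ + k₀))) (≤-reflexive (trans (eq k₀) (sym size₃))))
                   (<-trans (≤-reflexive (sym D₂.S-size′)) (≤-reflexive (sym S-size′)))
          where
          eq : ∀ k → 4 + suc (k + k) ≡ suc ((2 + k) + (2 + k))
          eq = solve-∀

        Q′ = status D₂.S′ a

        Q≤ : Q ≤ (3 + k₀) * (3 + k₀) + (3 + k₀)
        Q≤ = ≤-trans status-2 (≤-reflexive (trans (cong W₂ e) (W₂-even (3 + k₀))))

        Q′≤ : Q′ ≤ (5 + (k₀ + k₀)) + ((3 + (k₀ + k₀)) + (k₀ * k₀ + k₀))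
        Q′≤ = ≤-trans (Pt.status-232 wide) (≤-reflexive (trans (cong W₂₃ (trans size₃ (eq k₀)))
                (cong (λ z → (5 + (k₀ + k₀)) + ((3 + (k₀ + k₀)) + z)) (W₂-even k₀))))
          where
          eq : ∀ k → suc ((2 + k) + (2 + k)) ≡ 5 + (k + k)
          eq = solve-∀

      -- The estimate of `Q` exceeds the allowance of `odd-case` by k₀ + 1, and that of `Q′` stays
      -- below the allowance of `even-case` by the same amount, so the two deletions together fit
      -- exactly.
      goal : Goal ∣ S ∣ P
      goal = goal-odd {P = P} (3 + k₀) (trans S-size′ (cong suc e))
        (≤-from-slack 0 (+-mono-≤ (+-mono-≤ (proj₂ goal″ (2 + k₀) size₃) 6Q≤) 6Q′≤)
          (trans (cong (λ z → 3 * z + _ + 0) (trans wiener-drop (cong (_+ 2 * Q) D₂.wiener-drop))) (eq (wiener d D₂.S′) Q Q′ k₀)))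
        where
        6Q≤ : 6 * Q ≤ 6 * ((3 + k₀) * (3 + k₀) + (3 + k₀))
        6Q≤ = *-monoʳ-≤ 6 Q≤
        6Q′≤ : 6 * Q′ ≤ 6 * ((5 + (k₀ + k₀)) + ((3 + (k₀ + k₀)) + (k₀ * k₀ + k₀)))
        6Q′≤ = *-monoʳ-≤ 6 Q′≤
        eq : ∀ p q r k → 3 * (p + 2 * r + 2 * q) + (4 * ((2 + k) * ((2 + k) * (2 + k))) + 6 * ((2 + k) * (2 + k)) + 14 * (2 + k) +
               6 * ((3 + k) * (3 + k) + (3 + k)) + 6 * ((5 + (k + k)) + ((3 + (k + k)) + (k * k + k)))) + 0
             ≡ 4 * ((3 + k) * ((3 + k) * (3 + k))) + 6 * ((3 + k) * (3 + k)) + 14 * (3 + k) + (3 * p + 6 * q + 6 * r)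
        eq = solve-∀

    W₂₃-even : ∀ j → W₂₃ ((2 + j) + (2 + j)) ≤ (2 + j) * (2 + j) + 2
    W₂₃-even zero = ≤-refl
    W₂₃-even (suc i) = ≤-reflexive (trans (cong W₂₃ (r i)) (trans (cong (λ z → (6 + (i + i)) + ((4 + (i + i)) + z)) (W₂-odd i)) (eq i)))
      where
      r : ∀ i → (3 + i) + (3 + i) ≡ 6 + (i + i)
      r = solve-∀
      eq : ∀ i → (6 + (i + i)) + ((4 + (i + i)) + suc i * suc i) ≡ (3 + i) * (3 + i) + 2
      eq = solve-∀

    degree-2 : Goal ∣ S ∣ P
    degree-2 with parity ∣ S′ ∣
    ... | inj₂ (j , e) = even-case j e
    ... | inj₁ (0 , e) = ⊥-elim (<⇒≱ (s≤s z≤n) (subst (4 ≤_) e 4≤S′))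
    ... | inj₁ (1 , e) = ⊥-elim (<⇒≱ (s≤s (s≤s (s≤s z≤n))) (subst (4 ≤_) e 4≤S′))
    ... | inj₁ (suc (suc j) , e) with far? S v 2 | 3 ≤? ∣ Lev S (d v) 2 ∣
    ...   | no none | _ = odd-case (2 + j) e (≤-trans (status-232 (⊥-elim ∘ none)) (≤-trans (≤-reflexive (cong W₂₃ e)) (W₂₃-even j)))
    ...   | yes _ | yes three = odd-case (2 + j) e (≤-trans (status-232 (λ _ → three)) (≤-trans (≤-reflexive (cong W₂₃ e)) (W₂₃-even j)))
    -- For k = 2 the two values k² + k and k² + 2 coincide.
    degree-2 | inj₁ (suc (suc zero) , e) | yes _ | no _ = odd-case 2 e (≤-trans status-2 (≤-reflexive (cong W₂ e)))
    degree-2 | inj₁ (suc (suc (suc k₀)) , e) | yes beyond | no ¬three with card-two (Lev S (d v) 2) (lev-S beyond)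
    ...   | b , b′ , bL , b′L , ne = Chain.goal k₀ e ne (proj₁ (lv bL)) (proj₁ (lv b′L)) (proj₂ (lv bL)) (proj₂ (lv b′L)) only-b
      where
      lv : ∀ {x} → x ∈ Lev S (d v) 2 → x ∈ S × d v x ≡ 2
      lv = Lev∈ S (d v) 2
      only-b : ∀ {x} → x ∈ S → d v x ≡ 2 → x ≡ b ⊎ x ≡ b′
      only-b {x} xS h with x ≟F b | x ≟F b′
      ... | yes p | _ = inj₁ p
      ... | no _ | yes p = inj₂ p
      ... | no n₁ | no n₂ = ⊥-elim (¬three (card-≥3 (Lev S (d v) 2) (∈Lev S (d v) 2 xS h) bL b′L n₁ n₂ ne))

-- The induction

module Induction {N} {d : Fin N → Fin N → ℕ} (M : Metric d) (bip : Bip d) where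
  open Metric M
  open Sizes M bip
  open Status M bip

  -- The distances from x to a piece, of which m is the nearer and o the farther pole.
  module Row {S nx} (G : Surf d S nx) {C : Sub N} {m o : Fin N} (mS : m ∈ S)
             (C⊆ : ∀ {y} → y ∈ C → y ∈ S) (⊆C : ∀ {y} → y ∈ S → y ≢ m → y ≢ o → y ∈ C)
             (x : Fin N) (away : ∀ {y} → y ∈ C → d x m < d x y) where
    open Surface M G

    ρ : Fin N → ℕ
    ρ y = d x y ∸ d x m

    private
      lift : ∀ {y k} → d x y ≡ d x m + suc k → ρ y ≡ suc k
      lift {y} {k} e = trans (cong (_∸ d x m) e) (m+n∸m≡n (d x m) (suc k))

      -- `level-2` is applied inside the piece although x may lie outside it: distances from x are
      -- still Lipschitz there, and m starts the levels.
      level : ∀ k {y} → y ∈ C → suc k < ρ y → 2 ≤ ∣ Lev S (d x) (d x m + suc k) ∣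
      level k {y} yC far = level-2 (d x) (d-lip x) (d x m + suc k) mS (m<m+n (d x m) (s≤s z≤n)) (C⊆ yC)
        (≤-trans (≤-reflexive (sym (+-suc (d x m) (suc k)))) (≤-trans (+-monoʳ-≤ (d x m) far) (≤-reflexive (m+[n∸m]≡n (<⇒≤ (away yC))))))

      not-m : ∀ {y k} → d x y ≡ d x m + suc k → y ≢ m
      not-m {k = k} e refl = <⇒≢ (m<m+n (d x m) (s≤s z≤n)) e

      into : ∀ {y k} → y ∈ Lev S (d x) (d x m + suc k) → y ≢ o → y ∈ Lev C ρ (suc k)
      into {y} {k} p ne = case Lev∈ S (d x) (d x m + suc k) p of λ where
        (yS , e) → ∈Lev C ρ (suc k) (⊆C yS (not-m e) ne) (lift e)

      two : ∀ k → d x o ≢ d x m + suc k → Profile.Wide C ρ 2 (suc k)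
      two k ne y yC far = ≤-trans (level k yC far)
        (card-mono {S = Lev S (d x) (d x m + suc k)} {T = Lev C ρ (suc k)} (λ z p → into p (λ { refl → ne (proj₂ (Lev∈ S (d x) (d x m + suc k) p)) })))

      -- The farther pole o may be one of the two vertices on its level, and it does not count for
      -- C.
      one : ∀ k → Profile.Wide C ρ 1 (suc k)
      one k y yC far with card-two (Lev S (d x) (d x m + suc k)) (level k yC far)
      ... | z , w , zL , wL , ne with z ≟F o
      ...   | no n = card-≥1 (Lev C ρ (suc k)) (into zL n)
      ...   | yes refl = card-≥1 (Lev C ρ (suc k)) (into wL (ne ∘ sym))

    total : ∑ (λ y → 𝟙 (C y) * d x y) ≡ ∣ C ∣ * d x m + ∑ (λ y → 𝟙 (C y) * ρ y)
    total = begin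
      ∑ (λ y → 𝟙 (C y) * d x y)                            ≡⟨ ∑-cong pt ⟩
      ∑ (λ y → d x m * 𝟙 (C y) + 𝟙 (C y) * ρ y)            ≡⟨ ∑-+ (λ y → d x m * 𝟙 (C y)) (λ y → 𝟙 (C y) * ρ y) ⟩
      ∑ (λ y → d x m * 𝟙 (C y)) + ∑ (λ y → 𝟙 (C y) * ρ y)  ≡⟨ cong (_+ ∑ (λ y → 𝟙 (C y) * ρ y)) (trans (∑-* (d x m) (𝟙 ∘ C)) (*-comm (d x m) ∣ C ∣)) ⟩
      ∣ C ∣ * d x m + ∑ (λ y → 𝟙 (C y) * ρ y)              ∎
      where
      open ≡-Reasoning
      arith : ∀ p q → p + q + 0 ≡ p * 1 + (q + 0)
      arith = solve-∀
      pt : ∀ y → 𝟙 (C y) * d x y ≡ d x m * 𝟙 (C y) + 𝟙 (C y) * ρ y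
      pt y with y ∈? C
      ... | no n rewrite ¬true n = sym (trans (+-identityʳ (d x m * 0)) (*-zeroʳ (d x m)))
      ... | yes yC rewrite yC = trans (cong (_+ 0) (sym (m+[n∸m]≡n (<⇒≤ (away yC))))) (arith (d x m) (ρ y))

    balanced : d x o ≡ d x m → ∑ (λ y → 𝟙 (C y) * ρ y) ≤ W₂ ∣ C ∣
    balanced e = Profile.total-2 C ρ (λ k → two k (λ f → <⇒≢ (m<m+n (d x m) (s≤s z≤n)) (trans (sym e) f)))

    unbalanced : d x m ≤ d x o → d x o ≢ d x m → ∑ (λ y → 𝟙 (C y) * ρ y) ≤ W₁ ∣ C ∣
    unbalanced le ne = Profile.total-1 C ρ k₀ (one k₀) (λ k k≢k₀ → two k (λ e → k≢k₀ (suc-injective (+-cancelˡ-≡ (d x m) _ _ (trans (sym e) gap)))))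
      where
      k₀ = d x o ∸ d x m ∸ 1
      gap : d x o ≡ d x m + suc k₀
      gap = trans (sym (m+[n∸m]≡n le)) (cong (d x m +_) (sym (suc[n∸1] (m<n⇒0<n∸m (≤∧≢⇒< le (ne ∘ sym))))))
        where
        suc[n∸1] : ∀ {n} → 0 < n → suc (n ∸ 1) ≡ n
        suc[n∸1] {suc n} _ = refl

  module Wide {S nx} (G : Surf d S nx) (tight : 4 * ∣ S ∣ ≡ degrees S + 8) (5≤ : 5 ≤ ∣ S ∣) (ih : IH ∣ S ∣)
              (bad : ¬ Goal ∣ S ∣ (wiener d S)) where
    open Surface M G
    open Pieces M bip G

    no-single : ∀ {a c A C} → Cut d S a c A C → ∣ A ∣ ≤ 1 → ⊥
    no-single {A = A} K le = bad (Degree2.degree-2 G tight 5≤ ih K (proj₂ (Cut.A-in K)) only)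
      where
      only : Single (proj₁ (Cut.A-in K)) A
      only {x} xA with x ≟F proj₁ (Cut.A-in K)
      ... | yes e = e
      ... | no ne = ⊥-elim (<⇒≱ (card-≥2 A xA (proj₂ (Cut.A-in K)) ne) le)

    -- An inner level has at least two vertices; if it has no third, these two are the poles of a
    -- cut, since no edge jumps over a level.
    level-cut : ∀ δ → Lip δ → ∀ i {u v} → u ∈ S → δ u < i → v ∈ S → i < δ v → ¬ (3 ≤ ∣ Lev S δ i ∣) →
                ∃ λ y → ∃ λ y′ → Cut d S y y′ (Far S δ i) ⟦ (λ x → (x ∈? S) ×-dec (δ x <? i)) ⟧
    level-cut δ lip i {u} {v} uS u< vS >v few with card-two (Lev S δ i) (level-2 δ lip i uS u< vS >v)
    ... | y , y′ , yL , y′L , ne = y , y′ , record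
      { a∈ = proj₁ (lv yL) ; c∈ = proj₁ (lv y′L) ; a≢c = ne
      ; A⊆ = proj₁ ∘ fr ; C⊆ = proj₁ ∘ nr
      ; part = part
      ; disj = λ p q → <-asym (proj₂ (fr p)) (proj₂ (nr q))
      ; a∉A = λ p → <-irrefl (sym (proj₂ (lv yL))) (proj₂ (fr p)) ; a∉C = λ p → <-irrefl (proj₂ (lv yL)) (proj₂ (nr p))
      ; c∉A = λ p → <-irrefl (sym (proj₂ (lv y′L))) (proj₂ (fr p)) ; c∉C = λ p → <-irrefl (proj₂ (lv y′L)) (proj₂ (nr p))
      ; noE = λ p q e → <⇒≱ (proj₂ (fr p)) (≤-trans (lip (dart (proj₁ (fr p)) (proj₁ (nr q)) e)) (proj₂ (nr q)))
      ; A-in = v , ∈Far S δ i vS >v ; C-in = u , dec-true ((u ∈? S) ×-dec (δ u <? i)) (uS , u<) }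
      where
      lv : ∀ {x} → x ∈ Lev S δ i → x ∈ S × δ x ≡ i
      lv = Lev∈ S δ i
      fr : ∀ {x} → x ∈ Far S δ i → x ∈ S × i < δ x
      fr = Far∈ S δ i
      nr : ∀ {x} → x ∈ ⟦ (λ x → (x ∈? S) ×-dec (δ x <? i)) ⟧ → x ∈ S × δ x < i
      nr {x} = dec-true⁻ ((x ∈? S) ×-dec (δ x <? i))
      part : ∀ {x} → x ∈ S → x ∈ Far S δ i ⊎ x ∈ ⟦ (λ x → (x ∈? S) ×-dec (δ x <? i)) ⟧ ⊎ x ≡ y ⊎ x ≡ y′
      part {x} xS with <-cmp (δ x) i
      ... | tri< l _ _ = inj₂ (inj₁ (dec-true ((x ∈? S) ×-dec (δ x <? i)) (xS , l)))
      ... | tri> _ _ g = inj₁ (∈Far S δ i xS g)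
      ... | tri≈ _ e _ with x ≟F y | x ≟F y′
      ...   | yes p | _ = inj₂ (inj₂ (inj₁ p))
      ...   | no _ | yes p = inj₂ (inj₂ (inj₂ p))
      ...   | no n₁ | no n₂ = ⊥-elim (few (card-≥3 (Lev S δ i) (∈Lev S δ i xS e) yL y′L n₁ n₂ ne))

    -- Minimality of A takes the form of an induction on a bound for its size: within `Step` all
    -- cuts with a smaller first side are already refuted.
    NoCut≤ : ℕ → Set
    NoCut≤ f = ∀ {a c A C} → Cut d S a c A C → ∣ A ∣ ≤ f → ⊥

    module Step {f} (rec : NoCut≤ f) {a c A C} (K : Cut d S a c A C) (le : ∣ A ∣ ≤ suc f) (2≤s : 2 ≤ ∣ A ∣) (2≤t : 2 ≤ ∣ C ∣)
                {p₁ p₂ q₁ q₂} (X : Cross d S nx a c A C p₁ p₂ q₁ q₂) where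
      open Cut K
      private
        K′ = swap-sides M K

        smaller : ∀ {a c A′ C′} → Cut d S a c A′ C′ → ∣ A′ ∣ < ∣ A ∣ → ⊥
        smaller L l = rec L (≤-pred (≤-trans l le))

        X′ = flip-cross X

      open Cross X

      private
        distinct : ∀ {B : Sub N} {z} → 2 ≤ ∣ B ∣ → (∀ {y} → y ∈ B → y ≡ z) → ⊥
        distinct {B} h all with card-two B h
        ... | x , y , xB , yB , ne = ne (trans (all xB) (sym (all yB)))

        q₁≢q₂ : q₁ ≢ q₂
        q₁≢q₂ e = distinct 2≤t (only-q K X e)

        p₂≢p₁ : p₂ ≢ p₁
        p₂≢p₁ e = distinct 2≤s (only-q K′ X′ e)

        SA = Piece a c A
        SC = Piece a c C

        GA : Surf d SA (nx′ K′ X′)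
        GA = piece K′ X′ p₂≢p₁
        GC : Surf d SC (nx′ K X)
        GC = piece K X q₁≢q₂

        goal-A : Goal (∣ A ∣ + 2) (wiener d SA)
        goal-A = subst (λ k → Goal k (wiener d SA)) (Piece-size K′)
          (ih SA _ GA (piece-tight G tight K′ X′) (≤-trans (+-monoˡ-≤ 2 2≤s) (≤-reflexive (sym (Piece-size K′))))
             (subst₂ _<_ (sym (Piece-size K′)) (sym (S-size K)) (+-monoˡ-< 2 (m<m+n ∣ A ∣ (≤-trans (s≤s z≤n) 2≤t)))))

        goal-C : Goal (∣ C ∣ + 2) (wiener d SC)
        goal-C = subst (λ k → Goal k (wiener d SC)) (Piece-size K)
          (ih SC _ GC (piece-tight G tight K X) (≤-trans (+-monoˡ-≤ 2 2≤t) (≤-reflexive (sym (Piece-size K))))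
             (subst₂ _<_ (sym (Piece-size K)) (sym (S-size K)) (+-monoˡ-< 2 (m<n+m ∣ C ∣ (≤-trans (s≤s z≤n) 2≤s)))))

        μ : Fin N → ℕ
        μ x = d x a ℕ.⊓ d x c

        -- Extended by 0 to C, the distance to the nearer pole is Lipschitz on all of S, and a
        -- positive inner level with two vertices would cut off a proper subset of A.
        ν : Fin N → ℕ
        ν x = if C x then 0 else μ x

        ν-C : ∀ {x} → x ∈ C → ν x ≡ 0
        ν-C h rewrite h = refl
        ν-off : ∀ {x} → ¬ (x ∈ C) → ν x ≡ μ x
        ν-off h rewrite ¬true h = refl
        ν-a : ν a ≡ 0
        ν-a = trans (ν-off a∉C) (cong (ℕ._⊓ d a c) (d-refl a))
        ν-c : ν c ≡ 0
        ν-c = trans (ν-off c∉C) (trans (cong (d c a ℕ.⊓_) (d-refl c)) (⊓-zeroʳ (d c a)))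
        ν-pos : ∀ {x k} → x ∈ S → ν x ≡ suc k → x ∈ A
        ν-pos xS e with part xS
        ... | inj₁ p = p
        ... | inj₂ (inj₁ p) = case trans (sym (ν-C p)) e of λ ()
        ... | inj₂ (inj₂ (inj₁ refl)) = case trans (sym ν-a) e of λ ()
        ... | inj₂ (inj₂ (inj₂ refl)) = case trans (sym ν-c) e of λ ()

        lip-to : ∀ {u v} z → Dart u v → d u z ≤ suc (d v z)
        lip-to {u} {v} z D = subst₂ (λ a b → a ≤ suc b) (d-sym z u) (d-sym z v) (d-lip z D)

        ν-lip : Lip ν
        ν-lip {u} {v} D = go (u ∈? C) (part (Dart.tgt D))
          where
          off : ¬ (u ∈ C) → ¬ (v ∈ C) → ν u ≤ suc (ν v)
          off uC vC = subst₂ (λ x y → x ≤ suc y) (sym (ν-off uC)) (sym (ν-off vC)) (⊓-mono-≤ (lip-to a D) (lip-to c D))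
          go : Dec (u ∈ C) → v ∈ A ⊎ v ∈ C ⊎ v ≡ a ⊎ v ≡ c → ν u ≤ suc (ν v)
          go (yes uC) _ = ≤-trans (≤-reflexive (ν-C uC)) z≤n
          go (no n) (inj₁ vA) = off n (disj vA)
          go (no n) (inj₂ (inj₂ (inj₁ refl))) = off n a∉C
          go (no n) (inj₂ (inj₂ (inj₂ refl))) = off n c∉C
          go (no n) (inj₂ (inj₁ vC)) with part (Dart.src D)
          ... | inj₁ uA = ⊥-elim (noE uA vC (Dart.adj D))
          ... | inj₂ (inj₁ uC) = ⊥-elim (n uC)
          ... | inj₂ (inj₂ (inj₁ refl)) = ≤-trans (≤-reflexive ν-a) z≤n
          ... | inj₂ (inj₂ (inj₂ refl)) = ≤-trans (≤-reflexive ν-c) z≤n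

        L⊆A : ∀ {k y} → y ∈ Lev S ν (suc k) → y ∈ A × μ y ≡ suc k
        L⊆A {k} p = case Lev∈ S ν (suc k) p of λ where
          (yS , e) → ν-pos yS e , trans (sym (ν-off (disj (ν-pos yS e)))) e

        F⊆A : ∀ {k y} → y ∈ Far S ν (suc k) → y ∈ A
        F⊆A {k} {y} p = ν-pos (proj₁ (Far∈ S ν (suc k) p)) (pos (proj₂ (Far∈ S ν (suc k) p)))
          where
          pos : ∀ {m n} → m < n → n ≡ suc (n ∸ 1)
          pos {n = suc n} _ = refl

        level-ν : ∀ k {x} → x ∈ A → suc k < μ x → ¬ (3 ≤ ∣ Lev S ν (suc k) ∣) →
                  ∃ λ y → ∃ λ y′ → Cut d S y y′ (Far S ν (suc k)) ⟦ (λ x → (x ∈? S) ×-dec (ν x <? suc k)) ⟧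
        level-ν k xA far = level-cut ν ν-lip (suc k) a∈ (subst (_< suc k) (sym ν-a) (s≤s z≤n)) (A⊆ xA)
          (subst (suc k <_) (sym (ν-off (disj xA))) far)

        far-smaller : ∀ k {y} → y ∈ A → y ∈ S × ν y ≡ suc k → ∣ Far S ν (suc k) ∣ < ∣ A ∣
        far-smaller k {y} yA (yS , e) = card-< {S = Far S ν (suc k)} {T = A} y (λ z p → F⊆A p) yA
          (λ p → <-irrefl (sym e) (proj₂ (Far∈ S ν (suc k) p)))

        level-3 : ∀ k {x} → x ∈ A → suc k < μ x → Dec (3 ≤ ∣ Lev S ν (suc k) ∣) → 3 ≤ ∣ Lev S ν (suc k) ∣
        level-3 k xA far (yes three) = three
        level-3 k xA far (no few) = narrow (level-ν k xA far few)
          where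
          narrow : (∃ λ y → ∃ λ y′ → Cut d S y y′ (Far S ν (suc k)) ⟦ (λ x → (x ∈? S) ×-dec (ν x <? suc k)) ⟧) → 3 ≤ ∣ Lev S ν (suc k) ∣
          narrow (y , y′ , L) = ⊥-elim (smaller L (far-smaller k (proj₁ (L⊆A y∈)) (Lev∈ S ν (suc k) y∈)))
            where
            y∈ : y ∈ Lev S ν (suc k)
            y∈ = ∈Lev S ν (suc k) (Cut.a∈ L) (≤-antisym
              (≮⇒≥ (λ l → Cut.a∉A L (∈Far S ν (suc k) (Cut.a∈ L) l)))
              (≮⇒≥ (λ l → Cut.a∉C L (dec-true ((y ∈? S) ×-dec (ν y <? suc k)) (Cut.a∈ L , l)))))

        wide-A : ∀ k → Profile.Wide A μ 3 (suc k)
        wide-A k x xA far = ≤-trans (level-3 k xA far (3 ≤? ∣ Lev S ν (suc k) ∣))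
          (card-mono {S = Lev S ν (suc k)} {T = Lev A μ (suc k)} (λ y p → ∈Lev A μ (suc k) (proj₁ (L⊆A p)) (proj₂ (L⊆A p))))

        Y = ∑ (λ x → 𝟙 (A x) * μ x)

        Y≤ : 6 * Y ≤ suc ∣ A ∣ * suc (suc ∣ A ∣)
        Y≤ = ≤-trans (*-monoʳ-≤ 6 (Profile.total-3 A μ wide-A)) (6W₃≤ ∣ A ∣)

        Third? : Dec (∃ λ z → z ∈ S × d p₁ z ≡ 1 × z ≢ a × z ≢ c)
        Third? = any? (λ z → (z ∈? S) ×-dec ((d p₁ z ℕ.≟ 1) ×-dec (¬? (z ≟F a) ×-dec ¬? (z ≟F c))))

        -- Otherwise p₁ alone would form a side of a cut with the same poles, smaller than A.
        third : ∃ λ z → z ∈ S × d p₁ z ≡ 1 × z ≢ a × z ≢ c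
        third with Third?
        ... | yes t = t
        ... | no none = ⊥-elim (smaller cut (≤-trans (s≤s (≤-reflexive one)) 2≤s))
          where
          A₁? : ∀ x → Dec (x ≡ p₁)
          A₁? x = x ≟F p₁
          C₁? : ∀ x → Dec (x ∈ S × x ≢ p₁ × x ≢ a × x ≢ c)
          C₁? x = (x ∈? S) ×-dec (¬? (x ≟F p₁) ×-dec (¬? (x ≟F a) ×-dec ¬? (x ≟F c)))
          A₁∈ : ∀ {x} → x ∈ ⟦ A₁? ⟧ → x ≡ p₁
          A₁∈ {x} = dec-true⁻ (A₁? x)
          C₁∈ : ∀ {x} → x ∈ ⟦ C₁? ⟧ → x ∈ S × x ≢ p₁ × x ≢ a × x ≢ c
          C₁∈ {x} = dec-true⁻ (C₁? x)
          one : ∣ ⟦ A₁? ⟧ ∣ ≡ 1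
          one = card-single ⟦ A₁? ⟧ {p₁} (dec-true (A₁? p₁) refl) (λ {x} → A₁∈ {x})
          cut : Cut d S a c ⟦ A₁? ⟧ ⟦ C₁? ⟧
          cut = record
            { a∈ = a∈ ; c∈ = c∈ ; a≢c = a≢c ; A⊆ = λ p → subst (_∈ S) (sym (A₁∈ p)) (A⊆ p₁∈) ; C⊆ = proj₁ ∘ C₁∈
            ; part = λ {x} p → split p (x ≟F p₁) (x ≟F a) (x ≟F c)
            ; disj = λ p q → proj₁ (proj₂ (C₁∈ q)) (A₁∈ p)
            ; a∉A = λ p → a∉A (subst (_∈ A) (sym (A₁∈ p)) p₁∈) ; a∉C = λ p → proj₁ (proj₂ (proj₂ (C₁∈ p))) refl
            ; c∉A = λ p → c∉A (subst (_∈ A) (sym (A₁∈ p)) p₁∈) ; c∉C = λ p → proj₂ (proj₂ (proj₂ (C₁∈ p))) refl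
            ; noE = λ {x} {y} p q e → none (y , proj₁ (C₁∈ q) , subst (λ z → d z y ≡ 1) (A₁∈ p) e , proj₂ (proj₂ (C₁∈ q)))
            ; A-in = p₁ , dec-true (A₁? p₁) refl
            ; C-in = _ , dec-true (C₁? _) (C⊆ q₁∈ , (λ e → disj p₁∈ (subst (_∈ C) e q₁∈)) , (λ e → a∉C (subst (_∈ C) e q₁∈)) , (λ e → c∉C (subst (_∈ C) e q₁∈))) }
            where
            split : ∀ {x} → x ∈ S → Dec (x ≡ p₁) → Dec (x ≡ a) → Dec (x ≡ c) → x ∈ ⟦ A₁? ⟧ ⊎ x ∈ ⟦ C₁? ⟧ ⊎ x ≡ a ⊎ x ≡ c
            split {x} p (yes q) _ _ = inj₁ (dec-true (A₁? x) q)
            split p _ (yes q) _ = inj₂ (inj₂ (inj₁ q))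
            split p _ _ (yes q) = inj₂ (inj₂ (inj₂ q))
            split {x} p (no n₁) (no n₂) (no n₃) = inj₂ (inj₁ (dec-true (C₁? x) (p , n₁ , n₂ , n₃)))

        z = proj₁ third
        p₁z = proj₁ (proj₂ (proj₂ third))
        zA : z ∈ A
        zA with part (proj₁ (proj₂ third))
        ... | inj₁ q = q
        ... | inj₂ (inj₁ q) = ⊥-elim (noE p₁∈ q p₁z)
        ... | inj₂ (inj₂ (inj₁ q)) = ⊥-elim (proj₁ (proj₂ (proj₂ (proj₂ third))) q)
        ... | inj₂ (inj₂ (inj₂ q)) = ⊥-elim (proj₂ (proj₂ (proj₂ (proj₂ third))) q)

        two-away : ∀ {x y w} → d x y ≡ 1 → d x w ≡ 1 → y ≢ w → d y w ≡ 2
        two-away {x} {y} {w} xy xw y≢w = at (d y w) refl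
          where
          at : ∀ k → d y w ≡ k → d y w ≡ 2
          at 0 e = ⊥-elim (y≢w (d-zero e))
          at 1 e = ⊥-elim (bip w xy (trans xw (sym e)))
          at 2 e = e
          at (suc (suc (suc k))) e = ⊥-elim (<⇒≱ (s≤s (s≤s (s≤s z≤n))) (≤-trans (≤-reflexive (sym e))
            (≤-trans (d-tri y x w) (≤-reflexive (cong₂ _+_ (trans (d-sym y x) xy) xw)))))

        p₁c : d p₁ c ≡ 1
        p₁c = trans (d-sym p₁ c) cp₁
        p₂a : d p₂ a ≡ 1
        p₂a = trans (d-sym p₂ a) ap₂
        za : d z a ≡ 2
        za = two-away p₁z p₁a (proj₁ (proj₂ (proj₂ (proj₂ third))))
        zc : d z c ≡ 2
        zc = two-away p₁z p₁c (proj₂ (proj₂ (proj₂ (proj₂ third))))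
        ac : d a c ≡ 2
        ac = two-away p₁a p₁c a≢c

        Bal? : ∀ x → Dec (x ∈ A × d x a ≡ d x c)
        Bal? x = (x ∈? A) ×-dec (d x a ℕ.≟ d x c)
        Unb? : ∀ x → Dec (x ∈ A × d x a ≢ d x c)
        Unb? x = (x ∈? A) ×-dec ¬? (d x a ℕ.≟ d x c)

        bal-unb : ∣ A ∣ ≡ ∣ ⟦ Unb? ⟧ ∣ + ∣ ⟦ Bal? ⟧ ∣
        bal-unb = card-∪ {S = ⟦ Unb? ⟧} {T = ⟦ Bal? ⟧} (λ x → trans (sym (𝟙-≟ (A x)))
          (𝟙-⊎ (x ∈? A) (Unb? x) (Bal? x) (λ p → case d x a ℕ.≟ d x c of λ where
            (yes e) → inj₂ (p , e)
            (no n) → inj₁ (p , n)) proj₁ proj₁ (λ (_ , n) (_ , e) → n e)))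

        -- p₁ and p₂ are adjacent to both poles, and z, as a further neighbour of p₁, has distance 2
        -- to both by bipartiteness.
        three-bal : 3 ≤ ∣ ⟦ Bal? ⟧ ∣
        three-bal = card-≥3 ⟦ Bal? ⟧ {p₁} {p₂} {z}
          (dec-true (Bal? p₁) (p₁∈ , trans p₁a (sym p₁c))) (dec-true (Bal? p₂) (p₂∈ , trans p₂a (sym p₂c)))
          (dec-true (Bal? z) (zA , trans za (sym zc)))
          (p₂≢p₁ ∘ sym) (adj-≢ p₁z) (λ e → case trans (sym p₂a) (subst (λ w → d w a ≡ 2) (sym e) za) of λ ())

        h = ⌊ ∣ C ∣ /2⌋
        t = ∣ C ∣

        through′ : ∀ {x y} → x ∈ A → y ∈ C → μ x < d x y
        through′ {x} {y} xA yC with through K xA (inj₁ yC)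
        ... | inj₁ e = subst (μ x <_) (sym e) (≤-<-trans (m⊓n≤m (d x a) (d x c)) (m<m+n (d x a) (n≢0⇒n>0 (λ q → a∉C (subst (_∈ C) (sym (d-zero q)) yC)))))
        ... | inj₂ e = subst (μ x <_) (sym e) (≤-<-trans (m⊓n≤n (d x a) (d x c)) (m<m+n (d x c) (n≢0⇒n>0 (λ q → c∉C (subst (_∈ C) (sym (d-zero q)) yC)))))

        outside : ∀ {y} → y ∈ SC → y ≢ a → y ≢ c → y ∈ C
        outside p n₁ n₂ with Piece∈ K p
        ... | inj₁ q = q
        ... | inj₂ (inj₁ q) = ⊥-elim (n₁ q)
        ... | inj₂ (inj₂ q) = ⊥-elim (n₂ q)

        row : ∀ {x} → x ∈ A → status C x ≤ t * μ x + W₂ t + 𝟙 (⟦ Unb? ⟧ x) * h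
        row {x} xA = go (d x a ℕ.≟ d x c) (≤-total (d x a) (d x c))
          where
          Bound = status C x ≤ t * μ x + W₂ t + 𝟙 (⟦ Unb? ⟧ x) * h
          from : ∀ {k ρ} u → status C x ≡ t * k + ρ → μ x ≡ k → ρ ≤ W₂ t + u * h → u ≤ 𝟙 (⟦ Unb? ⟧ x) → Bound
          from {k} {ρ} u e e′ le ub = begin
            status C x                                 ≡⟨ e ⟩
            t * k + ρ                                  ≡⟨ cong (λ m → t * m + ρ) (sym e′) ⟩
            t * μ x + ρ                                ≤⟨ +-monoʳ-≤ (t * μ x) (≤-trans le (+-monoʳ-≤ (W₂ t) (*-monoˡ-≤ h ub))) ⟩
            t * μ x + (W₂ t + 𝟙 (⟦ Unb? ⟧ x) * h)      ≡⟨ sym (+-assoc (t * μ x) (W₂ t) _) ⟩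
            t * μ x + W₂ t + 𝟙 (⟦ Unb? ⟧ x) * h        ∎
            where open ≤-Reasoning
          unb : d x a ≢ d x c → 1 ≤ 𝟙 (⟦ Unb? ⟧ x)
          unb ne = ≤-reflexive (sym (𝟙≡1 (dec-true (Unb? x) (xA , ne))))
          W₁≤′ : W₁ t ≤ W₂ t + 1 * h
          W₁≤′ = ≤-trans (W₁≤ t) (≤-reflexive (cong (W₂ t +_) (sym (*-identityˡ h))))
          module Near-a (e : μ x ≡ d x a) = Row GC {C} {a} {c} (∈Piece K (inj₂ (inj₁ refl))) (∈Piece K ∘ inj₁) outside x (λ yC → subst (_< d x _) e (through′ xA yC))
          module Near-c (e : μ x ≡ d x c) = Row GC {C} {c} {a} (∈Piece K (inj₂ (inj₂ refl))) (∈Piece K ∘ inj₁) (λ p n₁ n₂ → outside p n₂ n₁) x (λ yC → subst (_< d x _) e (through′ xA yC))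
          go : Dec (d x a ≡ d x c) → d x a ≤ d x c ⊎ d x c ≤ d x a → Bound
          go (yes e) _ = from 0 (Near-a.total μa) μa (≤-trans (Near-a.balanced μa (sym e)) (m≤m+n (W₂ t) 0)) z≤n
            where
            μa : μ x ≡ d x a
            μa = m≤n⇒m⊓n≡m (≤-reflexive e)
          go (no ne) (inj₁ l) = from 1 (Near-a.total μa) μa (≤-trans (Near-a.unbalanced μa l (ne ∘ sym)) W₁≤′) (unb ne)
            where
            μa : μ x ≡ d x a
            μa = m≤n⇒m⊓n≡m l
          go (no ne) (inj₂ l) = from 1 (Near-c.total μc) μc (≤-trans (Near-c.unbalanced μc l ne) W₁≤′) (unb ne)
            where
            μc : μ x ≡ d x c
            μc = m≥n⇒m⊓n≡n l

        F = form d (𝟙 ∘ A) (𝟙 ∘ C)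

        F≤ : F ≤ t * Y + ∣ A ∣ * W₂ t + ∣ ⟦ Unb? ⟧ ∣ * h
        F≤ = begin
          F                                                                                   ≤⟨ ∑-mono cell ⟩
          ∑ (λ x → (t * (𝟙 (A x) * μ x) + W₂ t * 𝟙 (A x)) + h * 𝟙 (⟦ Unb? ⟧ x))                ≡⟨ ∑-+ (λ x → t * (𝟙 (A x) * μ x) + W₂ t * 𝟙 (A x)) (λ x → h * 𝟙 (⟦ Unb? ⟧ x)) ⟩
          ∑ (λ x → t * (𝟙 (A x) * μ x) + W₂ t * 𝟙 (A x)) + ∑ (λ x → h * 𝟙 (⟦ Unb? ⟧ x))        ≡⟨ cong₂ _+_ (∑-+ (λ x → t * (𝟙 (A x) * μ x)) (λ x → W₂ t * 𝟙 (A x))) (∑-* h (𝟙 ∘ ⟦ Unb? ⟧)) ⟩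
          ∑ (λ x → t * (𝟙 (A x) * μ x)) + ∑ (λ x → W₂ t * 𝟙 (A x)) + h * ∣ ⟦ Unb? ⟧ ∣          ≡⟨ cong₂ _+_ (cong₂ _+_ (∑-* t (λ x → 𝟙 (A x) * μ x)) (trans (∑-* (W₂ t) (𝟙 ∘ A)) (*-comm (W₂ t) ∣ A ∣))) (*-comm h ∣ ⟦ Unb? ⟧ ∣) ⟩
          t * Y + ∣ A ∣ * W₂ t + ∣ ⟦ Unb? ⟧ ∣ * h                                              ∎
          where
          open ≤-Reasoning
          arith : ∀ t m w u h → t * m + w + u * h + 0 ≡ t * (m + 0) + w * 1 + h * u
          arith = solve-∀
          cell : ∀ x → 𝟙 (A x) * status C x ≤ (t * (𝟙 (A x) * μ x) + W₂ t * 𝟙 (A x)) + h * 𝟙 (⟦ Unb? ⟧ x)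
          cell x = go (x ∈? A)
            where
            go : Dec (x ∈ A) → 𝟙 (A x) * status C x ≤ (t * (𝟙 (A x) * μ x) + W₂ t * 𝟙 (A x)) + h * 𝟙 (⟦ Unb? ⟧ x)
            go (no n) = ≤-trans (≤-reflexive (cong (_* status C x) (𝟙≡0 n))) z≤n
            go (yes xA) = ≤-trans (≤-reflexive (cong (_* status C x) (𝟙≡1 xA)))
              (≤-trans (+-monoˡ-≤ 0 (row xA)) (≤-reflexive (trans (arith t (μ x) (W₂ t) (𝟙 (⟦ Unb? ⟧ x)) h)
                (cong (λ b → (t * (b * μ x) + W₂ t * b) + h * 𝟙 (⟦ Unb? ⟧ x)) (sym (𝟙≡1 xA))))))

      impossible : ⊥
      impossible = bad (subst (λ n → Goal n (wiener d S)) (sym (S-size K))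
        (GlueBound.goal (∣ A ∣) t Y F (∣ ⟦ Unb? ⟧ ∣) (wiener d S) (wiener d SA) (wiener d SC)
          (≤-trans three-bal (≤-trans (m≤n+m (∣ ⟦ Bal? ⟧ ∣) (∣ ⟦ Unb? ⟧ ∣)) (≤-reflexive (sym bal-unb)))) 2≤t Y≤ F≤
          (≤-trans (+-monoʳ-≤ ∣ ⟦ Unb? ⟧ ∣ three-bal) (≤-reflexive (sym bal-unb)))
          (trans (cong (λ k → wiener d S + 2 * k) (sym ac)) (glue-dist K)) goal-A goal-C))

    no-cut : ∀ f → NoCut≤ f
    no-cut zero {A = A} K le = <⇒≱ (card-≥1 A (proj₂ (Cut.A-in K))) le
    no-cut (suc f) {A = A} {C} K le with 2 ≤? ∣ A ∣ | 2 ≤? ∣ C ∣ | cross (tight-al G tight) K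
    ... | no s | _ | _ = no-single K (≤-pred (≰⇒> s))
    ... | yes _ | no t | _ = no-single (swap-sides M K) (≤-pred (≰⇒> t))
    ... | yes s | yes t | inj₁ (_ , _ , _ , _ , X) = Step.impossible (no-cut f) K le s t X
    ... | yes _ | yes _ | inj₂ (_ , _ , L , l) = no-cut f L (≤-pred (≤-trans l le))

    wide-level : ∀ {v} → v ∈ S → ∀ k → Far-from S v (suc k) → 3 ≤ ∣ Lev S (d v) (suc k) ∣
    wide-level {v} vS k (x , xS , far) with 3 ≤? ∣ Lev S (d v) (suc k) ∣
    ... | yes p = p
    ... | no few with level-cut (d v) (d-lip v) (suc k) vS (subst (_< suc k) (sym (d-refl v)) (s≤s z≤n)) xS far few
    ...   | _ , _ , K = ⊥-elim (no-cut _ K ≤-refl)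

    -- The neighbours of v are split off because their exact number k is to be kept; the remaining
    -- levels start behind them, and of these only the lower bound 3 is used.
    module Row₃ {v} (vS : v ∈ S) where
      X? : ∀ y → Dec (y ∈ S × 1 < d v y)
      X? y = (y ∈? S) ×-dec (1 <? d v y)
      X : Sub N
      X = ⟦ X? ⟧
      X∈ : ∀ {y} → y ∈ X → y ∈ S × 1 < d v y
      X∈ {y} = dec-true⁻ (X? y)
      δ₁ : Fin N → ℕ
      δ₁ y = d v y ∸ 1
      k = ∣ Lev S (d v) 1 ∣

      pos : ∀ {y} → y ≢ v → 0 < d v y
      pos ne = n≢0⇒n>0 (λ e → ne (sym (d-zero e)))

      size : ∣ S ∖ v ∣ ≡ k + ∣ X ∣
      size = card-∪ {S = Lev S (d v) 1} {T = X} λ y → trans (sym (𝟙-≟ ((S ∖ v) y)))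
        (𝟙-⊎ (y ∈? (S ∖ v)) ((y ∈? S) ×-dec (d v y ℕ.≟ 1)) (X? y)
          (λ p → case ∖-∈⁻ S p of λ (yS , ne) → case d v y ℕ.≟ 1 of λ where
            (yes e) → inj₁ (yS , e)
            (no n) → inj₂ (yS , ≤∧≢⇒< (pos ne) (n ∘ sym)))
          (λ (yS , e) → ∖-∈ S yS (λ { refl → case trans (sym e) (d-refl y) of λ () }))
          (λ (yS , l) → ∖-∈ S yS (λ { refl → <⇒≱ l (≤-trans (≤-reflexive (d-refl y)) z≤n) }))
          (λ (_ , e) (_ , l) → <-irrefl (sym e) l))

      3≤k : 3 ≤ k
      3≤k with far? S v 1
      ... | yes far = wide-level vS 0 far
      ... | no none = ≤-pred (≤-trans (≤-trans (n≤1+n 4) 5≤) (≤-reflexive (trans (card-∖ S vS) (cong suc (trans size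
              (trans (cong (k +_) (card-empty X (λ y p → none (y , X∈ p)))) (+-identityʳ k)))))))

      total : status S v ≡ ∣ S ∖ v ∣ + ∑ (λ y → 𝟙 (X y) * δ₁ y)
      total = trans (∑-cong pt) (∑-+ (𝟙 ∘ (S ∖ v)) (λ y → 𝟙 (X y) * δ₁ y))
        where
        pt : ∀ y → 𝟙 (S y) * d v y ≡ 𝟙 ((S ∖ v) y) + 𝟙 (X y) * δ₁ y
        pt y = go (y ∈? S) (y ≟F v) (1 <? d v y)
          where
          off : ¬ (y ∈ S) ⊎ y ≡ v → ¬ (y ∈ (S ∖ v))
          off (inj₁ n) p = n (proj₁ (∖-∈⁻ S p))
          off (inj₂ e) p = proj₂ (∖-∈⁻ S p) e
          go : Dec (y ∈ S) → Dec (y ≡ v) → Dec (1 < d v y) → 𝟙 (S y) * d v y ≡ 𝟙 ((S ∖ v) y) + 𝟙 (X y) * δ₁ y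
          go (no n) _ _ = trans (cong (_* d v y) (𝟙≡0 n)) (sym (cong₂ (λ a b → a + b * δ₁ y) (𝟙≡0 (off (inj₁ n))) (𝟙≡0 (n ∘ proj₁ ∘ X∈))))
          go (yes yS) (yes refl) _ = trans (trans (cong (𝟙 (S y) *_) (d-refl y)) (*-zeroʳ (𝟙 (S y))))
            (sym (cong₂ (λ a b → a + b * δ₁ y) (𝟙≡0 (off (inj₂ refl))) (𝟙≡0 (λ p → <⇒≱ (proj₂ (X∈ p)) (≤-trans (≤-reflexive (d-refl y)) z≤n)))))
          go (yes yS) (no ne) (yes l) = trans (cong (_* d v y) (𝟙≡1 yS)) (trans (arith (≤-trans (n≤1+n 1) l))
            (sym (cong₂ (λ a b → a + b * δ₁ y) (𝟙≡1 (∖-∈ S yS ne)) (𝟙≡1 (dec-true (X? y) (yS , l))))))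
            where
            arith : ∀ {n} → 1 ≤ n → 1 * n ≡ 1 + 1 * (n ∸ 1)
            arith {suc n} _ = refl
          go (yes yS) (no ne) (no l) = trans (cong₂ _*_ (𝟙≡1 yS) (≤-antisym (≮⇒≥ l) (pos ne)))
            (sym (cong₂ (λ a b → a + b * δ₁ y) (𝟙≡1 (∖-∈ S yS ne)) (𝟙≡0 (l ∘ proj₂ ∘ X∈))))

      wide : ∀ j → Profile.Wide X δ₁ 3 (suc j)
      wide j y yX far = ≤-trans (wide-level vS (suc j) (y , proj₁ (X∈ yX) , up far))
        (card-mono {S = Lev S (d v) (2 + j)} {T = Lev X δ₁ (suc j)} (λ z p → case Lev∈ S (d v) (2 + j) p of λ where
          (zS , e) → ∈Lev X δ₁ (suc j) (dec-true (X? z) (zS , ≤-trans (s≤s (s≤s z≤n)) (≤-reflexive (sym e)))) (cong (_∸ 1) e)))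
        where
        up : ∀ {m n} → m < n ∸ 1 → suc m < n
        up {n = suc n} l = s≤s l

      -- Linear in the degree k, so that it can be summed over all vertices with the degree sum
      -- inserted. The slack is (k - 3) m, where m counts the vertices beyond the neighbours of v.
      row : 6 * status S v + ∣ S ∖ v ∣ * k ≤ 6 * ∣ S ∖ v ∣ + (∣ S ∖ v ∣ * ∣ S ∖ v ∣ + 2)
      row = bound (k ∸ 3) (sym (m+[n∸m]≡n 3≤k))
        where
        R = ∑ (λ y → 𝟙 (X y) * δ₁ y)
        6R≤ : 6 * R ≤ suc ∣ X ∣ * suc (suc ∣ X ∣)
        6R≤ = ≤-trans (*-monoʳ-≤ 6 (Profile.total-3 X δ₁ wide)) (6W₃≤ ∣ X ∣)
        poly : ∀ e m r → 6 * (3 + e + m + r) + (3 + e + m) * (3 + e) + suc m * suc (suc m) + e * m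
               ≡ 6 * (3 + e + m) + ((3 + e + m) * (3 + e + m) + 2) + 6 * r
        poly = solve-∀
        bound : ∀ e → k ≡ 3 + e → 6 * status S v + ∣ S ∖ v ∣ * k ≤ 6 * ∣ S ∖ v ∣ + (∣ S ∖ v ∣ * ∣ S ∖ v ∣ + 2)
        bound e ke = subst₂ (λ n t → 6 * t + n * k ≤ 6 * n + (n * n + 2)) (sym size′) (sym (trans total (cong (_+ R) size′)))
          (subst (λ q → 6 * (3 + e + m + R) + (3 + e + m) * q ≤ 6 * (3 + e + m) + ((3 + e + m) * (3 + e + m) + 2)) (sym ke) (≤-from-slack (e * m) 6R≤ (poly e m R)))
          where
          m = ∣ X ∣
          size′ : ∣ S ∖ v ∣ ≡ 3 + e + m
          size′ = trans size (cong (_+ m) ke)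

    private
      n′ = ∣ S ∣ ∸ 1
      n≡ : ∣ S ∣ ≡ suc n′
      n≡ = pred′ (≤-trans (s≤s z≤n) 5≤)
        where
        pred′ : ∀ {n} → 1 ≤ n → n ≡ suc (n ∸ 1)
        pred′ {suc n} _ = refl
      B = 6 * n′ + (n′ * n′ + 2)
      P = wiener d S

      cell : ∀ u → 6 * (𝟙 (S u) * status S u) + n′ * (𝟙 (S u) * ∑ (λ v → 𝟙 (S v) * adj d u v)) ≤ B * 𝟙 (S u)
      cell u = go (u ∈? S)
        where
        deg : ∑ (λ v → 𝟙 (S v) * adj d u v) ≡ ∣ Lev S (d u) 1 ∣
        deg = ∑-cong (λ v → pt (S v) (does (d u v ℕ.≟ 1)))
          where
          pt : ∀ a b → 𝟙 a * 𝟙 b ≡ 𝟙 (does (a Bool.≟ true) ∧ b)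
          pt true true = refl
          pt true false = refl
          pt false b = refl
        go : Dec (u ∈ S) → 6 * (𝟙 (S u) * status S u) + n′ * (𝟙 (S u) * ∑ (λ v → 𝟙 (S v) * adj d u v)) ≤ B * 𝟙 (S u)
        go (no n) = ≤-trans (≤-reflexive (trans (cong (λ b → 6 * (b * status S u) + n′ * (b * ∑ (λ v → 𝟙 (S v) * adj d u v))) (𝟙≡0 n)) (*-zeroʳ n′))) z≤n
        go (yes uS) = subst (λ b → 6 * (b * status S u) + n′ * (b * ∑ (λ v → 𝟙 (S v) * adj d u v)) ≤ B * b) (sym (𝟙≡1 uS))
          (≤-trans (≤-reflexive (cong₂ (λ a b → 6 * a + n′ * b) (*-identityˡ (status S u)) (trans (*-identityˡ _) deg)))
            (≤-trans (subst (λ n → 6 * status S u + n * ∣ Lev S (d u) 1 ∣ ≤ 6 * n + (n * n + 2)) (suc-injective (trans (sym (card-∖ S uS)) n≡)) (Row₃.row uS))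
              (≤-reflexive (sym (*-identityʳ B)))))

      summed : 6 * P + n′ * degrees S ≤ B * suc n′
      summed = begin
        6 * P + n′ * degrees S                   ≡⟨ sym (trans (∑-+ f g) (cong₂ _+_ (∑-* 6 (λ u → 𝟙 (S u) * status S u)) (∑-* n′ (λ u → 𝟙 (S u) * ∑ (λ v → 𝟙 (S v) * adj d u v))))) ⟩
        ∑ (λ u → f u + g u)                      ≤⟨ ∑-mono cell ⟩
        ∑ (λ u → B * 𝟙 (S u))                    ≡⟨ trans (∑-* B (𝟙 ∘ S)) (cong (B *_) n≡) ⟩
        B * suc n′                               ∎
        where
        open ≤-Reasoning
        f g : Fin N → ℕ
        f u = 6 * (𝟙 (S u) * status S u)
        g u = n′ * (𝟙 (S u) * ∑ (λ v → 𝟙 (S v) * adj d u v))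

      6P≤ : 6 * P ≤ n′ * (n′ * n′) + 3 * (n′ * n′) + 12 * n′ + 2
      6P≤ = ≤-from-slack 0 summed (trans (eq₁ (6 * P) n′) (trans (cong (λ z → n′ * z + (6 * P + (n′ * (n′ * n′) + 3 * (n′ * n′) + 4 * n′ + 2))) (trans (cong (4 *_) (sym n≡)) tight)) (eq₂ (6 * P) n′ (degrees S))))
        where
        eq₁ : ∀ p n → p + (6 * n + (n * n + 2)) * suc n + 0 ≡ n * (4 * suc n) + (p + (n * (n * n) + 3 * (n * n) + 4 * n + 2))
        eq₁ = solve-∀
        eq₂ : ∀ p n D → n * (D + 8) + (p + (n * (n * n) + 3 * (n * n) + 4 * n + 2)) ≡ n * (n * n) + 3 * (n * n) + 12 * n + 2 + (p + n * D)
        eq₂ = solve-∀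

    absurd : ⊥
    absurd with parity n′
    ... | inj₁ (zero , e) = <⇒≱ (≤-trans (s≤s (s≤s z≤n)) 5≤) (≤-reflexive (trans n≡ (cong suc e)))
    ... | inj₁ (suc i , e) = bad (goal-odd {P = P} (suc i) (trans n≡ (cong suc e))
          (*-cancelˡ-≤ 2 (≤-from-slack (4 * i + 2) (subst (λ n → 6 * P ≤ n * (n * n) + 3 * (n * n) + 12 * n + 2) e 6P≤) (eq P i))))
      where
      eq : ∀ p i → 2 * (3 * p) + ((suc i + suc i) * ((suc i + suc i) * (suc i + suc i)) + 3 * ((suc i + suc i) * (suc i + suc i)) + 12 * (suc i + suc i) + 2) + (4 * i + 2)
           ≡ 2 * (4 * (suc i * (suc i * suc i)) + 6 * (suc i * suc i) + 14 * suc i) + 6 * p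
      eq = solve-∀
    ... | inj₂ (zero , e) = <⇒≱ (≤-trans (s≤s (s≤s (s≤s z≤n))) 5≤) (≤-reflexive (trans n≡ (cong suc e)))
    ... | inj₂ (suc i , e) = bad (goal-even {P = P} (2 + i) (trans n≡ (trans (cong suc e) (r i)))
          (*-cancelˡ-≤ 2 (≤-from-slack (10 * i + 4) (subst (λ n → 6 * P ≤ n * (n * n) + 3 * (n * n) + 12 * n + 2) e 6P≤) (eq P i))))
      where
      r : ∀ i → suc (suc (suc i + suc i)) ≡ (2 + i) + (2 + i)
      r = solve-∀
      eq : ∀ p i → 2 * (3 * p + 12) + (suc (suc i + suc i) * (suc (suc i + suc i) * suc (suc i + suc i)) + 3 * (suc (suc i + suc i) * suc (suc i + suc i)) + 12 * suc (suc i + suc i) + 2) + (10 * i + 4)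
           ≡ 2 * (4 * ((2 + i) * ((2 + i) * (2 + i))) + 14 * (2 + i)) + 6 * p
      eq = solve-∀

  sphere-bound : ∀ fuel S nx → Surf d S nx → 4 * ∣ S ∣ ≡ degrees S + 8 → 4 ≤ ∣ S ∣ → ∣ S ∣ < fuel → Goal ∣ S ∣ (wiener d S)
  sphere-bound (suc fuel) S nx G tight 4≤ lt with ∣ S ∣ ℕ.≟ 4
  ... | yes e = small-case G e
  ... | no ne = goal-stable {P = wiener d S} (Wide.absurd G tight (≤∧≢⇒< 4≤ (ne ∘ sym))
        (λ S′ nx′ G′ t′ 4≤′ lt′ → sphere-bound fuel S′ nx′ G′ t′ 4≤′ (<-≤-trans lt′ (≤-pred lt))))

-- Rotation systems

length-filter : ∀ {n} {A : Set} {P : A → Set} (P? : ∀ x → Dec (P x)) (h : Fin n → A) →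
                length (filter P? (tabulate h)) ≡ ∑ (λ i → 𝟙 (does (P? (h i))))
length-filter {zero}  P? h = refl
length-filter {suc n} P? h with P? (h zero)
... | yes _ = cong suc (length-filter P? (h ∘ suc))
... | no _  = length-filter P? (h ∘ suc)

sum-map-filter : ∀ {n} {A : Set} {P : A → Set} (P? : ∀ x → Dec (P x)) (g : A → ℕ) (h : Fin n → A) →
                 sum (map g (filter P? (tabulate h))) ≡ ∑ (λ i → 𝟙 (does (P? (h i))) * g (h i))
sum-map-filter {zero}  P? g h = refl
sum-map-filter {suc n} P? g h with P? (h zero)
... | yes _ = cong₂ _+_ (sym (+-identityʳ (g (h zero)))) (sum-map-filter P? g (h ∘ suc))
... | no _  = sum-map-filter P? g (h ∘ suc)

sum-concatMap : ∀ {n} {A : Set} (k : A → List ℕ) (h : Fin n → A) →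
                sum (concatMap k (tabulate h)) ≡ ∑ (λ i → sum (k (h i)))
sum-concatMap {zero}  k h = refl
sum-concatMap {suc n} k h = trans (sum-++ (k (h zero)) _) (cong (sum (k (h zero)) +_) (sum-concatMap k (h ∘ suc)))

pairSum-double : ∀ n (f : Fin n → Fin n → ℕ) → (∀ u v → f u v ≡ f v u) → (∀ u → f u u ≡ 0) →
                 pairSum n f + pairSum n f ≡ ∑ (λ u → ∑ (f u))
pairSum-double n f f-sym f-diag = begin
  pairSum n f + pairSum n f                          ≡⟨ cong₂ _+_ as-∑ as-∑ ⟩
  ∑ (λ u → ∑ (k u)) + ∑ (λ u → ∑ (k u))              ≡⟨ cong (∑ (λ u → ∑ (k u)) +_) (∑-swap k) ⟩
  ∑ (λ u → ∑ (k u)) + ∑ (λ u → ∑ (λ v → k v u))      ≡⟨ sym (∑-+ (λ u → ∑ (k u)) (λ u → ∑ (λ v → k v u))) ⟩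
  ∑ (λ u → ∑ (k u) + ∑ (λ v → k v u))                ≡⟨ ∑-cong (λ u → trans (sym (∑-+ (k u) (λ v → k v u))) (∑-cong (cell u))) ⟩
  ∑ (λ u → ∑ (f u))                                  ∎
  where
  open ≡-Reasoning
  k : Fin n → Fin n → ℕ
  k u v = 𝟙 (does (toℕ u <? toℕ v)) * f u v
  as-∑ : pairSum n f ≡ ∑ (λ u → ∑ (k u))
  as-∑ = trans (sum-concatMap (λ u → map (λ v → f u v) (filter (λ v → toℕ u <? toℕ v) (allFin n))) id)
               (∑-cong (λ u → sum-map-filter (λ v → toℕ u <? toℕ v) (f u) id))
  cell : ∀ u v → k u v + k v u ≡ f u v
  cell u v with <-cmp (toℕ u) (toℕ v)
  ... | tri< a _ b rewrite dec-true (toℕ u <? toℕ v) a | dec-false (toℕ v <? toℕ u) b = trans (+-identityʳ _) (+-identityʳ _)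
  ... | tri> a _ b rewrite dec-false (toℕ u <? toℕ v) a | dec-true (toℕ v <? toℕ u) b = trans (+-identityʳ _) (f-sym v u)
  ... | tri≈ a e b rewrite dec-false (toℕ u <? toℕ v) a | dec-false (toℕ v <? toℕ u) b | toℕ-injective e = sym (f-diag v)

module Conversion {n} (Q : Quadrangulation n) (dist : Fin n → Fin n → ℕ)
                  (isDist : Quadrangulation.IsDistance Q dist) where
  open Quadrangulation Q renaming (M to map′)

  walk : ∀ u v → Walk (dist u v) u v
  walk u v = proj₁ (isDist u v)

  shortest : ∀ {k u v} → Walk k u v → dist u v ≤ k
  shortest {k} {u} {v} = proj₂ (isDist u v) k

  _++ʷ_ : ∀ {k l u v w} → Walk k u v → Walk l v w → Walk (k + l) u w
  here _   ++ʷ q = q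
  step e p ++ʷ q = step e (p ++ʷ q)

  edge : ∀ e → Walk 1 (tail e) (head e)
  edge e = step e (here (head e))

  back : ∀ e → Walk 1 (head e) (tail e)
  back e = subst (Walk 1 (head e)) (cong tail (α-invol e)) (edge (α e))

  reverse : ∀ {k u v} → Walk k u v → Walk k v u
  reverse (here u) = here u
  reverse {suc k} {v = v} (step e p) = subst (λ l → Walk l v (tail e)) (+-comm k 1) (reverse p ++ʷ back e)

  metric : Metric dist
  metric = record
    { d-refl = λ u → n≤0⇒n≡0 (shortest (here u))
    ; d-zero = λ {u} {v} e → zero-walk (subst (λ k → Walk k u v) e (walk u v))
    ; d-sym = λ u v → ≤-antisym (shortest (reverse (walk v u))) (shortest (reverse (walk u v)))
    ; d-tri = λ u v w → shortest (walk u v ++ʷ walk v w) }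
    where
    zero-walk : ∀ {u v} → Walk 0 u v → u ≡ v
    zero-walk (here _) = refl

  open Metric metric

  dart-dist : ∀ e → dist (tail e) (head e) ≡ 1
  dart-dist e = ≤-antisym (shortest (edge e)) (n≢0⇒n>0 (λ z → proj₁ simple e (d-zero z)))

  DartFrom : Fin n → Fin n → Set
  DartFrom u v = ∃ λ e → tail e ≡ u × head e ≡ v

  DartFrom? : ∀ u v → Dec (DartFrom u v)
  DartFrom? u v = any? (λ e → (tail e ≟F u) ×-dec (head e ≟F v))

  the-dart : ∀ {u v} → dist u v ≡ 1 → DartFrom u v
  the-dart {u} {v} e = one-step (subst (λ k → Walk k u v) e (walk u v))
    where
    one-step : ∀ {u v} → Walk 1 u v → DartFrom u v
    one-step (step e (here _)) = e , refl , refl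

  dart-unique : ∀ {e f} → tail e ≡ tail f → head e ≡ head f → e ≡ f
  dart-unique {e} {f} = proj₂ simple e f

  nx₀ : Fin n → Fin n → Fin n
  nx₀ u v with DartFrom? u v
  ... | yes (e , _) = head (φ e)
  -- A default value: every use concerns vertices at distance 1, and these are joined by a dart.
  ... | no _ = u

  nx-dart : ∀ e → nx₀ (tail e) (head e) ≡ head (φ e)
  nx-dart e with DartFrom? (tail e) (head e)
  ... | yes (f , p , q) = cong (head ∘ φ) (dart-unique p q)
  ... | no none = ⊥-elim (none (e , refl , refl))

  tail-φ : ∀ e → tail (φ e) ≡ head e
  tail-φ e = σ-tail (α e)

  nx-φ : ∀ e → nx₀ (head e) (head (φ e)) ≡ head (φ (φ e))
  nx-φ e = trans (cong (λ z → nx₀ z (head (φ e))) (sym (tail-φ e))) (nx-dart (φ e))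

  Full : Sub n
  Full _ = true

  surface : Surf dist Full nx₀
  surface = record
    { geo = λ {u} {v} _ _ ne → first-step ne (walk u v) refl
    ; nx-in = λ _ _ _ → refl
    ; nx-adj = λ _ _ e → adj′ (the-dart e)
    ; nx-per = λ _ _ e → per (the-dart e)
    ; nx-ne = λ _ _ e → ne (the-dart e)
    ; link = λ {v} _ g cl {x} {y} _ xv xg _ yv → around g cl (the-dart xv) (the-dart yv) xg }
    where
    first-step : ∀ {u v k} → u ≢ v → Walk k u v → k ≡ dist u v → ∃ λ w → w ∈ Full × dist u w ≡ 1 × suc (dist w v) ≡ dist u v
    first-step ne (here _) _ = ⊥-elim (ne refl)
    first-step {v = v} ne (step {k} e p) eq = head e , refl , dart-dist e ,
      ≤-antisym (≤-trans (s≤s (shortest p)) (≤-reflexive eq)) (shortest (step e (walk (head e) v)))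
    adj′ : ∀ {u v} → DartFrom u v → dist v (nx₀ u v) ≡ 1
    adj′ (e , refl , refl) = subst₂ (λ a b → dist a b ≡ 1) (tail-φ e) (sym (nx-dart e)) (dart-dist (φ e))
    per : ∀ {u v} → DartFrom u v → nx₀ (nx₀ u v) (nx₀ v (nx₀ u v)) ≡ u
    per (e , refl , refl) = begin
      nx₀ (nx₀ (tail e) (head e)) (nx₀ (head e) (nx₀ (tail e) (head e)))  ≡⟨ cong (λ w → nx₀ w (nx₀ (head e) w)) (nx-dart e) ⟩
      nx₀ (head (φ e)) (nx₀ (head e) (head (φ e)))       ≡⟨ cong (nx₀ (head (φ e))) (nx-φ e) ⟩
      nx₀ (head (φ e)) (head (φ (φ e)))                  ≡⟨ nx-φ (φ e) ⟩
      head (φ (φ (φ e)))                                 ≡⟨ sym (tail-φ (φ (φ (φ e)))) ⟩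
      tail (φ (φ (φ (φ e))))                             ≡⟨ cong tail (proj₁ (faces4 e)) ⟩
      tail e                                             ∎
      where open ≡-Reasoning
    ne : ∀ {u v} → DartFrom u v → nx₀ u v ≢ u
    ne (e , refl , refl) h = proj₁ (proj₂ (proj₂ (proj₂ (proj₂ (faces4 e)))))
      (trans (sym h) (trans (nx-dart e) (sym (tail-φ (φ e)))))
    around : ∀ {x y v} (g : Sub n) → (∀ {x} → x ∈ Full → dist x v ≡ 1 → x ∈ g → nx₀ x v ∈ g) →
             DartFrom x v → DartFrom y v → x ∈ g → y ∈ g
    around {v = v} g cl (e , refl , refl) (f , refl , q) xg =
      subst (_∈ g) (cong tail (α-invol f)) (subst (λ z → head z ∈ g) (proj₂ turn) (go (proj₁ turn)))
      where
      turn : ∃ λ k → iter σ k (α e) ≡ α f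
      turn = σ-trans (α e) (α f) (sym q)
      tail-iter : ∀ k → tail (iter σ k (α e)) ≡ head e
      tail-iter zero = refl
      tail-iter (suc k) = trans (σ-tail (iter σ k (α e))) (tail-iter k)
      -- Read on heads, the rotation `σ` at v is `nx₀`: the dart from v to x is followed by the one
      -- from v to `nx₀ x v`.
      go : ∀ k → head (iter σ k (α e)) ∈ g
      go zero = subst (_∈ g) (cong tail (sym (α-invol e))) xg
      go (suc k) = subst (_∈ g) (trans (cong (nx₀ (head c)) (sym h)) (trans (nx-dart (α c)) (cong (head ∘ σ) (α-invol c))))
                     (cl refl (trans (cong (dist (head c)) (sym h)) (dart-dist (α c))) (go k))
        where
        c = iter σ k (α e)
        h : head (α c) ≡ head e
        h = trans (cong tail (α-invol c)) (tail-iter k)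

  open Orbit4 {D} (λ _ → true) φ (λ _ → refl) (λ {e} _ → proj₁ (faces4 e)) (λ {e} _ → proj₁ (proj₂ (proj₂ (faces4 e)))) using (rep; Rep?; four-reps)

  D≡4reps : D ≡ 4 * ∣ rep ∣
  D≡4reps = begin
    D                                             ≡⟨ sym (*-identityʳ D) ⟩
    D * 1                                         ≡⟨ sym (∑-const D 1) ⟩
    ∑ {D} (λ _ → 1)                               ≡⟨ four-reps (λ _ → 1) (λ _ → refl) ⟩
    4 * ∑ (λ i → 1 * (1 * 𝟙 (rep i)))             ≡⟨ cong (4 *_) (∑-cong (λ i → trans (*-identityˡ (1 * 𝟙 (rep i))) (*-identityˡ (𝟙 (rep i))))) ⟩
    4 * ∣ rep ∣                                   ∎
    where open ≡-Reasoning

  -- `faceRep?` inspects only the iterates with index below D, and the comparison with `Rep?` needs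
  -- the indices up to 3.
  4≤D : Fin D → 4 ≤ D
  4≤D e = subst (4 ≤_) (sym D≡4reps) (*-monoʳ-≤ 4 {1} {∣ rep ∣} (n≢0⇒n>0 (λ z → empty (trans D≡4reps (cong (4 *_) z)) e)))
    where
    empty : ∀ {m} → m ≡ 0 → Fin m → ⊥
    empty refl ()

  faceCount≡ : faceCount ≡ ∣ rep ∣
  faceCount≡ = trans (length-filter faceRep? id) (∑-cong (λ e → 𝟙-dec (faceRep? e) (Rep? e) (to e) (from e)))
    where
    to : ∀ e → (∀ k → k < D → toℕ e ≤ toℕ (iter φ k e)) → toℕ e ≤ toℕ (φ e) × toℕ e ≤ toℕ (φ (φ e)) × toℕ e ≤ toℕ (φ (φ (φ e)))
    to e h = h 1 (≤-trans (s≤s (s≤s z≤n)) (4≤D e)) , h 2 (≤-trans (s≤s (s≤s (s≤s z≤n))) (4≤D e)) , h 3 (4≤D e)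
    from : ∀ e → toℕ e ≤ toℕ (φ e) × toℕ e ≤ toℕ (φ (φ e)) × toℕ e ≤ toℕ (φ (φ (φ e))) → ∀ k → k < D → toℕ e ≤ toℕ (iter φ k e)
    from e (a , b , c) k _ = all k
      where
      all : ∀ k → toℕ e ≤ toℕ (iter φ k e)
      all 0 = ≤-refl
      all 1 = a
      all 2 = b
      all 3 = c
      all (suc (suc (suc (suc k)))) = subst (λ z → toℕ e ≤ toℕ z) (sym (proj₁ (faces4 (iter φ k e)))) (all k)

  open Cotree metric surface using (al; Dart?)
  open Surface metric surface using (Dart; dart)

  -- Since the graph is simple, each ordered pair at distance 1 carries exactly one dart.
  ∣al∣≡D : ∣ al ∣ ≡ D
  ∣al∣≡D = begin
    ∣ al ∣                                                   ≡⟨ Code.card-coded n Dart? ⟩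
    ∑ (λ u → ∑ (λ v → 𝟙 (does (Dart? u v))))                 ≡⟨ ∑-cong (λ u → ∑-cong (cell u)) ⟩
    ∑ (λ u → ∑ (λ v → ∑ (λ e → t e u v)))                    ≡⟨ ∑-cong (λ u → ∑-swap (λ v e → t e u v)) ⟩
    ∑ (λ u → ∑ (λ e → ∑ (t e u)))                            ≡⟨ ∑-swap (λ u e → ∑ (t e u)) ⟩
    ∑ (λ e → ∑ (λ u → ∑ (t e u)))                            ≡⟨ ∑-cong single ⟩
    ∑ {D} (λ _ → 1)                                          ≡⟨ trans (∑-const D 1) (*-identityʳ D) ⟩
    D                                                        ∎
    where
    open ≡-Reasoning
    t : Fin D → Fin n → Fin n → ℕ
    t e u v = 𝟙 (does (u ≟F tail e)) * (𝟙 (does (v ≟F head e)) * 1)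
    single : ∀ e → ∑ (λ u → ∑ (t e u)) ≡ 1
    single e = trans (∑-cong (λ u → trans (∑-* (𝟙 (does (u ≟F tail e))) (λ v → 𝟙 (does (v ≟F head e)) * 1)) (cong (𝟙 (does (u ≟F tail e)) *_) (∑-δ (head e) (λ _ → 1)))))
                     (∑-δ (tail e) (λ _ → 1))
    t-zero : ∀ {e u v} → ¬ (tail e ≡ u × head e ≡ v) → t e u v ≡ 0
    t-zero {e} {u} {v} no′ with u ≟F tail e | v ≟F head e
    ... | yes p | yes q = ⊥-elim (no′ (sym p , sym q))
    ... | yes p | no q = refl
    ... | no p | _ = refl
    cell : ∀ u v → 𝟙 (does (Dart? u v)) ≡ ∑ (λ e → t e u v)
    cell u v = go (DartFrom? u v)
      where
      go : Dec (DartFrom u v) → 𝟙 (does (Dart? u v)) ≡ ∑ (λ e → t e u v)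
      go (no none) = trans (cong 𝟙 (dec-false (Dart? u v) (λ { (dart _ _ a) → none (the-dart a) })))
        (sym (trans (∑-cong (λ e → t-zero (λ p → none (e , p)))) (∑-zero D)))
      go (yes (e , refl , refl)) = trans (cong 𝟙 (dec-true (Dart? u v) (dart refl refl (dart-dist e))))
        (sym (trans (∑-cong only) (∑-δ e (λ _ → 1))))
        where
        only : ∀ f → t f (tail e) (head e) ≡ 𝟙 (does (f ≟F e)) * 1
        only f with f ≟F e
        ... | yes refl rewrite dec-true (tail e ≟F tail e) refl | dec-true (head e ≟F head e) refl = refl
        ... | no ne = t-zero (λ (p , q) → ne (dart-unique p q))

  ∣Full∣≡n : ∣ Full ∣ ≡ n
  ∣Full∣≡n = trans (∑-const n 1) (*-identityʳ n)

  euler-tight : 4 * ∣ Full ∣ ≡ ∣ al ∣ + 8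
  euler-tight = +-cancelʳ-≡ D _ _ (begin
    4 * ∣ Full ∣ + D                 ≡⟨ cong₂ (λ a b → 4 * a + b) ∣Full∣≡n (trans D≡4reps (cong (4 *_) (sym faceCount≡))) ⟩
    4 * n + 4 * faceCount            ≡⟨ r₁ n faceCount ⟩
    2 * (2 * (n + faceCount))        ≡⟨ cong (2 *_) planar ⟩
    2 * (D + 4)                      ≡⟨ r₂ D ⟩
    D + 8 + D                        ≡⟨ cong (λ z → z + 8 + D) (sym ∣al∣≡D) ⟩
    ∣ al ∣ + 8 + D                   ∎)
    where
    open ≡-Reasoning
    r₁ : ∀ n f → 4 * n + 4 * f ≡ 2 * (2 * (n + f))
    r₁ = solve-∀
    r₂ : ∀ D → 2 * (D + 4) ≡ D + 8 + D
    r₂ = solve-∀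

  bip : Bip dist
  bip {u} {v} r e = Bipartite.bipartite metric surface {r} refl euler-tight (dart refl refl e)

  goal : 4 ≤ n → Goal n (Wiener n dist + Wiener n dist)
  goal 4≤n = subst₂ Goal ∣Full∣≡n total
    (Induction.sphere-bound metric bip (suc ∣ Full ∣) Full nx₀ surface
      (trans euler-tight (cong (_+ 8) (Sizes.al≡degrees metric bip surface)))
      (subst (4 ≤_) (sym ∣Full∣≡n) 4≤n) ≤-refl)
    where
    total : wiener dist Full ≡ Wiener n dist + Wiener n dist
    total = trans (∑-cong (λ u → trans (*-identityˡ _) (∑-cong (λ v → *-identityˡ (dist u v)))))
                  (sym (pairSum-double n dist d-sym d-refl))

-- From the scaled bound back to the statement

Goal⇒bounds : ∀ n W → Goal n (W + W) →
    (n % 2 ≡ 0 → 12 * W + 24 ≤ n ^ 3 + 14 * n) ×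
    (n % 2 ≡ 1 → 12 * W + 12 ≤ n ^ 3 + 11 * n)
Goal⇒bounds n W (ge , go) with parity n
... | inj₁ (k , refl) =
  (λ _ → ≤-from-slack 0 (*-monoʳ-≤ 2 (ge k refl)) (eq W k)) ,
  (λ e → case trans (sym (trans (cong (_% 2) (double k)) ([m+kn]%n≡m%n 0 k 2))) e of λ ())
  where
  double : ∀ k → k + k ≡ 0 + k * 2
  double = solve-∀
  eq : ∀ W k → 12 * W + 24 + 2 * (4 * (k * (k * k)) + 14 * k) + 0
       ≡ (k + k) * ((k + k) * ((k + k) * 1)) + 14 * (k + k) + 2 * (3 * (W + W) + 12)
  eq = solve-∀
... | inj₂ (k , refl) =
  (λ e → case trans (sym (trans (cong (_% 2) (double k)) ([m+kn]%n≡m%n 1 k 2))) e of λ ()) ,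
  (λ _ → ≤-from-slack 0 (*-monoʳ-≤ 2 (go k refl)) (eq W k))
  where
  double : ∀ k → suc (k + k) ≡ 1 + k * 2
  double = solve-∀
  eq : ∀ W k → 12 * W + 12 + 2 * (4 * (k * (k * k)) + 6 * (k * k) + 14 * k) + 0
       ≡ suc (k + k) * (suc (k + k) * (suc (k + k) * 1)) + 11 * suc (k + k) + 2 * (3 * (W + W))
  eq = solve-∀

theorem2 : (n : ℕ) → 4 ≤ n → (G : Quadrangulation n) →
    (dist : Fin n → Fin n → ℕ) → Quadrangulation.IsDistance G dist →
    (n % 2 ≡ 0 → 12 * Wiener n dist + 24 ≤ n ^ 3 + 14 * n) ×
    (n % 2 ≡ 1 → 12 * Wiener n dist + 12 ≤ n ^ 3 + 11 * n)
theorem2 n 4≤n G dist isDist = Goal⇒bounds n (Wiener n dist) (Conversion.goal G dist isDist 4≤n)
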